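{- Let $\lambda/\mu$ and $\nu/\rho$ be skew shapes and let $D$ be the shuffle diagram of shape $(\lambda/\mu)\circledast(\nu/\rho)$. For every partition $\kappa$, the Littlewood--Richardson coefficient $c^{\kappa}_{\lambda/\mu,\nu/\rho}$ equals the number of $D$-peelable tableaux of shape $\kappa$.
   Context: Young diagrams are drawn in English convention: position $(i,j)$ is row $i$ (rows numbered top to bottom) and column $j$ (columns numbered left to right). The shuffle diagram $D$ of shape $(\lambda/\mu)\circledast(\nu/\rho)$ is the set of squares consisting of a square at position $(2i-1,2j-1)$ for every square $(i,j)$ of $\lambda/\mu$ and a square at position $(2i,2j)$ for every square $(i,j)$ of $\nu/\rho$. Thus row $2i-1$ of $D$ has $\lambda_i-\mu_i$ squares and row $2i$ has $\nu_i-\rho_i$ squares. For $i\ge 1$ let $a_i$ be the number of columns of $D$ that contain a square in row $i$ and a square in row $i+2$. A $D$-peelable tableau is a semistandard Young tableau $T$ (of some partition shape) whose content is $(\lambda_1-\mu_1,\nu_1-\rho_1,\lambda_2-\mu_2,\nu_2-\rho_2,\ldots)$ (i.e. the number of entries equal to $r$ is the number of squares in row $r$ of $D$), such that for every $i\ge1$ there are at least $a_i$ pairwise disjoint pairs (a square of $T$ containing $i$, a square of $T$ containing $i+2$) in which the $i$-square lies Northeast of the $(i+2)$-square, i.e. in a row weakly above and a column weakly to the right of it. The coefficient $c^{\kappa}_{\lambda/\mu,\nu/\rho}$ is defined by $s_{\lambda/\mu}s_{\nu/\rho}=\sum_\kappa c^{\kappa}_{\lambda/\mu,\nu/\rho}s_\kappa$,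 where $s$ denotes (skew) Schur functions. -}

module Defs where

open import Data.Nat using (ℕ; zero; suc; _+_; _*_; _∸_; _≤_; _≡ᵇ_; _≤ᵇ_; _<ᵇ_)
open import Data.Bool using (Bool; true; false; _∧_; _∨_; not; if_then_else_)
open import Data.List using (List; []; _∷_; map; concatMap; upTo; length; filterᵇ; zip; zipWith)
open import Data.Bool.ListAction using (all; any)
open import Data.Nat.ListAction using (sum)
open import Data.Product using (_×_; _,_; proj₁; proj₂)

part : List ℕ → ℕ → ℕ
part []       _       = 0
part (x ∷ xs) zero    = x
part (x ∷ xs) (suc i) = part xs i

IsPartition : List ℕ → Set
IsPartition λ' = ∀ i → part λ' (suc i) ≤ part λ' i

_⊆ₚ_ : List ℕ → List ℕ → Set
μ ⊆ₚ λ' = ∀ i → part μ i ≤ part λ' i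

Cell : Set
Cell = ℕ × ℕ   -- (row , column), 0-indexed, English convention

range : ℕ → ℕ → List ℕ
range a b = map (a +_) (upTo (b ∸ a))

cells : List ℕ → List ℕ → List Cell
cells λ' μ = concatMap (λ r → map (λ c → (r , c)) (range (part μ r) (part λ' r))) (upTo (length λ'))

listsOver : ℕ → List ℕ → List (List ℕ)
listsOver zero    xs = [] ∷ []
listsOver (suc k) xs = concatMap (λ x → map (x ∷_) (listsOver k xs)) xs

Filled : Set
Filled = Cell × ℕ

ssyt : List Filled → Bool
ssyt z = all (λ p → all (λ q → ok p q) z) z
  where
  ok : Filled → Filled → Bool
  ok ((r , c) , x) ((r' , c') , y) =
    (not ((r ≡ᵇ r') ∧ (c <ᵇ c')) ∨ (x ≤ᵇ y)) ∧
    (not ((c ≡ᵇ c') ∧ (r <ᵇ r')) ∨ (x <ᵇ y))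

content : ℕ → List ℕ → List ℕ
content n f = map (λ k → length (filterᵇ (λ x → x ≡ᵇ suc k) f)) (upTo n)

listEqᵇ : List ℕ → List ℕ → Bool
listEqᵇ []       []       = true
listEqᵇ (x ∷ xs) (y ∷ ys) = (x ≡ᵇ y) ∧ listEqᵇ xs ys
listEqᵇ _        _        = false

fillings : List ℕ → List ℕ → ℕ → List (List Filled)
fillings λ' μ n = map (zip (cells λ' μ)) (listsOver (length (cells λ' μ)) (map suc (upTo n)))

SSYTs : List ℕ → List ℕ → List ℕ → List (List Filled)
SSYTs λ' μ α = filterᵇ (λ z → ssyt z ∧ listEqᵇ (content (length α) (map proj₂ z)) α)
                       (fillings λ' μ (length α))

-- Polynomials in x₁,…,xₙ with ℕ coefficients, as coefficient functions:
-- `f α` is the coefficient of x^α in n = length α variables.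

Poly : Set
Poly = List ℕ → ℕ

-- skew Schur polynomial: s_{λ/μ}(x₁,…,xₙ) = Σ_{T ∈ SSYT(λ/μ, [n])} x^T
skewSchur : List ℕ → List ℕ → Poly
skewSchur λ' μ α = length (SSYTs λ' μ α)

belowVec : List ℕ → List (List ℕ)
belowVec []       = [] ∷ []
belowVec (a ∷ as) = concatMap (λ b → map (b ∷_) (belowVec as)) (upTo (suc a))

_·ₚ_ : Poly → Poly → Poly
(f ·ₚ g) α = sum (map (λ β → f β * g (zipWith _∸_ α β)) (belowVec α))

decreasingᵇ : List ℕ → Bool
decreasingᵇ []           = true
decreasingᵇ (x ∷ [])     = true
decreasingᵇ (x ∷ y ∷ xs) = (y ≤ᵇ x) ∧ decreasingᵇ (y ∷ xs)

partitionsOf : ℕ → List (List ℕ)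
partitionsOf N =
  filterᵇ (λ κ → decreasingᵇ κ ∧ (sum κ ≡ᵇ N))
          (concatMap (λ k → listsOver k (map suc (upTo N))) (upTo (suc N)))

shuffleDiagram : List ℕ → List ℕ → List ℕ → List ℕ → List Cell
shuffleDiagram λ' μ ν ρ =
  map (λ { (i , j) → (2 * i , 2 * j) }) (cells λ' μ) Data.List.++
  map (λ { (i , j) → (suc (2 * i) , suc (2 * j)) }) (cells ν ρ)

cellEqᵇ : Cell → Cell → Bool
cellEqᵇ (a , b) (c , d) = (a ≡ᵇ c) ∧ (b ≡ᵇ d)

memᵇ : Cell → List Cell → Bool
memᵇ p = any (cellEqᵇ p)

-- a_{r+1}: number of columns of D with a square in (1-indexed) rows r+1 and r+3
aCoeff : List Cell → ℕ → ℕ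
aCoeff D r = length (filterᵇ (λ { (r' , c) → (r' ≡ᵇ r) ∧ memᵇ (r + 2 , c) D }) D)

shuffleContent : List ℕ → List ℕ → List ℕ → List ℕ → List ℕ
shuffleContent λ' μ ν ρ =
  concatMap (λ i → (part λ' i ∸ part μ i) ∷ (part ν i ∸ part ρ i) ∷ [])
            (upTo (length λ' + length ν))

sublists : {A : Set} → List A → List (List A)
sublists []       = [] ∷ []
sublists (x ∷ xs) = let s = sublists xs in s Data.List.++ map (x ∷_) s

distinctᵇ : List Cell → Bool
distinctᵇ []       = true
distinctᵇ (p ∷ ps) = not (memᵇ p ps) ∧ distinctᵇ ps

-- for the entry value i = r+1: at least a_i pairwise disjoint pairs
-- (square with i, square with i+2), the i-square weakly NE of the (i+2)-square
peelCondition : List Cell → List Filled → ℕ → Bool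
peelCondition D z r =
  any (λ s → (aCoeff D r ≤ᵇ length s) ∧ distinctᵇ (map proj₁ s) ∧ distinctᵇ (map proj₂ s))
      (sublists cands)
  where
  cands : List (Cell × Cell)
  cands = concatMap (λ { ((rp , cp) , x) →
            concatMap (λ { ((rq , cq) , y) →
              if (x ≡ᵇ suc r) ∧ (y ≡ᵇ r + 3) ∧ (rp ≤ᵇ rq) ∧ (cq ≤ᵇ cp)
              then ((rp , cp) , (rq , cq)) ∷ [] else [] }) z }) z

peelableCount : List ℕ → List ℕ → List ℕ → List ℕ → List ℕ → ℕ
peelableCount λ' μ ν ρ κ =
  length (filterᵇ (λ z → all (peelCondition D z) (upTo (length w))) (SSYTs κ [] w))
  where
  D = shuffleDiagram λ' μ ν ρ
  w = shuffleContent λ' μ ν ρ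

{-# OPTIONS --safe #-}
module Submission where

-- Let row r of a filling of D consist of the columns in which a tableau Q has the entry r, in
-- decreasing order.  Q is D-peelable iff (Hall) this filling weakly decreases down the columns of
-- D, and Q is a tableau iff the reading of the rows of D, alternately from both components, is a
-- lattice word.  Behind the first excess of j+1 over j in this reading, the letters j and j+1 can
-- be exchanged by the Bender–Knuth involution: the rows just before the excess are such that the
-- column condition survives.  As in Stembridge's proof of the Littlewood–Richardson rule, the
-- alternants of the numbers of all fillings and of lattice fillings therefore agree, and the
-- fillings of D, as chains of vertical strips, are equinumerous with pairs of a D-peelable tableau
-- of shape κ and a filling of κ.  The relations Σ_j (−1)^j e_j h_{n−j} = 0 turn vertical strips
-- into horizontal ones, that is, into semistandard tableaux.

-- Why the exchange is possible with two components: let e_t be the excess of j+1 over j in the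
-- first t rows of the alternating reading. A row holds each letter at most once, so e grows by at
-- most 1 per row. If t is least with e_t > 0, then e_t = 1, e_(t-1) = 0 and e_(t-2) ≤ 0, so neither
-- of the last two rows, one from each component, contains j without j+1. These are the rows where
-- the untouched part of a component meets the exchanged part, and below such a row every outcome of
-- the exchange still fits. With three components the third row from the end would be uncontrolled.
-- As the excess is exactly 1, the exchange transposes two entries of β + δ and not of β; hence the
-- alternants. A straight shape κ has a single lattice filling. Subtracting from D all shapes κ,
-- weighted by their peelable counts, therefore cancels the lattice fillings content by content. The
-- difference of the numbers of all fillings is symmetric in β and has zero alternants, and this
-- forces it to vanish.

open import Defs
open import Data.Nat using (ℕ; zero; suc; _+_; _*_; _∸_; _≤_; _<_; _≥_; _>_; z≤n; s≤s; s≤s⁻¹; _≡ᵇ_; _≤ᵇ_; _<ᵇ_; _≤?_; _<?_; ⌊_/2⌋; ⌈_/2⌉)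
open import Data.Nat.Properties
open import Data.Nat.Tactic.RingSolver using (solve-∀)
open import Data.Nat.ListAction using (sum)
open import Data.Nat.ListAction.Properties using (sum-++; sum-↭)
open import Data.Bool using (Bool; true; false; _∧_; _∨_; not; if_then_else_; T; T?)
open import Data.Bool.ListAction using (all; any)
open import Data.Bool.Properties using (T-∧)
open import Data.Empty using (⊥; ⊥-elim)
open import Data.Unit using (⊤; tt)
open import Data.Integer using (ℤ; 0ℤ; 1ℤ; -1ℤ) renaming (+_ to pos; _+_ to _+ℤ_; _*_ to _*ℤ_; -_ to negℤ_; _-_ to _-ℤ_)
import Data.Integer.Properties as ℤ
import Data.Integer.Tactic.RingSolver as ℤR
open import Data.Product using (∃; _×_; _,_; proj₁; proj₂)
open import Data.Product.Properties using (≡-dec; ,-injectiveˡ; ,-injectiveʳ)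
open import Data.Sum using (_⊎_; inj₁; inj₂)
open import Data.List using (List; []; _∷_; map; concatMap; upTo; length; filterᵇ; filter; zip; zipWith; _++_; applyUpTo; cartesianProduct)
import Data.List.Properties as List
open import Data.List.Membership.Propositional using (_∈_; _∉_; find; lose)
open import Data.List.Membership.Propositional.Properties
open import Data.List.Relation.Unary.Any using (Any; here; there)
open import Data.List.Relation.Unary.All using (All; []; _∷_)
import Data.List.Relation.Unary.Any as Any using (map)
import Data.List.Relation.Unary.Any.Properties as Any using (any⁺; any⁻)
import Data.List.Relation.Unary.All as All
import Data.List.Relation.Unary.All.Properties as All
open import Data.List.Relation.Unary.AllPairs using ([]; _∷_)
open import Data.List.Relation.Unary.Unique.Propositional using (Unique)
import Data.List.Relation.Unary.Unique.Propositional.Properties as Unique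
open import Data.List.Relation.Unary.Linked using (Linked; []; [-]; _∷_; linked?)
open import Data.List.Relation.Binary.Pointwise using (Pointwise; []; _∷_)
import Data.List.Relation.Binary.Pointwise as PW
open import Data.List.Relation.Binary.Permutation.Propositional as Perm using (_↭_; ↭-sym; ↭-trans; ↭-refl)
import Data.List.Relation.Binary.Permutation.Propositional.Properties as PermP
open import Function using (_∘_; id; case_of_; Equivalence)
open import Relation.Nullary using (¬_; Dec; yes; no)
open import Relation.Nullary.Decidable using (_×-dec_; ¬?; map′)
open import Relation.Unary using (Decidable)
open import Relation.Binary.Definitions using (DecidableEquality; tri<; tri≈; tri>)
open import Relation.Binary.PropositionalEquality using (_≡_; _≢_; refl; sym; trans; cong; cong₂; subst; subst₂; module ≡-Reasoning)
open import Algebra.Properties.CommutativeSemigroup +-commutativeSemigroup using (x∙yz≈y∙xz; x∙yz≈z∙yx) renaming (interchange to +-interchange)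
open import Algebra.Properties.CommutativeSemigroup ℤ.+-commutativeSemigroup using () renaming (interchange to +ℤ-interchange)
open import Algebra.Properties.CommutativeSemigroup ℤ.*-commutativeSemigroup using () renaming (interchange to *ℤ-interchange)

-- Counting and finite sums

private variable
  Elt Elt′ : Set

unique-⊆⇒length-≤ : {xs ys : List Elt} → Unique xs → (∀ {x} → x ∈ xs → x ∈ ys) → length xs ≤ length ys
unique-⊆⇒length-≤ [] _ = z≤n
unique-⊆⇒length-≤ {xs = x ∷ xs} (x∉ ∷ u) sub with ∈-∃++ (sub (here refl))
... | as , bs , refl = subst (suc (length xs) ≤_) (sym eq) (s≤s (unique-⊆⇒length-≤ u sub′))
  where
  eq : length (as ++ x ∷ bs) ≡ suc (length (as ++ bs))
  eq = trans (List.length-++ as) (trans (+-suc (length as) (length bs)) (cong suc (sym (List.length-++ as))))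
  sub′ : ∀ {y} → y ∈ xs → y ∈ as ++ bs
  sub′ y∈ with ∈-++⁻ as (sub (there y∈))
  ... | inj₁ p = ∈-++⁺ˡ p
  ... | inj₂ (here refl) = ⊥-elim (All.lookup x∉ y∈ refl)
  ... | inj₂ (there p) = ∈-++⁺ʳ as p

map-unique : {xs : List Elt} (f : Elt → Elt′) → Unique xs →
  (∀ {a b} → a ∈ xs → b ∈ xs → f a ≡ f b → a ≡ b) → Unique (map f xs)
map-unique f [] inj = []
map-unique {xs = x ∷ xs} f (x∉ ∷ u) inj =
  All.tabulate (λ y∈ fx≡y → case ∈-map⁻ f y∈ of λ { (z , z∈ , refl) →
    All.lookup x∉ z∈ (inj (here refl) (there z∈) fx≡y) })
  ∷ map-unique f u (λ p q → inj (there p) (there q))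

length-inj : {xs : List Elt} {ys : List Elt′} → Unique xs → (f : Elt → Elt′) →
  (∀ {a} → a ∈ xs → f a ∈ ys) → (∀ {a b} → a ∈ xs → b ∈ xs → f a ≡ f b → a ≡ b) →
  length xs ≤ length ys
length-inj {xs = xs} {ys} u f to inj = subst (_≤ length ys) (List.length-map f xs)
  (unique-⊆⇒length-≤ (map-unique f u inj)
    (λ y∈ → case ∈-map⁻ f y∈ of λ { (z , z∈ , refl) → to z∈ }))

length-bij : {xs : List Elt} {ys : List Elt′} → Unique xs → Unique ys → (f : Elt → Elt′) (g : Elt′ → Elt) →
  (∀ {a} → a ∈ xs → f a ∈ ys) → (∀ {b} → b ∈ ys → g b ∈ xs) →
  (∀ {a} → a ∈ xs → g (f a) ≡ a) → (∀ {b} → b ∈ ys → f (g b) ≡ b) →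
  length xs ≡ length ys
length-bij u v f g to from gf fg = ≤-antisym
  (length-inj u f to (λ p q e → trans (sym (gf p)) (trans (cong g e) (gf q))))
  (length-inj v g from (λ p q e → trans (sym (fg p)) (trans (cong f e) (fg q))))

length-empty : {xs : List Elt} → (∀ {x} → ¬ x ∈ xs) → length xs ≡ 0
length-empty {xs = []} _ = refl
length-empty {xs = x ∷ xs} ∉ = ⊥-elim (∉ (here refl))

length-singleton : {xs : List Elt} → Unique xs → (a : Elt) → a ∈ xs → (∀ {x} → x ∈ xs → x ≡ a) → length xs ≡ 1
length-singleton u a a∈ all≡ = ≤-antisym
  (unique-⊆⇒length-≤ {ys = a ∷ []} u (λ p → here (all≡ p)))
  (unique-⊆⇒length-≤ {xs = a ∷ []} ([] ∷ []) (λ { (here refl) → a∈ }))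

concatMap-unique : (f : Elt → List Elt′) {xs : List Elt} → Unique xs → (∀ {x} → x ∈ xs → Unique (f x)) →
  (∀ {x y z} → x ∈ xs → y ∈ xs → z ∈ f x → z ∈ f y → x ≡ y) → Unique (concatMap f xs)
concatMap-unique f [] uf dis = []
concatMap-unique f {x ∷ xs} (x∉ ∷ u) uf dis =
  Unique.++⁺ (uf (here refl)) (concatMap-unique f u (uf ∘ there) (λ p q → dis (there p) (there q)))
    λ { (p , q) → case find (∈-concatMap⁻ f {xs = xs} q) of λ { (y , y∈ , z∈) →
      All.lookup x∉ y∈ (dis (here refl) (there y∈) p z∈) } }

∈-concatMap-intro : (f : Elt → List Elt′) {xs : List Elt} {x : Elt} {z : Elt′} → x ∈ xs → z ∈ f x → z ∈ concatMap f xs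
∈-concatMap-intro f x∈ z∈ = ∈-concatMap⁺ f (lose x∈ z∈)

∈-concatMap-elim : (f : Elt → List Elt′) {xs : List Elt} {z : Elt′} → z ∈ concatMap f xs → ∃ λ x → x ∈ xs × z ∈ f x
∈-concatMap-elim f {xs} p = find (∈-concatMap⁻ f {xs = xs} p)

length-concatMap : (f : Elt → List Elt′) (xs : List Elt) → length (concatMap f xs) ≡ sum (map (length ∘ f) xs)
length-concatMap f [] = refl
length-concatMap f (x ∷ xs) = trans (List.length-++ (f x)) (cong (length (f x) +_) (length-concatMap f xs))

∑ : List Elt → (Elt → ℤ) → ℤ
∑ [] f = 0ℤ
∑ (x ∷ xs) f = f x +ℤ ∑ xs f

∑-cong : (xs : List Elt) {f g : Elt → ℤ} → (∀ {x} → x ∈ xs → f x ≡ g x) → ∑ xs f ≡ ∑ xs g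
∑-cong [] e = refl
∑-cong (x ∷ xs) e = cong₂ _+ℤ_ (e (here refl)) (∑-cong xs (e ∘ there))

∑-zero : (xs : List Elt) {f : Elt → ℤ} → (∀ {x} → x ∈ xs → f x ≡ 0ℤ) → ∑ xs f ≡ 0ℤ
∑-zero [] e = refl
∑-zero (x ∷ xs) e = cong₂ _+ℤ_ (e (here refl)) (∑-zero xs (e ∘ there))

∑-+ : (xs : List Elt) (f g : Elt → ℤ) → ∑ xs (λ x → f x +ℤ g x) ≡ ∑ xs f +ℤ ∑ xs g
∑-+ [] f g = refl
∑-+ (x ∷ xs) f g = trans (cong ((f x +ℤ g x) +ℤ_) (∑-+ xs f g)) (+ℤ-interchange (f x) (g x) (∑ xs f) (∑ xs g))

∑-*ˡ : (c : ℤ) (xs : List Elt) (f : Elt → ℤ) → ∑ xs (λ x → c *ℤ f x) ≡ c *ℤ ∑ xs f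
∑-*ˡ c [] f = sym (ℤ.*-zeroʳ c)
∑-*ˡ c (x ∷ xs) f = trans (cong ((c *ℤ f x) +ℤ_) (∑-*ˡ c xs f)) (sym (ℤ.*-distribˡ-+ c (f x) (∑ xs f)))

∑-*ʳ : (c : ℤ) (xs : List Elt) (f : Elt → ℤ) → ∑ xs (λ x → f x *ℤ c) ≡ ∑ xs f *ℤ c
∑-*ʳ c xs f = trans (∑-cong xs (λ {x} _ → ℤ.*-comm (f x) c)) (trans (∑-*ˡ c xs f) (ℤ.*-comm c (∑ xs f)))

∑-swap : (xs : List Elt) (ys : List Elt′) (f : Elt → Elt′ → ℤ) → ∑ xs (λ x → ∑ ys (f x)) ≡ ∑ ys
  (λ y → ∑ xs (λ x → f x y))
∑-swap [] ys f = sym (∑-zero ys (λ _ → refl))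
∑-swap (x ∷ xs) ys f = trans (cong (∑ ys (f x) +ℤ_) (∑-swap xs ys f)) (sym (∑-+ ys (f x) (λ y → ∑ xs (λ z → f z y))))

∑-++ : (xs ys : List Elt) (f : Elt → ℤ) → ∑ (xs ++ ys) f ≡ ∑ xs f +ℤ ∑ ys f
∑-++ [] ys f = sym (ℤ.+-identityˡ _)
∑-++ (x ∷ xs) ys f = trans (cong (f x +ℤ_) (∑-++ xs ys f)) (sym (ℤ.+-assoc (f x) (∑ xs f) (∑ ys f)))

∑-map : (g : Elt → Elt′) (xs : List Elt) (f : Elt′ → ℤ) → ∑ (map g xs) f ≡ ∑ xs (f ∘ g)
∑-map g [] f = refl
∑-map g (x ∷ xs) f = cong (f (g x) +ℤ_) (∑-map g xs f)

∑-concatMap : (g : Elt → List Elt′) (xs : List Elt) (f : Elt′ → ℤ) → ∑ (concatMap g xs) f ≡ ∑ xs (λ x → ∑ (g x) f)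
∑-concatMap g [] f = refl
∑-concatMap g (x ∷ xs) f = trans (∑-++ (g x) (concatMap g xs) f) (cong (∑ (g x) f +ℤ_) (∑-concatMap g xs f))

∑-cartesian : (xs : List Elt) (ys : List Elt′) (f : Elt × Elt′ → ℤ) →
  ∑ (cartesianProduct xs ys) f ≡ ∑ xs (λ x → ∑ ys (λ y → f (x , y)))
∑-cartesian [] ys f = refl
∑-cartesian (x ∷ xs) ys f = trans (∑-++ (map (x ,_) ys) (cartesianProduct xs ys) f)
  (cong₂ _+ℤ_ (∑-map (x ,_) ys f) (∑-cartesian xs ys f))

ind : {P : Set} → Dec P → ℤ
ind (yes _) = 1ℤ
ind (no _) = 0ℤ

ind-yes : {P : Set} (d : Dec P) → P → ind d ≡ 1ℤ
ind-yes (yes _) p = refl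
ind-yes (no ¬p) p = ⊥-elim (¬p p)

ind-no : {P : Set} (d : Dec P) → ¬ P → ind d ≡ 0ℤ
ind-no (yes p) ¬p = ⊥-elim (¬p p)
ind-no (no _) ¬p = refl

ind-⇔ : {P Q : Set} (d : Dec P) (e : Dec Q) → (P → Q) → (Q → P) → ind d ≡ ind e
ind-⇔ (yes p) e f g = sym (ind-yes e (f p))
ind-⇔ (no ¬p) e f g = sym (ind-no e (¬p ∘ g))

ind-× : {P Q : Set} (d : Dec P) (e : Dec Q) → ind (d ×-dec e) ≡ ind d *ℤ ind e
ind-× (yes p) (yes q) = refl
ind-× (yes p) (no q) = refl
ind-× (no p) (yes q) = refl
ind-× (no p) (no q) = refl

∑-filter : {P : Elt → Set} (P? : Decidable P) (xs : List Elt) (f : Elt → ℤ) →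
  ∑ (filter P? xs) f ≡ ∑ xs (λ x → ind (P? x) *ℤ f x)
∑-filter P? [] f = refl
∑-filter P? (x ∷ xs) f with P? x
... | yes _ = cong₂ _+ℤ_ (sym (ℤ.*-identityˡ (f x))) (∑-filter P? xs f)
... | no _ = trans (∑-filter P? xs f) (sym (ℤ.+-identityˡ _))

pos-sum : (xs : List Elt) (f : Elt → ℕ) → pos (sum (map f xs)) ≡ ∑ xs (λ x → pos (f x))
pos-sum [] f = refl
pos-sum (x ∷ xs) f = trans (ℤ.pos-+ (f x) (sum (map f xs))) (cong (pos (f x) +ℤ_) (pos-sum xs f))

∑-single : {xs : List Elt} → Unique xs → {a : Elt} → a ∈ xs → (f : Elt → ℤ) →
  (∀ {x} → x ∈ xs → x ≢ a → f x ≡ 0ℤ) → ∑ xs f ≡ f a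
∑-single {xs = x ∷ xs} (x∉ ∷ u) (here refl) f z =
  trans (cong (f x +ℤ_) (∑-zero xs (λ p → z (there p) (λ { refl → All.lookup x∉ p refl })))) (ℤ.+-identityʳ (f x))
∑-single {xs = x ∷ xs} (x∉ ∷ u) (there a∈) f z =
  trans (cong₂ _+ℤ_ (z (here refl) (λ { refl → All.lookup x∉ a∈ refl })) (∑-single u a∈ f (z ∘ there)))
    (ℤ.+-identityˡ _)

-- Chains of related elements with a prescribed content

nth : Elt → List Elt → ℕ → Elt
nth u F zero = u
-- Beyond the end the last member of the chain is repeated.
nth u [] (suc k) = u
nth u (v ∷ F) (suc k) = nth v F k

nth-applyUpTo : (S : ℕ → Elt) (n : ℕ) {k : ℕ} → k ≤ n → nth (S 0) (applyUpTo (S ∘ suc) n) k ≡ S k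
nth-applyUpTo S n {zero} _ = refl
nth-applyUpTo S (suc n) {suc k} (s≤s p) = nth-applyUpTo (S ∘ suc) n p

applyUpTo-cong : {f g : ℕ → Elt} (n : ℕ) → (∀ i → i < n → f i ≡ g i) → applyUpTo f n ≡ applyUpTo g n
applyUpTo-cong zero e = refl
applyUpTo-cong (suc n) e = cong₂ _∷_ (e 0 (s≤s z≤n)) (applyUpTo-cong n (λ i p → e (suc i) (s≤s p)))

-- The first argument of `R` is the number of letters still to come. It serves the shift by δ, where
-- the admissible size of a step depends on its position. Confining all members to a finite list `U`
-- makes the chains enumerable and turns their numbers into sums over `U`.
module Chains {X : Set} (_≟ₓ_ : DecidableEquality X) (U : List X) (U-unique : Unique U)
  (R : ℕ → ℕ → X → X → Set) (R? : ∀ e b u → Decidable (R e b u)) where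

  data IsChain : X → List ℕ → List X → X → Set where
    []  : ∀ {t} → IsChain t [] [] t
    _∷_ : ∀ {u b β v F t} → v ∈ U × R (length β) b u v → IsChain v β F t → IsChain u (b ∷ β) (v ∷ F) t

  chains : X → List ℕ → X → List (List X)
  chains u [] t with u ≟ₓ t
  ... | yes _ = [] ∷ []
  ... | no _ = []
  chains u (b ∷ β) t = concatMap (λ v → map (v ∷_) (chains v β t)) (filter (R? (length β) b u) U)

  chains-sound : ∀ u β t {F} → F ∈ chains u β t → IsChain u β F t
  chains-sound u [] t F∈ with u ≟ₓ t
  chains-sound u [] t (here refl) | yes refl = []
  chains-sound u (b ∷ β) t F∈ with ∈-concatMap-elim
    (λ v → map (v ∷_) (chains v β t)) {filter (R? (length β) b u) U} F∈
  ... | v , v∈ , F∈′ with ∈-map⁻ (v ∷_) F∈′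
  ... | F′ , F′∈ , refl = ∈-filter⁻ (R? (length β) b u) v∈ ∷ chains-sound v β t F′∈

  chains-complete : ∀ {u β t F} → IsChain u β F t → F ∈ chains u β t
  chains-complete {t = t} [] with t ≟ₓ t
  ... | yes _ = here refl
  ... | no ¬p = ⊥-elim (¬p refl)
  chains-complete {u} {b ∷ β} {t} (_∷_ {v = v} (v∈ , r) c) =
    ∈-concatMap-intro (λ v → map (v ∷_) (chains v β t)) (∈-filter⁺ (R? (length β) b u) v∈ r)
      (∈-map⁺ (v ∷_) (chains-complete c))

  chains-unique : ∀ u β t → Unique (chains u β t)
  chains-unique u [] t with u ≟ₓ t
  ... | yes _ = [] ∷ []
  ... | no _ = []
  chains-unique u (b ∷ β) t = concatMap-unique (λ v → map (v ∷_) (chains v β t))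
    (Unique.filter⁺ (R? (length β) b u) U-unique)
    (λ {v} _ → Unique.map⁺ List.∷-injectiveʳ (chains-unique v β t))
    (λ {v} {w} _ _ p q → case (∈-map⁻ (v ∷_) p , ∈-map⁻ (w ∷_) q) of λ { ((_ , _ , refl) , (_ , _ , e))
      → List.∷-injectiveˡ e })

  #chains : X → List ℕ → X → ℕ
  #chains u β t = length (chains u β t)

  #chains-[] : ∀ u t → pos (#chains u [] t) ≡ ind (u ≟ₓ t)
  #chains-[] u t with u ≟ₓ t
  ... | yes _ = refl
  ... | no _ = refl

  #chains-∷ : ∀ u b β t → pos (#chains u (b ∷ β) t) ≡ ∑ U (λ v → ind (R? (length β) b u v) *ℤ pos (#chains v β t))
  #chains-∷ u b β t = begin
    pos (length (concatMap (λ v → map (v ∷_) (chains v β t)) V))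
      ≡⟨ cong pos (length-concatMap (λ v → map (v ∷_) (chains v β t)) V) ⟩
    pos (sum (map (λ v → length (map (v ∷_) (chains v β t))) V))
      ≡⟨ pos-sum V _ ⟩
    ∑ V (λ v → pos (length (map (v ∷_) (chains v β t))))
      ≡⟨ ∑-cong V (λ {v} _ → cong pos (List.length-map (v ∷_) (chains v β t))) ⟩
    ∑ V (λ v → pos (#chains v β t))
      ≡⟨ ∑-filter (R? (length β) b u) U _ ⟩
    ∑ U (λ v → ind (R? (length β) b u v) *ℤ pos (#chains v β t)) ∎
    where
    open ≡-Reasoning
    V = filter (R? (length β) b u) U

  chain-end : ∀ {u β F t} → IsChain u β F t → nth u F (length β) ≡ t
  chain-end [] = refl
  chain-end (_ ∷ c) = chain-end c

  chain-step : ∀ {u β F t} → IsChain u β F t → ∀ k → k < length β →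
    nth u F (suc k) ∈ U × ∃ λ e → R e (part β k) (nth u F k) (nth u F (suc k))
  chain-step ((v∈ , r) ∷ c) zero _ = v∈ , _ , r
  chain-step (_ ∷ c) (suc k) (s≤s p) = chain-step c k p

  chain-nth : ∀ {u β F t} → IsChain u β F t → F ≡ applyUpTo (λ k → nth u F (suc k)) (length β)
  chain-nth [] = refl
  chain-nth (_∷_ {v = v} _ c) = cong (v ∷_) (chain-nth c)

  steps-chain : ∀ (S : ℕ → X) β → (∀ k → k < length β → S (suc k) ∈ U × (∀ e → R e (part β k) (S k) (S (suc k)))) →
    IsChain (S 0) β (applyUpTo (S ∘ suc) (length β)) (S (length β))
  steps-chain S [] h = []
  steps-chain S (b ∷ β) h = (proj₁ (h 0 (s≤s z≤n)) , proj₂ (h 0 (s≤s z≤n)) (length β)) ∷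
    steps-chain (S ∘ suc) β (λ k p → h (suc k) (s≤s p))

open Chains using ([]; _∷_)

-- The Bender–Knuth involution on vertical strips

Desc : List ℕ → Set
Desc = Linked _≥_

Step : ℕ → ℕ → Set
Step b c = b ≤ c × c ≤ suc b

-- `Pointwise` forces equal lengths: all shapes of a chain are padded with zeros to the same number
-- of rows. Weak decrease of the rows is demanded separately, by `Desc`.
VStrip : List ℕ → List ℕ → Set
VStrip = Pointwise Step

data Between : List ℕ → List ℕ → List ℕ → Set where
  []  : Between [] [] []
  _∷_ : ∀ {a b c as bs cs} → Step a b × Step b c → Between as bs cs → Between (a ∷ as) (b ∷ bs) (c ∷ cs)

between : ∀ {as bs cs} → VStrip as bs → VStrip bs cs → Between as bs cs
between [] [] = []
between (p ∷ ps) (q ∷ qs) = (p , q) ∷ between ps qs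

between-lower : ∀ {as bs cs} → Between as bs cs → VStrip as bs
between-lower [] = []
between-lower ((p , q) ∷ w) = p ∷ between-lower w

between-upper : ∀ {as bs cs} → Between as bs cs → VStrip bs cs
between-upper [] = []
between-upper ((p , q) ∷ w) = q ∷ between-upper w

-- A row holding exactly one of the two letters, `c = a + 1`, changes it into the other one. For
-- `c = a` and `c = a + 2` the value `b` is forced and stays.
reflect : ℕ → ℕ → ℕ → ℕ
reflect a b c = a + c ∸ b

reflect-+ : ∀ {a b c} → Step a b × Step b c → reflect a b c + b ≡ a + c
reflect-+ {a} {b} {c} (_ , (b≤c , _)) = m∸n+n≡m (≤-trans b≤c (m≤n+m c a))

reflect-step : ∀ {a b c} → Step a b × Step b c → Step a (reflect a b c) × Step (reflect a b c) c
reflect-step {a} {b} {c} w@((a≤b , b≤) , (b≤c , c≤)) =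
  (+-cancelʳ-≤ b a r (subst (a + b ≤_) (sym e) (+-monoʳ-≤ a b≤c)) ,
   +-cancelʳ-≤ b r (suc a) (subst (_≤ suc a + b) (sym e) (≤-trans (+-monoʳ-≤ a c≤) (≤-reflexive (+-suc a b))))) ,
  (+-cancelʳ-≤ b r c (subst (_≤ c + b) (sym e) (subst (a + c ≤_) (+-comm b c) (+-monoˡ-≤ c a≤b))) ,
   +-cancelʳ-≤ b c (suc r) (subst (λ z → c + b ≤ suc z) (sym e)
     (subst (_≤ suc (a + c)) (+-comm b c) (+-monoˡ-≤ c b≤))))
  where
  r = reflect a b c
  e = reflect-+ w

reflect-involutive : ∀ {a b c} → Step a b × Step b c → reflect a (reflect a b c) c ≡ b
reflect-involutive {a} {b} {c} w = trans (cong (_∸ reflect a b c) (sym (reflect-+ w))) (m+n∸m≡n (reflect a b c) b)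

insert : ℕ → List ℕ → List ℕ
insert x [] = x ∷ []
insert x (y ∷ ys) with x <? y
... | yes _ = y ∷ insert x ys
... | no _ = x ∷ y ∷ ys

insert-< : ∀ {x y} ys → x < y → insert x (y ∷ ys) ≡ y ∷ insert x ys
insert-< {x} {y} ys p with x <? y
... | yes _ = refl
... | no ¬p = ⊥-elim (¬p p)

insert-≥ : ∀ {x y} ys → y ≤ x → insert x (y ∷ ys) ≡ x ∷ y ∷ ys
insert-≥ {x} {y} ys p with x <? y
... | yes q = ⊥-elim (<⇒≱ q p)
... | no _ = refl

-- The Bender–Knuth involution for vertical strips: between fixed as and cs, reflecting every row
-- and sorting only rearranges rows with equal values of a and of c.
flip : List ℕ → List ℕ → List ℕ → List ℕ
flip (a ∷ as) (b ∷ bs) (c ∷ cs) = insert (reflect a b c) (flip as bs cs)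
flip _ _ _ = []

insert-sum : ∀ x ys → sum (insert x ys) ≡ x + sum ys
insert-sum x [] = refl
insert-sum x (y ∷ ys) with x <? y
... | yes _ = trans (cong (y +_) (insert-sum x ys)) (x∙yz≈y∙xz y x (sum ys))
... | no _ = refl

insert-commute-< : ∀ {x y} → x < y → ∀ zs → insert x (insert y zs) ≡ insert y (insert x zs)
insert-commute-< p [] = trans (insert-< [] p) (sym (insert-≥ [] (<⇒≤ p)))
insert-commute-< {x} {y} p (z ∷ zs) with y <? z
... | yes q = trans (insert-< (insert y zs) (<-trans p q))
  (trans (cong (z ∷_) (insert-commute-< p zs))
    (sym (trans (cong (insert y) (insert-< zs (<-trans p q))) (insert-< (insert x zs) q))))
... | no ¬q with x <? z
... | yes r = trans (insert-< (z ∷ zs) p) (trans (cong (y ∷_) (insert-< zs r))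
  (sym (insert-≥ (insert x zs) (≮⇒≥ ¬q))))
... | no ¬r = trans (insert-< (z ∷ zs) p) (trans (cong (y ∷_) (insert-≥ zs (≮⇒≥ ¬r)))
  (sym (insert-≥ (z ∷ zs) (<⇒≤ p))))

insert-commute : ∀ x y zs → insert x (insert y zs) ≡ insert y (insert x zs)
insert-commute x y zs with <-cmp x y
... | tri< p _ _ = insert-commute-< p zs
... | tri≈ _ refl _ = refl
... | tri> _ _ p = sym (insert-commute-< p zs)

head-bound : ∀ {x ys} → Desc ys → All (_≤ x) ys → Desc (x ∷ ys)
head-bound [] [] = [-]
head-bound [-] (p ∷ _) = p ∷ [-]
head-bound (q ∷ l) (p ∷ _) = p ∷ q ∷ l

desc-all : ∀ {x ys} → Desc (x ∷ ys) → All (_≤ x) ys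
desc-all [-] = []
desc-all (p ∷ l) = p ∷ All.map (λ q → ≤-trans q p) (desc-all l)

desc-tail : ∀ {x ys} → Desc (x ∷ ys) → Desc ys
desc-tail [-] = []
desc-tail (_ ∷ l) = l

insert-all : ∀ {P : ℕ → Set} x ys → P x → All P ys → All P (insert x ys)
insert-all x [] p [] = p ∷ []
insert-all x (y ∷ ys) p (q ∷ qs) with x <? y
... | yes _ = q ∷ insert-all x ys p qs
... | no _ = p ∷ q ∷ qs

insert-desc : ∀ x {ys} → Desc ys → Desc (insert x ys)
insert-desc x {[]} _ = [-]
insert-desc x {y ∷ ys} d with x <? y
... | yes p = head-bound (insert-desc x (desc-tail d)) (insert-all x ys (<⇒≤ p) (desc-all d))
... | no ¬p = ≮⇒≥ ¬p ∷ d

insert-≥-desc : ∀ {x ys} → Desc (x ∷ ys) → insert x ys ≡ x ∷ ys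
insert-≥-desc {ys = []} _ = refl
insert-≥-desc {ys = y ∷ ys} (p ∷ _) = insert-≥ ys p

flip-desc : ∀ as bs cs → Desc (flip as bs cs)
flip-desc (a ∷ as) (b ∷ bs) (c ∷ cs) = insert-desc (reflect a b c) (flip-desc as bs cs)
flip-desc [] _ _ = []
flip-desc (_ ∷ _) [] _ = []
flip-desc (_ ∷ _) (_ ∷ _) [] = []

-- From `a ≤ x < y ≤ a′ + 1` and `c ≤ x + 1 ≤ y ≤ c′`. Hence sorting moves a value past another one
-- only between rows with the same bounds, where both values are admissible in both rows.
out-of-order : ∀ {a x c a′ y c′} → Step a x × Step x c → Step a′ y × Step y c′ →
  a′ ≤ a → c′ ≤ c → x < y → a ≡ a′ × c ≡ c′
out-of-order ((a≤x , _) , (_ , c≤)) ((_ , y≤) , (y≤c′ , _)) a′≤a c′≤c x<y =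
  ≤-antisym (s≤s⁻¹ (≤-trans (s≤s a≤x) (≤-trans x<y y≤))) a′≤a ,
  ≤-antisym (≤-trans c≤ (≤-trans x<y y≤c′)) c′≤c

insert-between : ∀ {a x c as ys cs} → Desc (a ∷ as) → Desc (c ∷ cs) → Step a x × Step x c →
  Between as ys cs → Between (a ∷ as) (insert x ys) (c ∷ cs)
insert-between da dc w [] = w ∷ []
insert-between {x = x} da dc w (_∷_ {b = y} w′ ws) with x <? y
insert-between (pa ∷ da) (pc ∷ dc) w (w′ ∷ ws) | yes p with out-of-order w w′ pa pc p
... | refl , refl = w′ ∷ insert-between da dc w ws
insert-between da dc w (w′ ∷ ws) | no ¬p = w ∷ w′ ∷ ws

flip-between : ∀ {as bs cs} → Desc as → Desc cs → Between as bs cs → Between as (flip as bs cs) cs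
flip-between da dc [] = []
flip-between da dc (w ∷ ws) =
  insert-between da dc (reflect-step w) (flip-between (desc-tail da) (desc-tail dc) ws)

flip-sum : ∀ {as bs cs} → Between as bs cs → sum (flip as bs cs) + sum bs ≡ sum as + sum cs
flip-sum [] = refl
flip-sum {a ∷ as} {b ∷ bs} {c ∷ cs} (w ∷ ws) = begin
  sum (insert r (flip as bs cs)) + (b + sum bs)  ≡⟨ cong (_+ (b + sum bs)) (insert-sum r (flip as bs cs)) ⟩
  r + sum (flip as bs cs) + (b + sum bs)         ≡⟨ +-interchange r (sum (flip as bs cs)) b (sum bs) ⟩
  r + b + (sum (flip as bs cs) + sum bs)         ≡⟨ cong₂ _+_ (reflect-+ w) (flip-sum ws) ⟩
  a + c + (sum as + sum cs)                      ≡⟨ +-interchange a c (sum as) (sum cs) ⟩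
  a + sum as + (c + sum cs)                      ∎
  where
  open ≡-Reasoning
  r = reflect a b c

-- An insertion only passes rows with the same bounds, and on these reflection followed by sorting
-- does not depend on the order. This is what lets the second flip undo the first one in spite of
-- the sorting.
flip-insert : ∀ {a x c as ys cs} → Desc (a ∷ as) → Desc (c ∷ cs) → Step a x × Step x c → Between as ys cs →
  flip (a ∷ as) (insert x ys) (c ∷ cs) ≡ insert (reflect a x c) (flip as ys cs)
flip-insert da dc w [] = refl
flip-insert {x = x} da dc w (_∷_ {b = y} w′ ws) with x <? y
flip-insert {a} {x} {c} {_ ∷ as} {y ∷ ys} {_ ∷ cs} (pa ∷ da) (pc ∷ dc) w
  (w′ ∷ ws) | yes p with out-of-order w w′ pa pc p
... | refl , refl = trans (cong (insert (reflect a y c)) (flip-insert da dc w ws))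
  (insert-commute (reflect a y c) (reflect a x c) (flip as ys cs))
flip-insert da dc w (w′ ∷ ws) | no _ = refl

flip-involutive : ∀ {as bs cs} → Desc as → Desc bs → Desc cs → Between as bs cs →
  flip as (flip as bs cs) cs ≡ bs
flip-involutive da db dc [] = refl
flip-involutive {a ∷ as} {b ∷ bs} {c ∷ cs} da db dc (w ∷ ws) = begin
  flip (a ∷ as) (insert (reflect a b c) (flip as bs cs)) (c ∷ cs)
    ≡⟨ flip-insert da dc (reflect-step w) (flip-between (desc-tail da) (desc-tail dc) ws) ⟩
  insert (reflect a (reflect a b c) c) (flip as (flip as bs cs) cs)
    ≡⟨ cong₂ insert (reflect-involutive w) (flip-involutive (desc-tail da) (desc-tail db) (desc-tail dc) ws) ⟩
  insert b bs
    ≡⟨ insert-≥-desc db ⟩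
  b ∷ bs ∎
  where open ≡-Reasoning

-- Pairs of shapes and lattice violations

psum : ℕ → List ℕ → ℕ
psum zero xs = 0
psum (suc p) [] = 0
psum (suc p) (x ∷ xs) = x + psum p xs

psum-suc : ∀ p xs → psum (suc p) xs ≡ psum p xs + part xs p
psum-suc zero [] = refl
psum-suc (suc p) [] = refl
psum-suc zero (x ∷ xs) = +-identityʳ x
psum-suc (suc p) (x ∷ xs) = trans (cong (x +_) (psum-suc p xs)) (sym (+-assoc x (psum p xs) (part xs p)))

flipFrom : ℕ → List ℕ → List ℕ → List ℕ → List ℕ
flipFrom zero as bs cs = flip as bs cs
flipFrom (suc p) (a ∷ as) (b ∷ bs) (c ∷ cs) = b ∷ flipFrom p as bs cs
flipFrom (suc p) _ _ _ = []

flipFrom-between : ∀ p {as bs cs} → Desc as → Desc cs → Between as bs cs → Between as (flipFrom p as bs cs) cs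
flipFrom-between zero da dc w = flip-between da dc w
flipFrom-between (suc p) da dc [] = []
flipFrom-between (suc p) da dc (w ∷ ws) = w ∷ flipFrom-between p (desc-tail da) (desc-tail dc) ws

-- A condition on the last of the kept rows: between the bounds of a strip it fails only for
-- `b = a`, `c = b + 1`, that is, if the row has the letter of `cs/bs` without that of `bs/as`.
TopHeavy : ℕ → List ℕ → List ℕ → List ℕ → Set
TopHeavy zero as bs cs = ⊤
TopHeavy (suc i) as bs cs = part as i + part cs i ≤ part bs i + part bs i

-- Only the border between the last kept row `b` and the first flipped row `x` is critical. If
-- `a < b`, then `x ≤ a′ + 1 ≤ a + 1 ≤ b`. Otherwise top-heaviness gives `c ≤ b`, and `x ≤ c′ ≤ c`.
flipFrom-desc : ∀ p {as bs cs} → Desc as → Desc bs → Desc cs → Between as bs cs → TopHeavy p as bs cs →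
  Desc (flipFrom p as bs cs)
flipFrom-desc zero {as} {bs} {cs} da db dc w _ = flip-desc as bs cs
flipFrom-desc (suc p) da db dc [] h = []
flipFrom-desc (suc zero) {a ∷ as} {b ∷ bs} {c ∷ cs} da db dc (((_ , b≤) , (b≤c , _)) ∷ ws) h
  with flip as bs cs | flip-desc as bs cs | flip-between (desc-tail da) (desc-tail dc) ws | da | dc
... | [] | _ | _ | _ | _ = [-]
... | x ∷ xs | d | ((_ , x≤a′) , (x≤c′ , _)) ∷ _ | a′≤a ∷ _ | c′≤c ∷ _ = x≤b ∷ d
  where
  x≤b : x ≤ b
  x≤b with b ≤? a
  ... | no ¬p = ≤-trans x≤a′ (≤-trans (s≤s a′≤a) (≰⇒> ¬p))
  ... | yes p = ≤-trans x≤c′ (≤-trans c′≤c (+-cancelˡ-≤ b c b (≤-trans (+-monoˡ-≤ c p) h)))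
flipFrom-desc (suc (suc p)) {_ ∷ as} {_ ∷ bs} {_ ∷ cs} da db dc (w ∷ ws) h
  with flipFrom-desc (suc p) (desc-tail da) (desc-tail db) (desc-tail dc) ws h
flipFrom-desc (suc (suc p)) da db dc (w ∷ []) h | d = [-]
flipFrom-desc (suc (suc p)) da (q ∷ db) dc (w ∷ w′ ∷ ws) h | d = q ∷ d

flipFrom-involutive : ∀ p {as bs cs} → Desc as → Desc bs → Desc cs → Between as bs cs →
  flipFrom p as (flipFrom p as bs cs) cs ≡ bs
flipFrom-involutive zero da db dc w = flip-involutive da db dc w
flipFrom-involutive (suc p) da db dc [] = refl
flipFrom-involutive (suc p) {bs = b ∷ bs} da db dc (w ∷ ws) =
  cong (b ∷_) (flipFrom-involutive p (desc-tail da) (desc-tail db) (desc-tail dc) ws)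

-- Flipped rows satisfy `new + b = a + c`, kept rows `new = b`. The prefix sums on both sides
-- correct for the kept rows without any subtraction.
flipFrom-sum : ∀ p {as bs cs} → Between as bs cs →
  sum (flipFrom p as bs cs) + sum bs + (psum p as + psum p cs) ≡ sum as + sum cs + (psum p bs + psum p bs)
flipFrom-sum zero w = cong (_+ 0) (flip-sum w)
flipFrom-sum (suc p) [] = refl
flipFrom-sum (suc p) {a ∷ as} {b ∷ bs} {c ∷ cs} (w ∷ ws) =
  trans (l₁ b (sum (flipFrom p as bs cs)) (sum bs) a (psum p as) c (psum p cs))
  (trans (cong (b + b + a + c +_) (flipFrom-sum p ws))
  (l₂ a b c (sum as) (sum cs) (psum p bs)))
  where
  l₁ : ∀ b F B a A c C → b + F + (b + B) + (a + A + (c + C)) ≡ b + b + a + c + (F + B + (A + C))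
  l₁ = solve-∀
  l₂ : ∀ a b c A C B → b + b + a + c + (A + C + (B + B)) ≡ a + A + (c + C) + (b + B + (b + B))
  l₂ = solve-∀

flipFrom-psum : ∀ {p q} → q ≤ p → ∀ {as bs cs} → Between as bs cs → psum q (flipFrom p as bs cs) ≡ psum q bs
flipFrom-psum z≤n w = refl
flipFrom-psum (s≤s q≤p) [] = refl
flipFrom-psum (s≤s q≤p) {bs = b ∷ _} (w ∷ ws) = cong (b +_) (flipFrom-psum q≤p ws)

Shape : Set
Shape = List ℕ × List ℕ

size : Shape → ℕ
size (as , as′) = sum as + sum as′

-- Sum of the first t rows when the rows of the two components alternate.
pre : ℕ → Shape → ℕ
pre t (as , as′) = psum ⌈ t /2⌉ as + psum ⌊ t /2⌋ as′

Desc₂ : Shape → Set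
Desc₂ (as , as′) = Desc as × Desc as′

VStrip₂ : Shape → Shape → Set
VStrip₂ (as , as′) (bs , bs′) = VStrip as bs × VStrip as′ bs′

flip₂ : ℕ → Shape → Shape → Shape → Shape
flip₂ t (as , as′) (bs , bs′) (cs , cs′) = flipFrom ⌈ t /2⌉ as bs cs , flipFrom ⌊ t /2⌋ as′ bs′ cs′

-- For A, B, C = S_{j+2}, S_{j+1}, S_j: letter j+1 exceeds letter j in the first t rows.
Excess : ℕ → Shape → Shape → Shape → Set
Excess t A B C = pre t A + pre t C < pre t B + pre t B

FirstExcess : ℕ → Shape → Shape → Shape → Set
FirstExcess t A B C = Excess t A B C × (∀ {i} → i < t → ¬ Excess i A B C)

part-between : ∀ {as bs cs} → Between as bs cs → ∀ i → Step (part as i) (part bs i) × Step (part bs i) (part cs i)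
part-between [] i = (z≤n , z≤n) , (z≤n , z≤n)
part-between (w ∷ ws) zero = w
part-between (w ∷ ws) (suc i) = part-between ws i

row≤1 : ∀ {a b c} → Step a b × Step b c → b + b ≤ suc (a + c)
row≤1 {a} {b} {c} ((_ , b≤) , (b≤c , _)) = +-mono-≤ b≤ b≤c

-- The possible pairs of `⌈ t /2⌉` and `⌊ t /2⌋`. With `even` the next row in the alternating order
-- is row `i` of the first component, with `odd` it is row `i` of the second.
data Halves : ℕ → ℕ → Set where
  even : ∀ {i} → Halves i i
  odd  : ∀ {i} → Halves (suc i) i

next : ∀ {p q} → Halves p q → Halves (suc q) p
next even = odd
next odd = even

halves : ∀ t → Halves ⌈ t /2⌉ ⌊ t /2⌋
halves zero = even
halves (suc t) = next (halves t)

rowAt : ∀ {p q} → Halves p q → Shape → ℕ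
rowAt (even {i}) (as , as′) = part as i
rowAt (odd {i}) (as , as′) = part as′ i

row : ℕ → Shape → ℕ
row t = rowAt (halves t)

pre-suc : ∀ t S → pre (suc t) S ≡ pre t S + row t S
pre-suc t (as , as′) = go (halves t)
  where
  l₁ : ∀ x y z → x + y + z ≡ x + z + y
  l₁ = solve-∀
  go : ∀ {p q} (h : Halves p q) → psum (suc q) as + psum p as′ ≡ psum p as + psum q as′ + rowAt h (as , as′)
  go (even {i}) = trans (cong (_+ psum i as′) (psum-suc i as)) (l₁ (psum i as) (part as i) (psum i as′))
  go (odd {i}) = trans (cong (psum (suc i) as +_) (psum-suc i as′))
    (sym (+-assoc (psum (suc i) as) (psum i as′) (part as′ i)))

Between₂ : Shape → Shape → Shape → Set
Between₂ (as , as′) (bs , bs′) (cs , cs′) = Between as bs cs × Between as′ bs′ cs′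

row-between : ∀ {A B C} → Between₂ A B C → ∀ t → Step (row t A) (row t B) × Step (row t B) (row t C)
row-between (w , w′) t with ⌈ t /2⌉ | ⌊ t /2⌋ | halves t
... | _ | _ | even {i} = part-between w i
... | _ | _ | odd {i} = part-between w′ i

TopHeavy₂ : ℕ → Shape → Shape → Shape → Set
TopHeavy₂ t (as , as′) (bs , bs′) (cs , cs′) = TopHeavy ⌈ t /2⌉ as bs cs × TopHeavy ⌊ t /2⌋ as′ bs′ cs′

topHeavy₁ : ∀ A B C → row 0 A + row 0 C ≤ row 0 B + row 0 B → TopHeavy₂ 1 A B C
topHeavy₁ A B C h = h , tt

topHeavy₂ : ∀ t A B C → row t A + row t C ≤ row t B + row t B →
  row (suc t) A + row (suc t) C ≤ row (suc t) B + row (suc t) B → TopHeavy₂ (suc (suc t)) A B C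
topHeavy₂ t A B C h h′ with ⌈ t /2⌉ | ⌊ t /2⌋ | halves t
... | _ | _ | even = h , h′
... | _ | _ | odd = h′ , h

pre-sum-suc : ∀ t A C → pre (suc t) A + pre (suc t) C ≡ (pre t A + pre t C) + (row t A + row t C)
pre-sum-suc t A C = trans (cong₂ _+_ (pre-suc t A) (pre-suc t C))
  (+-interchange (pre t A) (row t A) (pre t C) (row t C))

-- The prefix without this row has no excess and the prefix with it has one, so the row itself
-- cannot lower the excess.
last-row-heavy : ∀ {t A B C} → FirstExcess (suc t) A B C → row t A + row t C ≤ row t B + row t B
last-row-heavy {t} {A} {B} {C} (ex , fst) = +-cancelˡ-≤ (pre t B + pre t B) _ _
  (≤-trans (+-monoˡ-≤ (row t A + row t C) (≮⇒≥ (fst ≤-refl)))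
  (≤-trans (<⇒≤ (subst₂ _<_ (pre-sum-suc t A C) refl ex)) (≤-reflexive (pre-sum-suc t B B))))

-- The prefix one row shorter has no excess, and a row raises it by at most one. This 1 reappears as
-- the difference of consecutive entries of δ.
firstExcess-exact : ∀ {t A B C} → Between₂ A B C → FirstExcess t A B C → pre t B + pre t B ≡ suc (pre t A + pre t C)
firstExcess-exact {suc t} {A} {B} {C} w (ex , fst) = ≤-antisym le ex
  where
  le : pre (suc t) B + pre (suc t) B ≤ suc (pre (suc t) A + pre (suc t) C)
  le = subst₂ _≤_ (sym (pre-sum-suc t B B)) (trans (+-suc _ _) (cong suc (sym (pre-sum-suc t A C))))
    (+-mono-≤ (≮⇒≥ (fst ≤-refl)) (row≤1 (row-between w t)))
firstExcess-exact {zero} w (() , _)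

-- The last row accounts for at most 1 of the excess, so before it the balance is at least 0, while
-- one row earlier it is at most 0. The row in between, which belongs to the other component, thus
-- does not lower it.
previous-row-heavy : ∀ {t A B C} → Between₂ A B C → FirstExcess (suc (suc t)) A B C →
  row t A + row t C ≤ row t B + row t B
previous-row-heavy {t} {A} {B} {C} w (ex , fst) = +-cancelˡ-≤ (pre t B + pre t B) _ _
  (≤-trans (+-monoˡ-≤ (row t A + row t C) (≮⇒≥ (fst (m<n⇒m<1+n (n<1+n t)))))
  (subst₂ _≤_ (pre-sum-suc t A C) (pre-sum-suc t B B)
  (+-cancelʳ-≤ (suc (row (suc t) A + row (suc t) C)) _ _
    (≤-trans (≤-reflexive (trans (+-suc _ _) (cong suc (sym (pre-sum-suc (suc t) A C)))))
    (≤-trans ex (≤-trans (≤-reflexive (pre-sum-suc (suc t) B B))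
      (+-monoʳ-≤ (pre (suc t) B + pre (suc t) B) (row≤1 (row-between w (suc t))))))))))

firstExcess-topHeavy : ∀ {t A B C} → Between₂ A B C → FirstExcess t A B C → TopHeavy₂ t A B C
firstExcess-topHeavy {zero} w (() , _)
firstExcess-topHeavy {suc zero} {A} {B} {C} w f = topHeavy₁ A B C (last-row-heavy {0} {A} {B} {C} f)
firstExcess-topHeavy {suc (suc t)} {A} {B} {C} w f =
  topHeavy₂ t A B C (previous-row-heavy {t} {A} {B} {C} w f) (last-row-heavy {suc t} {A} {B} {C} f)

module _ {t : ℕ} {A B C : Shape} (dA : Desc₂ A) (dB : Desc₂ B) (dC : Desc₂ C) (w : Between₂ A B C) where

  flip₂-between : Between₂ A (flip₂ t A B C) C
  flip₂-between = flipFrom-between ⌈ t /2⌉ (proj₁ dA) (proj₁ dC) (proj₁ w) , flipFrom-between ⌊ t /2⌋ (proj₂ dA)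
    (proj₂ dC) (proj₂ w)

  flip₂-desc : TopHeavy₂ t A B C → Desc₂ (flip₂ t A B C)
  flip₂-desc (h , h′) = flipFrom-desc ⌈ t /2⌉ (proj₁ dA) (proj₁ dB) (proj₁ dC) (proj₁ w) h ,
    flipFrom-desc ⌊ t /2⌋ (proj₂ dA) (proj₂ dB) (proj₂ dC) (proj₂ w) h′

  flip₂-involutive : flip₂ t A (flip₂ t A B C) C ≡ B
  flip₂-involutive = cong₂ _,_ (flipFrom-involutive ⌈ t /2⌉ (proj₁ dA) (proj₁ dB) (proj₁ dC) (proj₁ w))
    (flipFrom-involutive ⌊ t /2⌋ (proj₂ dA) (proj₂ dB) (proj₂ dC) (proj₂ w))

  flip₂-pre : ∀ {i} → i ≤ t → pre i (flip₂ t A B C) ≡ pre i B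
  flip₂-pre i≤t = cong₂ _+_ (flipFrom-psum (⌈n/2⌉-mono i≤t) (proj₁ w)) (flipFrom-psum (⌊n/2⌋-mono i≤t) (proj₂ w))

  flip₂-size : size (flip₂ t A B C) + size B + (pre t A + pre t C) ≡ size A + size C + (pre t B + pre t B)
  flip₂-size = trans (l (sum (proj₁ F)) (sum (proj₂ F)) (sum (proj₁ B)) (sum (proj₂ B)) (p A) (q A) (p C) (q C))
    (trans (cong₂ _+_ (flipFrom-sum ⌈ t /2⌉ (proj₁ w)) (flipFrom-sum ⌊ t /2⌋ (proj₂ w)))
    (sym (l (sum (proj₁ A)) (sum (proj₂ A)) (sum (proj₁ C)) (sum (proj₂ C)) (p B) (q B) (p B) (q B))))
    where
    F = flip₂ t A B C
    p q : Shape → ℕ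
    p S = psum ⌈ t /2⌉ (proj₁ S)
    q S = psum ⌊ t /2⌋ (proj₂ S)
    l : ∀ f f′ b b′ a a′ c c′ → f + f′ + (b + b′) + (a + a′ + (c + c′)) ≡ (f + b + (a + c)) + (f′ + b′ + (a′ + c′))
    l = solve-∀

  -- The prefix keeps one surplus letter j+1, so the exchange behind it misses a plain transposition
  -- of the two multiplicities by 1. This is exactly a transposition of entries of β + δ.
  flip₂-size-excess : FirstExcess t A B C → size (flip₂ t A B C) + size B ≡ suc (size A + size C)
  flip₂-size-excess f = +-cancelʳ-≡ (pre t A + pre t C) _ _
    (trans flip₂-size (trans (cong (size A + size C +_) (firstExcess-exact w f)) (+-suc _ _)))

-- Chains of vertical strips

vstrip-sum : ∀ {as bs} → VStrip as bs → sum as ≤ sum bs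
vstrip-sum [] = z≤n
vstrip-sum ((p , _) ∷ ps) = +-mono-≤ p (vstrip-sum ps)

vstrip₂-size : ∀ {A B} → VStrip₂ A B → size A ≤ size B
vstrip₂-size (p , p′) = +-mono-≤ (vstrip-sum p) (vstrip-sum p′)

belowVec-≤ : ∀ s {u} → u ∈ belowVec s → Pointwise _≤_ u s
belowVec-≤ [] (here refl) = []
belowVec-≤ (a ∷ s) u∈ with ∈-concatMap-elim (λ b → map (b ∷_) (belowVec s)) {upTo (suc a)} u∈
... | b , b∈ , u∈′ with ∈-map⁻ (b ∷_) u∈′
... | v , v∈ , refl = s≤s⁻¹ (∈-upTo⁻ b∈) ∷ belowVec-≤ s v∈

≤-belowVec : ∀ {u s} → Pointwise _≤_ u s → u ∈ belowVec s
≤-belowVec [] = here refl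
≤-belowVec {b ∷ u} {a ∷ s} (p ∷ ps) =
  ∈-concatMap-intro (λ b → map (b ∷_) (belowVec s)) (∈-upTo⁺ (s≤s p)) (∈-map⁺ (b ∷_) (≤-belowVec ps))

belowVec-unique : ∀ s → Unique (belowVec s)
belowVec-unique [] = [] ∷ []
belowVec-unique (a ∷ s) = concatMap-unique (λ b → map (b ∷_) (belowVec s)) (Unique.upTo⁺ (suc a))
  (λ _ → Unique.map⁺ List.∷-injectiveʳ (belowVec-unique s))
  (λ {x} {y} _ _ p q → case (∈-map⁻ (x ∷_) p , ∈-map⁻ (y ∷_) q) of λ { ((_ , _ , refl) , (_ , _ , e))
    → List.∷-injectiveˡ e })

desc? : Decidable Desc
desc? = linked? (λ x y → y ≤? x)

vstrip? : ∀ bs cs → Dec (VStrip bs cs)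
vstrip? = PW.decidable (λ b c → (b ≤? c) ×-dec (c ≤? suc b))

_≟ₛ_ : DecidableEquality Shape
_≟ₛ_ = ≡-dec (List.≡-dec _≟_) (List.≡-dec _≟_)

module _ {X : Set} where

  At : (X → X → X → Set) → ℕ → X → List X → Set
  At P zero C (B ∷ A ∷ F) = P A B C
  At P (suc j) C (B ∷ F) = At P j B F
  At P _ _ _ = ⊥

  at? : {P : X → X → X → Set} → (∀ A B C → Dec (P A B C)) → ∀ j C F → Dec (At P j C F)
  at? P? zero C [] = no λ ()
  at? P? zero C (_ ∷ []) = no λ ()
  at? P? zero C (B ∷ A ∷ F) = P? A B C
  at? P? (suc j) C [] = no λ ()
  at? P? (suc j) C (B ∷ F) = at? P? j B F

excess? : ∀ t A B C → Dec (Excess t A B C)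
excess? t A B C = _ <? _

firstExcessAt : ∀ {t} j {C F} → At (Excess t) j C F → (∀ {i} → i < t → ¬ At (Excess i) j C F) →
  At (FirstExcess t) j C F
firstExcessAt zero {F = B ∷ A ∷ F} ex fst = ex , fst
firstExcessAt (suc j) {F = B ∷ F} ex fst = firstExcessAt j ex fst

swapAt : ℕ → List ℕ → List ℕ
swapAt zero (x ∷ y ∷ ξ) = y ∷ x ∷ ξ
swapAt (suc k) (x ∷ ξ) = x ∷ swapAt k ξ
swapAt _ ξ = ξ

swapAt-length : ∀ k ξ → length (swapAt k ξ) ≡ length ξ
swapAt-length zero [] = refl
swapAt-length zero (_ ∷ []) = refl
swapAt-length zero (_ ∷ _ ∷ _) = refl
swapAt-length (suc k) [] = refl
swapAt-length (suc k) (_ ∷ ξ) = cong suc (swapAt-length k ξ)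

swapAt-involutive : ∀ k ξ → swapAt k (swapAt k ξ) ≡ ξ
swapAt-involutive zero [] = refl
swapAt-involutive zero (_ ∷ []) = refl
swapAt-involutive zero (_ ∷ _ ∷ _) = refl
swapAt-involutive (suc k) [] = refl
swapAt-involutive (suc k) (x ∷ ξ) = cong (x ∷_) (swapAt-involutive k ξ)

swapAt-beyond : ∀ k ξ → length ξ ≤ suc k → swapAt k ξ ≡ ξ
swapAt-beyond zero [] _ = refl
swapAt-beyond zero (_ ∷ []) _ = refl
swapAt-beyond zero (_ ∷ _ ∷ _) (s≤s ())
swapAt-beyond (suc k) [] _ = refl
swapAt-beyond (suc k) (x ∷ ξ) (s≤s p) = cong (x ∷_) (swapAt-beyond k ξ p)

flipAt : ℕ → ℕ → Shape → List Shape → List Shape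
flipAt t zero C (B ∷ A ∷ F) = flip₂ t A B C ∷ A ∷ F
flipAt t (suc j) C (B ∷ F) = B ∷ flipAt t j B F
flipAt t _ _ F = F

between₂ : ∀ {A B C} → VStrip₂ A B → VStrip₂ B C → Between₂ A B C
between₂ (p , p′) (q , q′) = between p q , between p′ q′

partsBelow : List ℕ → List (List ℕ)
partsBelow s = filter desc? (belowVec s)

partsBelow-unique : ∀ s → Unique (partsBelow s)
partsBelow-unique s = Unique.filter⁺ desc? (belowVec-unique s)

∈-partsBelow⁻ : ∀ {s u} → u ∈ partsBelow s → Pointwise _≤_ u s × Desc u
∈-partsBelow⁻ {s} u∈ with ∈-filter⁻ desc? {xs = belowVec s} u∈
... | p , d = belowVec-≤ s p , d

∈-partsBelow⁺ : ∀ {s u} → Pointwise _≤_ u s → Desc u → u ∈ partsBelow s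
∈-partsBelow⁺ p d = ∈-filter⁺ desc? (≤-belowVec p) d

module Inside (top : Shape) where

  U : List Shape
  U = cartesianProduct (partsBelow (proj₁ top)) (partsBelow (proj₂ top))

  U-unique : Unique U
  U-unique = Unique.cartesianProduct⁺ (partsBelow-unique (proj₁ top)) (partsBelow-unique (proj₂ top))

  Inside : Shape → Set
  Inside u = (Pointwise _≤_ (proj₁ u) (proj₁ top) × Pointwise _≤_ (proj₂ u) (proj₂ top)) × Desc₂ u

  ∈U⇒inside : ∀ {u} → u ∈ U → Inside u
  ∈U⇒inside u∈ with ∈-cartesianProduct⁻ (partsBelow (proj₁ top)) (partsBelow (proj₂ top)) u∈
  ... | p , q with ∈-partsBelow⁻ {proj₁ top} p | ∈-partsBelow⁻ {proj₂ top} q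
  ... | a , d | b , d′ = (a , b) , (d , d′)

  inside⇒∈U : ∀ {u} → Inside u → u ∈ U
  inside⇒∈U ((p , q) , (d , d′)) = ∈-cartesianProduct⁺ (∈-partsBelow⁺ p d) (∈-partsBelow⁺ q d′)

-- Chains s = S₀ ⊇ S₁ ⊇ … ⊇ S_K of vertical strips.  The content β is recorded through
-- |S_j| + shift (K−1−j) = β_j + |S_{j+1}|: for shift = id it is β + δ, δ = (K−1, …, 1, 0).
module VChains (top : Shape) (shift : ℕ → ℕ) where

  open Inside top public

  Rel : ℕ → ℕ → Shape → Shape → Set
  Rel e b u v = VStrip₂ v u × size u + shift e ≡ b + size v

  rel? : ∀ e b u → Decidable (Rel e b u)
  rel? e b u v = (vstrip? (proj₁ v) (proj₁ u) ×-dec vstrip? (proj₂ v) (proj₂ u)) ×-dec (_ ≟ _)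

  open Chains _≟ₛ_ U U-unique Rel rel? public hiding ([]; _∷_)

  -- The size equation is what both steps around the new shape require after the transposition of
  -- the contents. It is met for `shift = id` at a first excess, and for the zero shift by the flip
  -- of all rows.
  Swappable : ℕ → Shape → Shape → Shape → Set
  Swappable t A B C = TopHeavy₂ t A B C ×
    (Between₂ A B C → ∀ n → size (flip₂ t A B C) + size B + shift n ≡ size A + size C + shift (suc n))

  flip-inside : ∀ t {A B C} → Inside A → Inside B → Inside C → Between₂ A B C → TopHeavy₂ t A B C →
    Inside (flip₂ t A B C)
  flip-inside t (_ , dA) (_ , dB) ((c , c′) , dC) w h with flip₂-between {t} dA dB dC w
  ... | v , v′ = (PW.transitive ≤-trans (PW.map proj₁ (between-upper v)) c , PW.transitive ≤-trans
    (PW.map proj₁ (between-upper v′)) c′) ,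
    flip₂-desc {t} dA dB dC w h

  flipAt-chain : ∀ t j {u ξ F z} → Inside u → IsChain u ξ F z → At (Swappable t) j u F →
    IsChain u (swapAt j ξ) (flipAt t j u F) z
  flipAt-chain t zero {C} {x ∷ y ∷ ξ} {B ∷ A ∷ F} C-in ((B∈ , vB , eB) ∷ (A∈ , vA , eA) ∷ c) (h , e)
    with ∈U⇒inside A∈ | ∈U⇒inside B∈
  ... | A-in | B-in = (inside⇒∈U (flip-inside t A-in B-in C-in w h) ,
    (between-upper (proj₁ w′) , between-upper (proj₂ w′)) , e₁) ∷
      (A∈ , (between-lower (proj₁ w′) , between-lower (proj₂ w′)) , e₂) ∷ c
    where
    w = between₂ vA vB
    w′ = flip₂-between {t} (proj₂ A-in) (proj₂ B-in) (proj₂ C-in) w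
    n = length ξ
    B′ = flip₂ t A B C
    l₁ : ∀ c s b → c + s + b ≡ b + c + s
    l₁ = solve-∀
    l₂ : ∀ y b b′ s → y + b′ + b + s ≡ y + (b′ + b + s)
    l₂ = solve-∀
    l₃ : ∀ y a c s → y + (a + c + s) ≡ (y + a) + c + s
    l₃ = solve-∀
    l₄ : ∀ b n c s → b + n + c + s ≡ c + s + b + n
    l₄ = solve-∀
    l₅ : ∀ b′ n b → b′ + n + b ≡ b′ + b + n
    l₅ = solve-∀
    l₆ : ∀ a c s → a + c + s ≡ a + (c + s)
    l₆ = solve-∀
    l₇ : ∀ a x b → a + (x + b) ≡ x + a + b
    l₇ = solve-∀
    e₁ : size C + shift (suc n) ≡ y + size B′
    e₁ = +-cancelʳ-≡ (size B) _ _ (+-cancelʳ-≡ (shift n) _ _ (sym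
      (trans (l₂ y (size B) (size B′) (shift n))
        (trans (cong (y +_) (e w n)) (trans (l₃ y (size A) (size C) (shift (suc n)))
      (trans (cong (λ z → z + size C + shift (suc n)) (sym eA)) (l₄ (size B) (shift n) (size C) (shift (suc n)))))))))
    e₂ : size B′ + shift n ≡ x + size A
    e₂ = +-cancelʳ-≡ (size B) _ _ (trans (l₅ (size B′) (shift n) (size B)) (trans (e w n)
      (trans (l₆ (size A) (size C) (shift (suc n))) (trans (cong (size A +_) eB) (l₇ (size A) x (size B))))))
  flipAt-chain t zero {F = _ ∷ []} C-in (_ ∷ []) ()
  flipAt-chain t (suc j) {u} {b ∷ ξ} {B ∷ F} u-in (_∷_ {β = ξ} (B∈ , v , e) c) s =
    (B∈ , v , subst (λ n → size u + shift n ≡ b + size B) (sym (swapAt-length j ξ)) e) ∷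
    flipAt-chain t j (∈U⇒inside B∈) c s

  flipAt-involutive : ∀ t j {u ξ F z} → Inside u → IsChain u ξ F z → flipAt t j u (flipAt t j u F) ≡ F
  flipAt-involutive t zero C-in [] = refl
  flipAt-involutive t zero C-in (_ ∷ []) = refl
  flipAt-involutive t zero {C} C-in (_∷_ {v = B} (B∈ , vB , _) (_∷_ {v = A} {F = F} (A∈ , vA , _) c)) =
    cong (λ z → z ∷ A ∷ F) (flip₂-involutive {t} (proj₂ (∈U⇒inside A∈)) (proj₂ (∈U⇒inside B∈)) (proj₂ C-in)
      (between₂ vA vB))
  flipAt-involutive t (suc j) u-in [] = refl
  flipAt-involutive t (suc j) u-in (_∷_ {v = B} (B∈ , _) c) = cong (B ∷_) (flipAt-involutive t j (∈U⇒inside B∈) c)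

  SamePre : ℕ → List Shape → List Shape → Set
  SamePre t = Pointwise (λ S S′ → ∀ i → i ≤ t → pre i S ≡ pre i S′)

  flipAt-samePre : ∀ t j {u ξ F z} → Inside u → IsChain u ξ F z → SamePre t (flipAt t j u F) F
  flipAt-samePre t zero C-in [] = []
  flipAt-samePre t zero C-in c@(_ ∷ []) = PW.refl (λ _ _ → refl)
  flipAt-samePre t zero C-in ((B∈ , vB , _) ∷ (A∈ , vA , _) ∷ c) =
    (λ _ → flip₂-pre {t} (proj₂ (∈U⇒inside A∈)) (proj₂ (∈U⇒inside B∈)) (proj₂ C-in) (between₂ vA vB)) ∷ PW.refl
      (λ _ _ → refl)
  flipAt-samePre t (suc j) u-in [] = []
  flipAt-samePre t (suc j) u-in ((B∈ , _) ∷ c) = (λ _ _ → refl) ∷ flipAt-samePre t j (∈U⇒inside B∈) c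

  excessAt-resp : ∀ {t i} j {C C′ F F′} → i ≤ t → (∀ i → i ≤ t → pre i C ≡ pre i C′) → SamePre t F F′ →
    At (Excess i) j C F → At (Excess i) j C′ F′
  excessAt-resp {t} {i} zero i≤t pC (pB ∷ pA ∷ _) ex =
    subst₂ (λ a b → a < b) (cong₂ _+_ (pA i i≤t) (pC i i≤t)) (cong₂ _+_ (pB i i≤t) (pB i i≤t)) ex
  excessAt-resp (suc j) i≤t pC (pB ∷ ps) ex = excessAt-resp j i≤t pB ps ex

  -- The first `t` rows are kept, so all prefix sums up to `t` survive, and with them every
  -- violation up to `t`, for any two adjacent letters. In particular the flipped chain has the same
  -- first violation, which makes the flip an involution on the chains to be cancelled.
  excessAt-flip : ∀ t j j′ {i u ξ F z} → i ≤ t → Inside u → IsChain u ξ F z →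
    (At (Excess i) j′ u (flipAt t j u F) → At (Excess i) j′ u F) ×
      (At (Excess i) j′ u F → At (Excess i) j′ u (flipAt t j u F))
  excessAt-flip t j j′ i≤t u-in c =
    excessAt-resp j′ i≤t (λ _ _ → refl) (flipAt-samePre t j u-in c) ,
    excessAt-resp j′ i≤t (λ _ _ → refl) (PW.symmetric (λ e i p → sym (e i p)) (flipAt-samePre t j u-in c))

-- Alternants

altIns : ℕ → (List ℕ → ℤ) → List ℕ → ℤ
altIns x f [] = f (x ∷ [])
altIns x f (y ∷ ys) = f (x ∷ y ∷ ys) -ℤ altIns x (f ∘ (y ∷_)) ys

-- The alternating sum of f over all permutations of the list.
alt : (List ℕ → ℤ) → List ℕ → ℤ
alt f [] = f []
alt f (x ∷ xs) = alt (altIns x f) xs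

altIns-cong : ∀ x {f g} ys → (∀ zs → length zs ≡ suc (length ys) → f zs ≡ g zs) → altIns x f ys ≡ altIns x g ys
altIns-cong x [] e = e _ refl
altIns-cong x (y ∷ ys) e = cong₂ _-ℤ_ (e _ refl) (altIns-cong x ys (λ zs p → e (y ∷ zs) (cong suc p)))

alt-cong : ∀ {f g} xs → (∀ zs → length zs ≡ length xs → f zs ≡ g zs) → alt f xs ≡ alt g xs
alt-cong [] e = e [] refl
alt-cong (x ∷ xs) e = alt-cong xs (λ ys p → altIns-cong x ys (λ zs q → e zs (trans q (cong suc p))))

altIns-+ : ∀ x f g ys → altIns x (λ zs → f zs +ℤ g zs) ys ≡ altIns x f ys +ℤ altIns x g ys
altIns-+ x f g [] = refl
altIns-+ x f g (y ∷ ys) = trans (cong ((f (x ∷ y ∷ ys) +ℤ g (x ∷ y ∷ ys)) -ℤ_)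
  (altIns-+ x (f ∘ (y ∷_)) (g ∘ (y ∷_)) ys))
  (l (f (x ∷ y ∷ ys)) (g (x ∷ y ∷ ys)) (altIns x (f ∘ (y ∷_)) ys) (altIns x (g ∘ (y ∷_)) ys))
  where
  l : ∀ a b c d → (a +ℤ b) -ℤ (c +ℤ d) ≡ (a -ℤ c) +ℤ (b -ℤ d)
  l = ℤR.solve-∀

alt-+ : ∀ f g xs → alt (λ zs → f zs +ℤ g zs) xs ≡ alt f xs +ℤ alt g xs
alt-+ f g [] = refl
alt-+ f g (x ∷ xs) = trans (alt-cong xs (λ ys _ → altIns-+ x f g ys)) (alt-+ (altIns x f) (altIns x g) xs)

altIns-* : ∀ x c f ys → altIns x (λ zs → c *ℤ f zs) ys ≡ c *ℤ altIns x f ys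
altIns-* x c f [] = refl
altIns-* x c f (y ∷ ys) = trans (cong ((c *ℤ f (x ∷ y ∷ ys)) -ℤ_) (altIns-* x c (f ∘ (y ∷_)) ys)) (l c _ _)
  where
  l : ∀ a b c → (a *ℤ b) -ℤ (a *ℤ c) ≡ a *ℤ (b -ℤ c)
  l = ℤR.solve-∀

alt-* : ∀ c f xs → alt (λ zs → c *ℤ f zs) xs ≡ c *ℤ alt f xs
alt-* c f [] = refl
alt-* c f (x ∷ xs) = trans (alt-cong xs (λ ys _ → altIns-* x c f ys)) (alt-* c (altIns x f) xs)

alt-zero : ∀ {f} xs → (∀ zs → length zs ≡ length xs → f zs ≡ 0ℤ) → alt f xs ≡ 0ℤ
alt-zero {f} xs e = trans (alt-cong {g = λ zs → 0ℤ *ℤ f zs} xs (λ zs p → trans (e zs p) (sym (ℤ.*-zeroˡ (f zs)))))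
  (trans (alt-* 0ℤ f xs) (ℤ.*-zeroˡ (alt f xs)))

alt-∑ : {A : Set} (as : List A) (f : A → List ℕ → ℤ) (xs : List ℕ) → alt (λ zs → ∑ as (λ a → f a zs)) xs ≡ ∑ as
  (λ a → alt (f a) xs)
alt-∑ [] f xs = alt-zero xs (λ _ _ → refl)
alt-∑ (a ∷ as) f xs = trans (alt-+ (f a) (λ zs → ∑ as (λ a → f a zs)) xs) (cong (alt (f a) xs +ℤ_) (alt-∑ as f xs))

SwapInvariant : {A : Set} → ℕ → (List ℕ → A) → Set
SwapInvariant k f = ∀ ys → f (swapAt k ys) ≡ f ys

-- The insertions of x before, respectively after, both of the entries k and k+1.
altIns-before altIns-after : ℕ → ℕ → (List ℕ → ℤ) → List ℕ → ℤ
altIns-before zero x f ys = 0ℤ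
altIns-before (suc k) x f [] = 0ℤ
altIns-before (suc k) x f (y ∷ ys) = f (x ∷ y ∷ ys) -ℤ altIns-before k x (f ∘ (y ∷_)) ys
altIns-after zero x f (y ∷ z ∷ zs) = altIns x (λ ws → f (y ∷ z ∷ ws)) zs
altIns-after (suc k) x f (y ∷ ys) = negℤ altIns-after k x (f ∘ (y ∷_)) ys
altIns-after _ x f _ = 0ℤ

altIns-before-swap : ∀ k x {f} → SwapInvariant (suc k) f → SwapInvariant k (altIns-before (suc k) x f)
altIns-before-swap zero x inv [] = refl
altIns-before-swap zero x inv (y ∷ []) = refl
altIns-before-swap zero x inv (y ∷ z ∷ ys) = cong (_-ℤ 0ℤ) (inv (x ∷ y ∷ z ∷ ys))
altIns-before-swap (suc k) x inv [] = refl
altIns-before-swap (suc k) x inv (y ∷ ys) =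
  cong₂ _-ℤ_ (inv (x ∷ y ∷ ys)) (altIns-before-swap k x (λ zs → inv (y ∷ zs)) ys)

altIns-after-swap : ∀ k x {f} → SwapInvariant k f → SwapInvariant k (altIns-after k x f)
altIns-after-swap zero x inv [] = refl
altIns-after-swap zero x inv (y ∷ []) = refl
altIns-after-swap zero x inv (y ∷ z ∷ zs) = altIns-cong x zs (λ ws _ → inv (y ∷ z ∷ ws))
altIns-after-swap (suc k) x inv [] = refl
altIns-after-swap (suc k) x inv (y ∷ ys) = cong negℤ_ (altIns-after-swap k x (λ zs → inv (y ∷ zs)) ys)

-- Inserting `x` just before and just after entry `k` of `ys` gives two lists that differ by the
-- swap at `k` and carry opposite signs. These two terms cancel and all others remain.
altIns-split : ∀ k x {f} → SwapInvariant k f → ∀ ys → suc k ≤ length ys →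
  altIns x f ys ≡ altIns-before k x f ys +ℤ altIns-after k x f ys
altIns-split zero x {f} inv (y ∷ []) _ = trans (cong (f (x ∷ y ∷ []) -ℤ_) (inv (x ∷ y ∷ [])))
  (ℤ.+-inverseʳ (f (x ∷ y ∷ [])))
altIns-split zero x {f} inv (y ∷ z ∷ zs) _ = trans
  (cong (λ a → f (x ∷ y ∷ z ∷ zs) -ℤ (a -ℤ altIns-after 0 x f (y ∷ z ∷ zs))) (inv (x ∷ y ∷ z ∷ zs)))
  (l (f (x ∷ y ∷ z ∷ zs)) _)
  where
  l : ∀ a b → a -ℤ (a -ℤ b) ≡ 0ℤ +ℤ b
  l = ℤR.solve-∀
altIns-split (suc k) x {f} inv (y ∷ ys) (s≤s p) = trans
  (cong (f (x ∷ y ∷ ys) -ℤ_) (altIns-split k x (λ zs → inv (y ∷ zs)) ys p))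
  (l (f (x ∷ y ∷ ys)) _ _)
  where
  l : ∀ a b c → a -ℤ (b +ℤ c) ≡ (a -ℤ b) +ℤ (negℤ c)
  l = ℤR.solve-∀

altIns-after-last : ∀ k x f ys → length ys ≡ suc k → altIns-after k x f ys ≡ 0ℤ
altIns-after-last zero x f (y ∷ []) _ = refl
altIns-after-last (suc k) x f (y ∷ ys) p = cong negℤ_ (altIns-after-last k x (f ∘ (y ∷_)) ys (suc-injective p))

-- Induction on the list, after the cancellation in `altIns-split`. An `x` in front of the invariant
-- pair leaves a function of `ys` that is invariant at `k − 1`, an `x` behind it one that is
-- invariant at `k`. If only `k + 1` entries are left, there is no place behind the pair.
alt-swapInvariant : ∀ k {f} → SwapInvariant k f → ∀ xs → suc k < length xs → alt f xs ≡ 0ℤ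
alt-swapInvariant k {f} inv (x ∷ xs) (s≤s p) = begin
  alt (altIns x f) xs
    ≡⟨ alt-cong xs (λ ys q → altIns-split k x inv ys (subst (suc k ≤_) (sym q) p)) ⟩
  alt (λ ys → altIns-before k x f ys +ℤ altIns-after k x f ys) xs
    ≡⟨ alt-+ (altIns-before k x f) (altIns-after k x f) xs ⟩
  alt (altIns-before k x f) xs +ℤ alt (altIns-after k x f) xs
    ≡⟨ cong₂ _+ℤ_ (before k inv p) after ⟩
  0ℤ ∎
  where
  open ≡-Reasoning
  before : ∀ k {f} → SwapInvariant k f → suc k ≤ length xs → alt (altIns-before k x f) xs ≡ 0ℤ
  before zero inv p = alt-zero xs (λ _ _ → refl)
  before (suc k) inv p = alt-swapInvariant k (altIns-before-swap k x inv) xs p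
  after : alt (altIns-after k x f) xs ≡ 0ℤ
  after with suc k <? length xs
  ... | yes q = alt-swapInvariant k (altIns-after-swap k x inv) xs q
  ... | no ¬q = alt-zero xs (λ ys q → altIns-after-last k x f ys (trans q (≤-antisym (≮⇒≥ ¬q) p)))

data Insertion (x : ℕ) : List ℕ → List ℕ → Set where
  here  : ∀ {ys} → Insertion x ys (x ∷ ys)
  there : ∀ {y ys zs} → Insertion x ys zs → Insertion x (y ∷ ys) (y ∷ zs)

insertion-↭ : ∀ {x ys zs} → Insertion x ys zs → zs ↭ x ∷ ys
insertion-↭ here = ↭-refl
insertion-↭ {x} (there {y} i) = ↭-trans (Perm.prep y (insertion-↭ i)) (Perm.swap y x ↭-refl)

altIns-zero : ∀ {x f} ys → (∀ {zs} → Insertion x ys zs → f zs ≡ 0ℤ) → altIns x f ys ≡ 0ℤ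
altIns-zero [] e = e here
altIns-zero (y ∷ ys) e = cong₂ _-ℤ_ (e here) (altIns-zero ys (e ∘ there))

altIns-head : ∀ {x f} ys → (∀ {y ys′ zs} → ys ≡ y ∷ ys′ → Insertion x ys′ zs → f (y ∷ zs) ≡ 0ℤ) → altIns x f ys ≡ f
  (x ∷ ys)
altIns-head [] e = refl
altIns-head {x} {f} (y ∷ ys) e = trans (cong (f (x ∷ y ∷ ys) -ℤ_) (altIns-zero ys (e refl))) (ℤ.+-identityʳ _)

-- The scalar product of ys with δ = (n−1, …, 1, 0).
weight : List ℕ → ℕ
weight [] = 0
weight (y ∷ ys) = y * length ys + weight ys

insertion-length : ∀ {x ys zs} → Insertion x ys zs → length zs ≡ suc (length ys)
insertion-length here = refl
insertion-length (there i) = cong suc (insertion-length i)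

insertion-weight : ∀ {x ys zs} → Insertion x ys zs → All (_≤ x) ys → weight zs ≤ weight (x ∷ ys)

insertion-weight-there : ∀ {x ys zs} → Insertion x ys zs → All (_≤ x) ys → ∀ y → x + weight (y ∷ zs) ≤ y + weight
  (x ∷ y ∷ ys)
insertion-weight-there {x} {ys} {zs} i ps y = begin
  x + (y * length zs + weight zs)                        ≡⟨ cong (λ n → x + (y * n + weight zs))
    (insertion-length i) ⟩
  x + (y * suc (length ys) + weight zs)                  ≤⟨ +-monoʳ-≤ x
    (+-monoʳ-≤ (y * suc (length ys)) (insertion-weight i ps)) ⟩
  x + (y * suc (length ys) + (x * length ys + weight ys)) ≡⟨ l x y (length ys) (weight ys) ⟩
  y + (x * suc (length ys) + (y * length ys + weight ys)) ∎
  where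
  open ≤-Reasoning
  l : ∀ x y n w → x + (y * suc n + (x * n + w)) ≡ y + (x * suc n + (y * n + w))
  l = solve-∀

insertion-weight here _ = ≤-refl
insertion-weight {x} (there {y} {ys} {zs} i) (p ∷ ps) =
  +-cancelˡ-≤ x (weight (y ∷ zs)) (weight (x ∷ y ∷ ys))
    (≤-trans (insertion-weight-there i ps y) (+-monoˡ-≤ (weight (x ∷ y ∷ ys)) p))

insertion-weight-< : ∀ {x y ys zs} → Insertion x ys zs → All (_≤ x) ys → y < x → weight (y ∷ zs) < weight (x ∷ y ∷ ys)
insertion-weight-< {x} {y} {ys} {zs} i ps p =
  +-cancelˡ-< x (weight (y ∷ zs)) (weight (x ∷ y ∷ ys))
    (≤-<-trans (insertion-weight-there i ps y) (+-monoˡ-< (weight (x ∷ y ∷ ys)) p))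

strict-all : ∀ {x ys} → Linked _>_ (x ∷ ys) → All (_< x) ys
strict-all [-] = []
strict-all (p ∷ l) = p ∷ All.map (λ q → <-trans q p) (strict-all l)

-- The rearrangement inequality: among the permutations of a strictly decreasing list, that list
-- alone maximises the scalar product with δ. All other terms of the alternant have smaller weight
-- and vanish.
alt-leading : ∀ {f} xs → Linked _>_ xs → (∀ ys → ys ↭ xs → weight ys < weight xs → f ys ≡ 0ℤ) → alt f xs ≡ f xs
alt-leading [] _ _ = refl
alt-leading {f} (x ∷ xs) l e = trans
  (alt-leading xs (tail l) (λ ys p w → altIns-zero ys (λ {zs} i → e zs (↭-trans (insertion-↭ i) (Perm.prep x p))
    (≤-<-trans (insertion-weight i (All.map <⇒≤ (PermP.All-resp-↭ (↭-sym p) (strict-all l))))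
      (subst (λ n → x * n + weight ys < weight (x ∷ xs)) (sym (PermP.↭-length p)) (+-monoʳ-< (x * length xs) w))))))
  (altIns-head xs λ { {y} {ys} {zs} refl i → case strict-all l of λ { (y<x ∷ ps) →
    e (y ∷ zs) (↭-trans (Perm.prep y (insertion-↭ i)) (Perm.swap y x ↭-refl))
      (insertion-weight-< i (All.map <⇒≤ ps) y<x) } })
  where
  tail : ∀ {x xs} → Linked _>_ (x ∷ xs) → Linked _>_ xs
  tail [-] = []
  tail (_ ∷ l) = l

Symmetric : {A : Set} → (List ℕ → A) → Set
Symmetric f = ∀ k → SwapInvariant k f

sortDesc : List ℕ → List ℕ
sortDesc [] = []
sortDesc (x ∷ xs) = insert x (sortDesc xs)

sortDesc-desc : ∀ xs → Desc (sortDesc xs)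
sortDesc-desc [] = []
sortDesc-desc (x ∷ xs) = insert-desc x (sortDesc-desc xs)

symmetric-insert : {A : Set} {f : List ℕ → A} → Symmetric f → ∀ x ys → f (insert x ys) ≡ f (x ∷ ys)
symmetric-insert s x [] = refl
symmetric-insert s x (y ∷ ys) with x <? y
... | yes _ = trans (symmetric-insert (λ k zs → s (suc k) (y ∷ zs)) x ys) (s 0 (x ∷ y ∷ ys))
... | no _ = refl

symmetric-sort : {A : Set} {f : List ℕ → A} → Symmetric f → ∀ xs → f (sortDesc xs) ≡ f xs
symmetric-sort s [] = refl
symmetric-sort s (x ∷ xs) = trans (symmetric-insert s x (sortDesc xs))
  (symmetric-sort (λ k zs → s (suc k) (x ∷ zs)) xs)

addδ : List ℕ → List ℕ
addδ [] = []
addδ (b ∷ β) = b + length β ∷ addδ β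

addδ-length : ∀ β → length (addδ β) ≡ length β
addδ-length [] = refl
addδ-length (b ∷ β) = cong suc (addδ-length β)

addδ-strict : ∀ {β} → Desc β → Linked _>_ (addδ β)
addδ-strict [] = []
addδ-strict [-] = [-]
addδ-strict {x ∷ y ∷ β} (p ∷ d) = subst (y + length β <_) (sym (+-suc x (length β)))
  (s≤s (+-monoˡ-≤ (length β) p)) ∷ addδ-strict d

squares : List ℕ → ℕ
squares = sum ∘ map (λ x → x * x)

squares-δ : ℕ → ℕ
squares-δ zero = 0
squares-δ (suc n) = n * n + squares-δ n

-- With ξ = β + δ this is |ξ|² + |δ|² = |β|² + 2 ξ·δ. The left side is the same for all permutations
-- of ξ, so a smaller weight of ξ means a larger sum of squares of β.
squares-addδ : ∀ β → squares (addδ β) + squares-δ (length β) ≡ squares β + (weight (addδ β) + weight (addδ β))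
squares-addδ [] = refl
squares-addδ (b ∷ β) = begin
  (b + n) * (b + n) + s + (n * n + d)                ≡⟨ l₁ b n s d ⟩
  (b * b + ((b + n) * n + (b + n) * n)) + (s + d)    ≡⟨ cong (b * b + ((b + n) * n + (b + n) * n) +_)
    (squares-addδ β) ⟩
  (b * b + ((b + n) * n + (b + n) * n)) + (squares β + (w + w)) ≡⟨ l₂ (b * b) ((b + n) * n) (squares β) w ⟩
  b * b + squares β + ((b + n) * n + w + ((b + n) * n + w)) ≡⟨ cong
    (λ m → b * b + squares β + ((b + n) * m + w + ((b + n) * m + w))) (sym (addδ-length β)) ⟩
  squares (b ∷ β) + (weight (addδ (b ∷ β)) + weight (addδ (b ∷ β))) ∎
  where
  open ≡-Reasoning
  n = length β
  s = squares (addδ β)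
  d = squares-δ n
  w = weight (addδ β)
  l₁ : ∀ b n s d → (b + n) * (b + n) + s + (n * n + d) ≡ (b * b + ((b + n) * n + (b + n) * n)) + (s + d)
  l₁ = solve-∀
  l₂ : ∀ p q r w → (p + (q + q)) + (r + (w + w)) ≡ p + r + (q + w + (q + w))
  l₂ = solve-∀

squares-≤ : ∀ β → squares β ≤ sum β * sum β
squares-≤ [] = z≤n
squares-≤ (b ∷ β) = ≤-trans (+-monoʳ-≤ (b * b) (squares-≤ β))
  (subst (b * b + sum β * sum β ≤_) (l b (sum β)) (m≤m+n _ _))
  where
  l : ∀ a b → a * a + b * b + (a * b + a * b) ≡ (a + b) * (a + b)
  l = solve-∀

-- Antisymmetrising V̂(β + δ) = V(β) leaves V(β) for a partition β and further values of V at
-- vectors with a larger sum of squares; these vanish by downward induction.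
vanishing : (N K : ℕ) (V V̂ : List ℕ → ℤ) → Symmetric V →
  (∀ β → length β ≡ K → V̂ (addδ β) ≡ V β) →
  (∀ ξ → length ξ ≡ K → (∃ λ β → ξ ≡ addδ β) ⊎ V̂ ξ ≡ 0ℤ) →
  (∀ ξ → length ξ ≡ K → alt V̂ ξ ≡ 0ℤ) →
  (∀ β → sum β ≢ N → V β ≡ 0ℤ) →
  ∀ β → length β ≡ K → V β ≡ 0ℤ
vanishing N K V V̂ symm shift neg alt0 big β β-len = go (suc (N * N)) β β-len (m≤n+m (suc (N * N)) (squares β))
  where
  symmetric-length : Symmetric (length {A = ℕ})
  symmetric-length k ys = swapAt-length k ys
  symmetric-squares : Symmetric squares
  symmetric-squares zero [] = refl
  symmetric-squares zero (_ ∷ []) = refl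
  symmetric-squares zero (x ∷ y ∷ ys) = x∙yz≈y∙xz (y * y) (x * x) (squares ys)
  symmetric-squares (suc k) [] = refl
  symmetric-squares (suc k) (x ∷ ys) = cong (x * x +_) (symmetric-squares k ys)
  -- `q` is fuel for the growth of the sum of squares: once this exceeds `N * N`, the sum of `β`
  -- cannot be `N` and `big` applies.
  go : ∀ q β → length β ≡ K → N * N < squares β + q → V β ≡ 0ℤ
  go zero β len h with sum β ≟ N
  ... | yes refl = ⊥-elim (<⇒≱ (subst (N * N <_) (+-identityʳ (squares β)) h) (squares-≤ β))
  ... | no ¬p = big β ¬p
  -- By symmetry `β` may be sorted; only then is β + δ strictly decreasing, as `alt-leading`
  -- demands.
  go (suc q) β len h = trans (sym (symmetric-sort symm β)) (trans (sym (shift θ θ-len))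
    (trans (sym (alt-leading ξ (addδ-strict (sortDesc-desc β)) lower)) (alt0 ξ (trans (addδ-length θ) θ-len))))
    where
    θ = sortDesc β
    θ-len : length θ ≡ K
    θ-len = trans (symmetric-sort symmetric-length β) len
    ξ = addδ θ
    lower : ∀ ys → ys ↭ ξ → weight ys < weight ξ → V̂ ys ≡ 0ℤ
    lower ys p w with neg ys (trans (PermP.↭-length p) (trans (addδ-length θ) θ-len))
    ... | inj₂ e = e
    ... | inj₁ (γ , refl) = trans (shift γ γ-len)
      (go q γ γ-len (≤-trans h (≤-trans (≤-reflexive (+-suc (squares β) q))
        (+-monoˡ-≤ q (subst (_< squares γ) (symmetric-sort symmetric-squares β) more)))))
      where
      γ-len : length γ ≡ K
      γ-len = trans (sym (addδ-length γ)) (trans (PermP.↭-length p) (trans (addδ-length θ) θ-len))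
      eq : squares γ + (weight ys + weight ys) ≡ squares θ + (weight ξ + weight ξ)
      eq = trans (sym (squares-addδ γ)) (trans
        (cong₂ _+_ (sum-↭ (PermP.map⁺ (λ x → x * x) p)) (cong squares-δ (trans γ-len (sym θ-len)))) (squares-addδ θ))
      more : squares θ < squares γ
      more = +-cancelʳ-< (weight ys + weight ys) (squares θ) (squares γ)
        (subst (squares θ + (weight ys + weight ys) <_) (sym eq) (+-monoʳ-< (squares θ) (+-mono-< w w)))

-- Cancellation of the fillings that violate the lattice condition

length-filter-split : {A : Set} {P Q R : A → Set} (P? : Decidable P) (Q? : Decidable Q) (R? : Decidable R) →
  (∀ {a} → R a → ¬ P a × Q a) → (∀ {a} → ¬ P a → Q a → R a) → (xs : List A) →
  length (filter Q? xs) ≡ length (filter (λ a → P? a ×-dec Q? a) xs) + length (filter R? xs)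
length-filter-split P? Q? R? to from [] = refl
length-filter-split P? Q? R? to from (x ∷ xs) with P? x | Q? x | R? x
... | yes p | _     | yes r = ⊥-elim (proj₁ (to r) p)
... | yes p | yes q | no _  = cong suc (length-filter-split P? Q? R? to from xs)
... | yes p | no _  | no _  = length-filter-split P? Q? R? to from xs
... | no ¬p | yes q | yes _ = trans (cong suc (length-filter-split P? Q? R? to from xs)) (sym (+-suc _ _))
... | no ¬p | yes q | no ¬r = ⊥-elim (¬r (from ¬p q))
... | no ¬p | no ¬q | yes r = ⊥-elim (¬q (proj₂ (to r)))
... | no ¬p | no ¬q | no _  = length-filter-split P? Q? R? to from xs

rowCodes : ℕ → ℕ → List (ℕ × ℕ)
rowCodes t zero = []
rowCodes t (suc j) = (t , j) ∷ rowCodes t j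

-- The possible violations: prefix length `t`, letters `j` and `j + 1`. The list grows at its front,
-- by increasing `t` and then increasing `j`, so that each step excludes one more violation on top
-- of all earlier ones.
codes : ℕ → ℕ → List (ℕ × ℕ)
codes zero J = []
codes (suc t) J = rowCodes t J ++ codes t J

rowCodes-∈ : ∀ {t j} J → j < J → (t , j) ∈ rowCodes t J
rowCodes-∈ {t} {j} (suc J) (s≤s p) with j ≟ J
... | yes refl = here refl
... | no ¬e = there (rowCodes-∈ J (≤∧≢⇒< p ¬e))

codes-∈ : ∀ {i j J} t → i < t → j < J → (i , j) ∈ codes t J
codes-∈ {i} {j} {J} (suc t) (s≤s p) q with i ≟ t
... | yes refl = ∈-++⁺ˡ (rowCodes-∈ J q)
... | no ¬e = ∈-++⁺ʳ (rowCodes t J) (codes-∈ t (≤∧≢⇒< p ¬e) q)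

∈-rowCodes : ∀ {c t} J → c ∈ rowCodes t J → proj₁ c ≡ t
∈-rowCodes (suc J) (here refl) = refl
∈-rowCodes (suc J) (there p) = ∈-rowCodes J p

∈-codes : ∀ {c J} t → c ∈ codes t J → proj₁ c < t
∈-codes {c} {J} (suc t) p with ∈-++⁻ (rowCodes t J) p
... | inj₁ q = s≤s (≤-reflexive (∈-rowCodes J q))
... | inj₂ q = m<n⇒m<1+n (∈-codes t q)

NoExcess : List (ℕ × ℕ) → Shape → List Shape → Set
NoExcess cs u F = All (λ c → ¬ At (Excess (proj₁ c)) (proj₂ c) u F) cs

noExcess? : ∀ cs u → Decidable (NoExcess cs u)
noExcess? cs u F = All.all? (λ c → ¬? (at? (excess? (proj₁ c)) (proj₂ c) u F)) cs

module _ (top z : Shape) (top-desc : Desc₂ top) where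
  private
    module N = VChains top (λ _ → 0)
    module N̂ = VChains top id

  top-inside : N̂.Inside top
  top-inside = (PW.refl ≤-refl , PW.refl ≤-refl) , top-desc

  #V : List ℕ → ℕ
  #V β = N.#chains top β z

  #V̂ : List ℕ → ℕ
  #V̂ ξ = N̂.#chains top ξ z

  #noExcess : List (ℕ × ℕ) → List ℕ → ℕ
  #noExcess cs ξ = length (filter (noExcess? cs top) (N̂.chains top ξ z))

  firstExcess? : ∀ t j cs → Decidable (λ F → At (Excess t) j top F × NoExcess cs top F)
  firstExcess? t j cs F = at? (excess? t) j top F ×-dec noExcess? cs top F

  -- `cs` holds the violations already excluded. As none of them lies beyond `t`, the flip at
  -- `(t , j)` preserves their absence; as all `(i , j)` with `i < t` are among them, an excess at
  -- `t` is a first excess.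
  module _ (t j : ℕ) (cs : List (ℕ × ℕ)) (cs≤t : ∀ {c} → c ∈ cs → proj₁ c ≤ t)
    (earlier : ∀ {i} → i < t → (i , j) ∈ cs) where

    firstExcess-swap-∈ : ∀ ξ {F} → F ∈ filter (firstExcess? t j cs) (N̂.chains top ξ z) →
      flipAt t j top F ∈ filter (firstExcess? t j cs) (N̂.chains top (swapAt j ξ) z)
    firstExcess-swap-∈ ξ F∈ with ∈-filter⁻ (firstExcess? t j cs) {xs = N̂.chains top ξ z} F∈
    ... | F∈′ , ex , none = ∈-filter⁺ (firstExcess? t j cs)
        (N̂.chains-complete (N̂.flipAt-chain t j top-inside c
          (swappable j top-inside c (firstExcessAt j ex (λ i<t → All.lookup none (earlier i<t))))))
        (proj₂ (N̂.excessAt-flip t j j ≤-refl top-inside c) ex ,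
         All.tabulate (λ {c′} c∈ e → All.lookup none c∈
           (proj₁ (N̂.excessAt-flip t j (proj₂ c′) (cs≤t c∈) top-inside c) e)))
      where
      c = N̂.chains-sound top ξ z F∈′
      swappable : ∀ j {u ξ F} → N̂.Inside u → N̂.IsChain u ξ F z → At (FirstExcess t) j u F → At
        (N̂.Swappable t) j u F
      swappable zero {C} C-in (_∷_ {v = B} (B∈ , vB , _) (_∷_ {v = A} (A∈ , vA , _) c)) f =
        firstExcess-topHeavy {t} (between₂ vA vB) f ,
        λ w n → trans (cong (_+ n) (flip₂-size-excess {t} (proj₂ (N̂.∈U⇒inside A∈)) (proj₂ (N̂.∈U⇒inside B∈))
          (proj₂ C-in) w f))
          (sym (+-suc (size A + size C) n))
      swappable zero _ (_ ∷ []) ()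
      swappable (suc j) _ ((B∈ , _) ∷ c) f = swappable j (N̂.∈U⇒inside B∈) c f

    firstExcess-swap : ∀ ξ → length (filter (firstExcess? t j cs) (N̂.chains top (swapAt j ξ) z)) ≡
      length (filter (firstExcess? t j cs) (N̂.chains top ξ z))
    firstExcess-swap ξ = length-bij
      (Unique.filter⁺ (firstExcess? t j cs) (N̂.chains-unique top (swapAt j ξ) z))
      (Unique.filter⁺ (firstExcess? t j cs) (N̂.chains-unique top ξ z))
      (flipAt t j top) (flipAt t j top)
      (λ {F} F∈ → subst (λ η → flipAt t j top F ∈ filter (firstExcess? t j cs) (N̂.chains top η z))
        (swapAt-involutive j ξ)
        (firstExcess-swap-∈ (swapAt j ξ) F∈))
      (firstExcess-swap-∈ ξ)
      (λ F∈ → inv (swapAt j ξ) F∈) (λ F∈ → inv ξ F∈)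
      where
      inv : ∀ ξ {F} → F ∈ filter (firstExcess? t j cs) (N̂.chains top ξ z) → flipAt t j top (flipAt t j top F) ≡ F
      inv ξ F∈ = N̂.flipAt-involutive t j top-inside
        (N̂.chains-sound top ξ z (proj₁ (∈-filter⁻ (firstExcess? t j cs) {xs = N̂.chains top ξ z} F∈)))

    -- The chains that violate `(t , j)` but nothing in `cs` are equinumerous for a content and its
    -- transposition at `j`, so the alternant of their number is zero.
    alt-noExcess-∷ : ∀ ξ → suc j < length ξ →
      alt (λ η → pos (#noExcess cs η)) ξ ≡ alt (λ η → pos (#noExcess ((t , j) ∷ cs) η)) ξ
    alt-noExcess-∷ ξ j< = begin
      alt (λ η → pos (#noExcess cs η)) ξ
        ≡⟨ alt-cong ξ (λ η _ → cong pos (length-filter-split (at? (excess? t) j top) (noExcess? cs top)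
          (noExcess? ((t , j) ∷ cs) top)
             (λ { (e ∷ es) → e , es }) _∷_ (N̂.chains top η z))) ⟩
      alt (λ η → pos (first η + rest η)) ξ
        ≡⟨ alt-cong ξ (λ η _ → ℤ.pos-+ (first η) (rest η)) ⟩
      alt (λ η → pos (first η) +ℤ pos (rest η)) ξ
        ≡⟨ alt-+ (pos ∘ first) (pos ∘ rest) ξ ⟩
      alt (pos ∘ first) ξ +ℤ alt (pos ∘ rest) ξ
        ≡⟨ cong (_+ℤ alt (pos ∘ rest) ξ) (alt-swapInvariant j (λ η → cong pos (firstExcess-swap η)) ξ j<) ⟩
      0ℤ +ℤ alt (pos ∘ rest) ξ
        ≡⟨ ℤ.+-identityˡ _ ⟩
      alt (pos ∘ rest) ξ ∎
      where
      open ≡-Reasoning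
      first rest : List ℕ → ℕ
      first η = length (filter (firstExcess? t j cs) (N̂.chains top η z))
      rest η = #noExcess ((t , j) ∷ cs) η

  alt-noExcess : ∀ T ξ {J} → length ξ ≡ suc J → alt (λ η → pos (#V̂ η)) ξ ≡ alt
    (λ η → pos (#noExcess (codes T J) η)) ξ
  alt-noExcess zero ξ len = alt-cong ξ (λ η _ → cong (pos ∘ length)
    (sym (List.filter-all (noExcess? [] top) (All.tabulate {xs = N̂.chains top η z} (λ _ → [])))))
  alt-noExcess (suc t) ξ {J} len = trans (alt-noExcess t ξ len) (go J ≤-refl)
    where
    go : ∀ j → j ≤ J → alt (λ η → pos (#noExcess (codes t J) η)) ξ ≡ alt
      (λ η → pos (#noExcess (rowCodes t j ++ codes t J) η)) ξ
    go zero _ = refl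
    go (suc j) j<J = trans (go j (<⇒≤ j<J)) (alt-noExcess-∷ t j (rowCodes t j ++ codes t J)
      (λ c∈ → case ∈-++⁻ (rowCodes t j) c∈ of λ { (inj₁ p) → ≤-reflexive (∈-rowCodes j p) ; (inj₂ p) → <⇒≤
        (∈-codes t p) })
      (λ i<t → ∈-++⁺ʳ (rowCodes t j) (codes-∈ t i<t j<J))
      ξ (subst (suc j <_) (sym len) (s≤s j<J)))

  -- The ordinary Bender-Knuth argument: with `t = 0` no row is kept, so no condition on the border
  -- arises, and with the zero shift the multiplicities themselves are transposed.
  #V-symmetric : Symmetric #V
  #V-symmetric j β with suc j <? length β
  ... | no ¬p = cong #V (swapAt-beyond j β (≮⇒≥ ¬p))
  ... | yes p = length-bij (N.chains-unique top (swapAt j β) z) (N.chains-unique top β z)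
    (flipAt 0 j top) (flipAt 0 j top)
    (λ F∈ → subst (λ γ → _ ∈ N.chains top γ z) (swapAt-involutive j β)
      (N.chains-complete (N.flipAt-chain 0 j top-inside (N.chains-sound top (swapAt j β) z F∈)
        (swappable j (N.chains-sound top (swapAt j β) z F∈) (subst (suc j <_) (sym (swapAt-length j β)) p)))))
    (λ F∈ → N.chains-complete (N.flipAt-chain 0 j top-inside (N.chains-sound top β z F∈)
      (swappable j (N.chains-sound top β z F∈) p)))
    (λ F∈ → N.flipAt-involutive 0 j top-inside (N.chains-sound top (swapAt j β) z F∈))
    (λ F∈ → N.flipAt-involutive 0 j top-inside (N.chains-sound top β z F∈))
    where
    swappable : ∀ j {u β F} → N.IsChain u β F z → suc j < length β → At (N.Swappable 0) j u F
    swappable zero (_ ∷ []) (s≤s ())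
    swappable zero {C} (_∷_ {v = B} _ (_∷_ {v = A} _ c)) _ = (tt , tt) , λ w _ → cong (_+ 0)
      (trans (+-interchange (sum (flip (proj₁ A) (proj₁ B) (proj₁ C))) _ (sum (proj₁ B)) _)
      (trans (cong₂ _+_ (flip-sum (proj₁ w)) (flip-sum (proj₂ w)))
        (+-interchange (sum (proj₁ A)) (sum (proj₁ C)) (sum (proj₂ A)) (sum (proj₂ C)))))
    swappable (suc j) (_ ∷ c) (s≤s p) = swappable j c p

  addδ-chain⁻ : ∀ β {u F} → N̂.IsChain u (addδ β) F z → N.IsChain u β F z
  addδ-chain⁻ [] [] = []
  addδ-chain⁻ (b ∷ β) {u} (_∷_ {v = v} (v∈ , s , e) c) = (v∈ , s , trans (+-identityʳ (size u))
    (+-cancelʳ-≡ (length β) _ _ (trans (cong (size u +_) (sym (addδ-length β)))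
      (trans e (l b (length β) (size v)))))) ∷ addδ-chain⁻ β c
    where
    l : ∀ b n s → (b + n) + s ≡ (b + s) + n
    l = solve-∀

  addδ-chain⁺ : ∀ {β u F} → N.IsChain u β F z → N̂.IsChain u (addδ β) F z
  addδ-chain⁺ [] = []
  addδ-chain⁺ {b ∷ β} {u} (_∷_ {v = v} (v∈ , s , e) c) = (v∈ , s ,
    trans (cong (size u +_) (addδ-length β)) (trans (cong (_+ length β) (trans (sym (+-identityʳ (size u))) e))
      (l b (size v) (length β)))) ∷ addδ-chain⁺ c
    where
    l : ∀ b s n → (b + s) + n ≡ (b + n) + s
    l = solve-∀

  #V̂-addδ : ∀ β → #V̂ (addδ β) ≡ #V β
  #V̂-addδ β = length-bij (N̂.chains-unique top (addδ β) z) (N.chains-unique top β z) id id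
    (λ F∈ → N.chains-complete (addδ-chain⁻ β (N̂.chains-sound top (addδ β) z F∈)))
    (λ F∈ → N̂.chains-complete (addδ-chain⁺ (N.chains-sound top β z F∈))) (λ _ → refl) (λ _ → refl)

  #noExcess-addδ : ∀ cs β → #noExcess cs (addδ β) ≡ length (filter (noExcess? cs top) (N.chains top β z))
  #noExcess-addδ cs β = length-bij (Unique.filter⁺ (noExcess? cs top) (N̂.chains-unique top (addδ β) z))
    (Unique.filter⁺ (noExcess? cs top) (N.chains-unique top β z)) id id
    (λ F∈ → let (c , n) = ∈-filter⁻ (noExcess? cs top) {xs = N̂.chains top (addδ β) z} F∈ in
      ∈-filter⁺ (noExcess? cs top) (N.chains-complete (addδ-chain⁻ β (N̂.chains-sound top (addδ β) z c))) n)
    (λ F∈ → let (c , n) = ∈-filter⁻ (noExcess? cs top) {xs = N.chains top β z} F∈ in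
      ∈-filter⁺ (noExcess? cs top) (N̂.chains-complete (addδ-chain⁺ (N.chains-sound top β z c))) n)
    (λ _ → refl) (λ _ → refl)

  -- Sizes weakly decrease along a chain, so `|S_j| + δ_j = ξ_j + |S_(j+1)|` forces `δ_j ≤ ξ_j`.
  -- Vectors not of the form β + δ therefore have no chains at all.
  VChain̂-addδ : ∀ {u ξ F} → N̂.IsChain u ξ F z → ∃ λ β → ξ ≡ addδ β
  VChain̂-addδ [] = [] , refl
  VChain̂-addδ {u} {b ∷ ξ} (_∷_ {v = v} (v∈ , s , e) c) with VChain̂-addδ c
  ... | β , refl = b ∸ length β ∷ β , cong (_∷ addδ β) (sym (m∸n+n≡m (+-cancelʳ-≤ (size v) (length β) b
      (≤-trans (+-monoʳ-≤ (length β) (vstrip₂-size s))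
        (≤-reflexive (trans (+-comm (length β) (size u)) (trans (cong (size u +_) (sym (addδ-length β))) e)))))))

  #V̂-zero : ∀ ξ → ¬ (∃ λ β → ξ ≡ addδ β) → #V̂ ξ ≡ 0
  #V̂-zero ξ ¬δ = length-empty (λ F∈ → ¬δ (VChain̂-addδ (N̂.chains-sound top ξ z F∈)))

  #noExcess-zero : ∀ cs ξ → ¬ (∃ λ β → ξ ≡ addδ β) → #noExcess cs ξ ≡ 0
  #noExcess-zero cs ξ ¬δ = n≤0⇒n≡0 (≤-trans (List.length-filter (noExcess? cs top) (N̂.chains top ξ z))
    (≤-reflexive (#V̂-zero ξ ¬δ)))

  V-size : ∀ {u β F} → N.IsChain u β F z → size u ≡ sum β + size z
  V-size [] = refl
  V-size {u} {b ∷ β} (_∷_ {v = v} (_ , _ , e) c) = trans (sym (+-identityʳ (size u)))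
    (trans e (trans (cong (b +_) (V-size c)) (sym (+-assoc b (sum β) (size z)))))

  #V-size : ∀ β → sum β + size z ≢ size top → #V β ≡ 0
  #V-size β ne = length-empty (λ F∈ → ne (sym (V-size (N.chains-sound top β z F∈))))

-- Vertical against horizontal strips

-- Interlacing: a row of the inner shape is at least the next row of the outer one. In the last row
-- this is vacuous, by the default 0 of `part`.
data HStrip : List ℕ → List ℕ → Set where
  []  : HStrip [] []
  _∷_ : ∀ {v w vs ws} → v ≤ w × part ws 0 ≤ v → HStrip vs ws → HStrip (v ∷ vs) (w ∷ ws)

hstrip? : ∀ vs ws → Dec (HStrip vs ws)
hstrip? [] [] = yes []
hstrip? [] (_ ∷ _) = no λ ()
hstrip? (_ ∷ _) [] = no λ ()
hstrip? (v ∷ vs) (w ∷ ws) = map′ (λ { (p , ps) → p ∷ ps }) (λ { (p ∷ ps) → p , ps })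
  (((v ≤? w) ×-dec (part ws 0 ≤? v)) ×-dec hstrip? vs ws)

HStrip₂ : Shape → Shape → Set
HStrip₂ (v , v′) (w , w′) = HStrip v w × HStrip v′ w′

hstrip₂? : ∀ v w → Dec (HStrip₂ v w)
hstrip₂? (v , v′) (w , w′) = hstrip? v w ×-dec hstrip? v′ w′

vstrip₂? : ∀ v w → Dec (VStrip₂ v w)
vstrip₂? (v , v′) (w , w′) = vstrip? v w ×-dec vstrip? v′ w′

sgn : ℕ → ℤ
sgn zero = 1ℤ
sgn (suc n) = negℤ sgn n

sgn-+ : ∀ m n → sgn (m + n) ≡ sgn m *ℤ sgn n
sgn-+ zero n = sym (ℤ.*-identityˡ (sgn n))
sgn-+ (suc m) n = trans (cong negℤ_ (sgn-+ m n)) (ℤ.neg-distribˡ-* (sgn m) (sgn n))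

sgn-square : ∀ n → sgn n *ℤ sgn n ≡ 1ℤ
sgn-square zero = refl
sgn-square (suc n) = trans (l (sgn n)) (sgn-square n)
  where
  l : ∀ a → negℤ a *ℤ negℤ a ≡ a *ℤ a
  l = ℤR.solve-∀

∑-two : {A : Set} {xs : List A} → Unique xs → {a b : A} → a ≢ b → a ∈ xs → b ∈ xs → (f : A → ℤ) →
  (∀ {x} → x ∈ xs → x ≢ a → x ≢ b → f x ≡ 0ℤ) → ∑ xs f ≡ f a +ℤ f b
∑-two (x∉ ∷ u) ne (here refl) (here refl) f z = ⊥-elim (ne refl)
∑-two {xs = x ∷ xs} (x∉ ∷ u) ne (here refl) (there b∈) f z =
  cong (f x +ℤ_) (∑-single u b∈ f (λ y∈ y≢b → z (there y∈) (λ { refl → All.lookup x∉ y∈ refl }) y≢b))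
∑-two {xs = x ∷ xs} (x∉ ∷ u) {a} ne (there a∈) (here refl) f z =
  trans (cong (f x +ℤ_) (∑-single u a∈ f (λ y∈ y≢a → z (there y∈) y≢a (λ { refl → All.lookup x∉ y∈ refl }))))
    (ℤ.+-comm (f x) (f a))
∑-two (x∉ ∷ u) ne (there a∈) (there b∈) f z =
  trans (cong₂ _+ℤ_ (z (here refl) (λ { refl → All.lookup x∉ a∈ refl }) (λ { refl → All.lookup x∉ b∈ refl }))
    (∑-two u ne a∈ b∈ f (z ∘ there))) (ℤ.+-identityˡ _)

-- The contribution of a vertical strip u/v followed by a horizontal strip w/u.
signed : List ℕ → List ℕ → List ℕ → ℤ
signed v w u = sgn (sum u) *ℤ (ind (vstrip? v u) *ℤ ind (hstrip? u w))

signed-row : ℕ → ℕ → ℕ → ℕ → ℤ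
signed-row v w h b = sgn b *ℤ (ind ((v ≤? b) ×-dec (b ≤? suc v)) *ℤ ind ((b ≤? w) ×-dec (h ≤? b)))

signed-∷ : ∀ v vs w ws b u → signed (v ∷ vs) (w ∷ ws) (b ∷ u) ≡ signed-row v w (part ws 0) b *ℤ signed vs ws u
signed-∷ v vs w ws b u = trans (cong₂ _*ℤ_ (sgn-+ b (sum u)) (cong₂ _*ℤ_
    (trans (ind-⇔ (vstrip? (v ∷ vs) (b ∷ u)) (((v ≤? b) ×-dec (b ≤? suc v)) ×-dec vstrip? vs u)
      (λ { (p ∷ ps) → p , ps }) (λ { (p , ps) → p ∷ ps })) (ind-× ((v ≤? b) ×-dec (b ≤? suc v)) (vstrip? vs u)))
    (trans (ind-⇔ (hstrip? (b ∷ u) (w ∷ ws)) (((b ≤? w) ×-dec (part ws 0 ≤? b)) ×-dec hstrip? u ws)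
      (λ { (p ∷ ps) → p , ps }) (λ { (p , ps) → p ∷ ps })) (ind-× ((b ≤? w) ×-dec (part ws 0 ≤? b)) (hstrip? u ws)))))
  (l (sgn b) (sgn (sum u)) (ind ((v ≤? b) ×-dec (b ≤? suc v))) (ind (vstrip? vs u))
    (ind ((b ≤? w) ×-dec (part ws 0 ≤? b))) (ind (hstrip? u ws)))
  where
  l : ∀ a b c d e f → (a *ℤ b) *ℤ ((c *ℤ d) *ℤ (e *ℤ f)) ≡ (a *ℤ (c *ℤ e)) *ℤ (b *ℤ (d *ℤ f))
  l = ℤR.solve-∀

-- The vertical strip allows `v` and `v + 1`, the horizontal one the interval from `h` to `w`. If
-- `v < w`, both values qualify and cancel; if `v = w`, only `v` does; if `w < v`, neither.
∑-signed-row : ∀ v w h a → v ≤ a → w ≤ a → h ≤ v → ∑ (upTo (suc a)) (signed-row v w h) ≡ ind (v ≟ w) *ℤ sgn v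
∑-signed-row v w h a v≤a w≤a h≤v with <-cmp v w
... | tri≈ ¬< refl ¬> = trans (∑-single (Unique.upTo⁺ (suc a)) (∈-upTo⁺ (s≤s v≤a)) (signed-row v v h) off)
  (trans (cong (sgn v *ℤ_) (cong₂ _*ℤ_ (ind-yes ((v ≤? v) ×-dec (v ≤? suc v)) (≤-refl , n≤1+n v))
    (ind-yes ((v ≤? v) ×-dec (h ≤? v)) (≤-refl , h≤v))))
  (trans (ℤ.*-comm (sgn v) 1ℤ) (cong (_*ℤ sgn v) (sym (ind-yes (v ≟ v) refl)))))
  where
  off : ∀ {b} → b ∈ upTo (suc a) → b ≢ v → signed-row v v h b ≡ 0ℤ
  off {b} _ b≢v with (v ≤? b) ×-dec (b ≤? suc v) | (b ≤? v) ×-dec (h ≤? b)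
  ... | yes (p , _) | yes (q , _) = ⊥-elim (b≢v (≤-antisym q p))
  ... | yes _ | no _ = ℤ.*-zeroʳ (sgn b)
  ... | no _ | yes _ = ℤ.*-zeroʳ (sgn b)
  ... | no _ | no _ = ℤ.*-zeroʳ (sgn b)
... | tri< v<w v≢w _ = trans (∑-two (Unique.upTo⁺ (suc a)) (λ e → 1+n≢n (sym e)) (∈-upTo⁺ (s≤s v≤a))
  (∈-upTo⁺ (s≤s (≤-trans v<w w≤a))) (signed-row v w h) off)
  (trans (cong₂ _+ℤ_
    (cong (sgn v *ℤ_) (cong₂ _*ℤ_ (ind-yes ((v ≤? v) ×-dec (v ≤? suc v)) (≤-refl , n≤1+n v))
      (ind-yes ((v ≤? w) ×-dec (h ≤? v)) (<⇒≤ v<w , h≤v))))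
    (cong (sgn (suc v) *ℤ_) (cong₂ _*ℤ_ (ind-yes ((v ≤? suc v) ×-dec (suc v ≤? suc v)) (n≤1+n v , ≤-refl))
      (ind-yes ((suc v ≤? w) ×-dec (h ≤? suc v)) (v<w , m≤n⇒m≤1+n h≤v)))))
  (trans (l (sgn v)) (sym (trans (cong (_*ℤ sgn v) (ind-no (v ≟ w) v≢w)) (ℤ.*-zeroˡ (sgn v))))))
  where
  l : ∀ a → (a *ℤ (1ℤ *ℤ 1ℤ)) +ℤ (negℤ a *ℤ (1ℤ *ℤ 1ℤ)) ≡ 0ℤ
  l = ℤR.solve-∀
  off : ∀ {b} → b ∈ upTo (suc a) → b ≢ v → b ≢ suc v → signed-row v w h b ≡ 0ℤ
  off {b} _ b≢v b≢sv with (v ≤? b) ×-dec (b ≤? suc v)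
  ... | yes (p , q) = ⊥-elim (b≢sv (≤-antisym q (≤∧≢⇒< p (b≢v ∘ sym))))
  ... | no _ = trans (cong (sgn b *ℤ_) (ℤ.*-zeroˡ (ind ((b ≤? w) ×-dec (h ≤? b))))) (ℤ.*-zeroʳ (sgn b))
... | tri> _ v≢w w<v = trans (∑-zero (upTo (suc a)) off)
  (sym (trans (cong (_*ℤ sgn v) (ind-no (v ≟ w) v≢w)) (ℤ.*-zeroˡ (sgn v))))
  where
  off : ∀ {b} → b ∈ upTo (suc a) → signed-row v w h b ≡ 0ℤ
  off {b} _ with (v ≤? b) ×-dec (b ≤? suc v) | (b ≤? w) ×-dec (h ≤? b)
  ... | yes (p , _) | yes (q , _) = ⊥-elim (<⇒≱ w<v (≤-trans p q))
  ... | yes _ | no _ = ℤ.*-zeroʳ (sgn b)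
  ... | no _ | yes _ = ℤ.*-zeroʳ (sgn b)
  ... | no _ | no _ = ℤ.*-zeroʳ (sgn b)

_≟ₗ_ : DecidableEquality (List ℕ)
_≟ₗ_ = List.≡-dec _≟_

part-head : ∀ {v vs} → Desc (v ∷ vs) → part vs 0 ≤ v
part-head [-] = z≤n
part-head (p ∷ _) = p

-- The local form of Σ_j (-1)^j e_j h_{n-j} = 0, for a fixed inner and outer shape: the conditions
-- on the middle shape factor over its rows, because interlacing refers to the next row of the outer
-- shape only.
∑-signed : ∀ {s v w} → Pointwise _≤_ v s → Pointwise _≤_ w s → Desc v →
  ∑ (belowVec s) (signed v w) ≡ ind (v ≟ₗ w) *ℤ sgn (sum v)
∑-signed [] [] d = refl
∑-signed {a ∷ s} {v ∷ vs} {w ∷ ws} (p ∷ ps) (q ∷ qs) d = begin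
  ∑ (belowVec (a ∷ s)) (signed (v ∷ vs) (w ∷ ws))
    ≡⟨ ∑-concatMap (λ b → map (b ∷_) (belowVec s)) (upTo (suc a)) (signed (v ∷ vs) (w ∷ ws)) ⟩
  ∑ (upTo (suc a)) (λ b → ∑ (map (b ∷_) (belowVec s)) (signed (v ∷ vs) (w ∷ ws)))
    ≡⟨ ∑-cong (upTo (suc a)) (λ {b} _ → trans (∑-map (b ∷_) (belowVec s) (signed (v ∷ vs) (w ∷ ws)))
         (trans (∑-cong (belowVec s) (λ {u} _ → signed-∷ v vs w ws b u))
           (∑-*ˡ (signed-row v w (part ws 0) b) (belowVec s) (signed vs ws)))) ⟩
  ∑ (upTo (suc a)) (λ b → signed-row v w (part ws 0) b *ℤ ∑ (belowVec s) (signed vs ws))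
    ≡⟨ ∑-*ʳ (∑ (belowVec s) (signed vs ws)) (upTo (suc a)) (signed-row v w (part ws 0)) ⟩
  ∑ (upTo (suc a)) (signed-row v w (part ws 0)) *ℤ ∑ (belowVec s) (signed vs ws)
    ≡⟨ cong (∑ (upTo (suc a)) (signed-row v w (part ws 0)) *ℤ_) (∑-signed ps qs (desc-tail d)) ⟩
  ∑ (upTo (suc a)) (signed-row v w (part ws 0)) *ℤ (ind (vs ≟ₗ ws) *ℤ sgn (sum vs))
    ≡⟨ rest (vs ≟ₗ ws) ⟩
  ind ((v ∷ vs) ≟ₗ (w ∷ ws)) *ℤ sgn (v + sum vs) ∎
  where
  open ≡-Reasoning
  l : ∀ a b c → (a *ℤ b) *ℤ (1ℤ *ℤ c) ≡ a *ℤ (b *ℤ c)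
  l = ℤR.solve-∀
  -- The bound `part ws 0 ≤ v` that the row sum needs comes from `Desc` only for `ws = vs`; in the
  -- other case the factor of the lower rows is already zero.
  rest : (e : Dec (vs ≡ ws)) → ∑ (upTo (suc a)) (signed-row v w (part ws 0)) *ℤ (ind e *ℤ sgn (sum vs)) ≡
    ind ((v ∷ vs) ≟ₗ (w ∷ ws)) *ℤ sgn (v + sum vs)
  rest (yes refl) = trans (cong (_*ℤ (1ℤ *ℤ sgn (sum vs))) (∑-signed-row v w (part vs 0) a p q (part-head d)))
    (trans (l (ind (v ≟ w)) (sgn v) (sgn (sum vs))) (cong₂ _*ℤ_
      (ind-⇔ (v ≟ w) ((v ∷ vs) ≟ₗ (w ∷ ws)) (cong (_∷ vs)) List.∷-injectiveˡ) (sym (sgn-+ v (sum vs)))))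
  rest (no ¬e) = trans (ℤ.*-zeroʳ (∑ (upTo (suc a)) (signed-row v w (part ws 0)))) (sym
    (trans (cong (_*ℤ sgn (v + sum vs)) (ind-no ((v ∷ vs) ≟ₗ (w ∷ ws)) (¬e ∘ List.∷-injectiveʳ)))
      (ℤ.*-zeroˡ (sgn (v + sum vs)))))

hstrip-desc : ∀ {u w} → HStrip u w → Desc u
hstrip-desc [] = []
hstrip-desc (_ ∷ []) = [-]
hstrip-desc ((_ , h) ∷ (p , h′) ∷ s) = ≤-trans p h ∷ hstrip-desc ((p , h′) ∷ s)

-- Interlacing makes the inner shape of a horizontal strip weakly decreasing, so passing from all
-- vectors to partitions drops only zero terms.
∑-signed-parts : ∀ {s v w} → Pointwise _≤_ v s → Pointwise _≤_ w s → Desc v →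
  ∑ (partsBelow s) (signed v w) ≡ ind (v ≟ₗ w) *ℤ sgn (sum v)
∑-signed-parts {s} {v} {w} p q d = trans (∑-filter desc? (belowVec s) (signed v w))
  (trans (∑-cong (belowVec s) (λ {u} _ → drop u (desc? u))) (∑-signed p q d))
  where
  drop : ∀ u (e : Dec (Desc u)) → ind e *ℤ signed v w u ≡ signed v w u
  drop u (yes _) = ℤ.*-identityˡ _
  drop u (no ¬d) = trans (ℤ.*-zeroˡ (signed v w u)) (sym (trans
    (cong (λ z → sgn (sum u) *ℤ (ind (vstrip? v u) *ℤ z)) (ind-no (hstrip? u w) (¬d ∘ hstrip-desc)))
    (trans (cong (sgn (sum u) *ℤ_) (ℤ.*-zeroʳ (ind (vstrip? v u)))) (ℤ.*-zeroʳ (sgn (sum u))))))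

signed₂ : Shape → Shape → Shape → ℤ
signed₂ v w u = sgn (size u) *ℤ (ind (vstrip₂? v u) *ℤ ind (hstrip₂? u w))

∑-signed₂ : ∀ top {v w} → Inside.Inside top v → Inside.Inside top w →
  ∑ (Inside.U top) (signed₂ v w) ≡ ind (v ≟ₛ w) *ℤ sgn (size v)
∑-signed₂ top {v , v′} {w , w′} ((p , p′) , (d , d′)) ((q , q′) , _) = begin
  ∑ (Inside.U top) (signed₂ (v , v′) (w , w′))
    ≡⟨ ∑-cartesian (partsBelow (proj₁ top)) (partsBelow (proj₂ top)) _ ⟩
  ∑ (partsBelow (proj₁ top)) (λ u → ∑ (partsBelow (proj₂ top)) (λ u′ → signed₂ (v , v′) (w , w′) (u , u′)))
    ≡⟨ ∑-cong (partsBelow (proj₁ top)) (λ {u} _ → trans (∑-cong (partsBelow (proj₂ top)) (λ {u′} _ → split u u′))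
         (∑-*ˡ (signed v w u) (partsBelow (proj₂ top)) (signed v′ w′))) ⟩
  ∑ (partsBelow (proj₁ top)) (λ u → signed v w u *ℤ ∑ (partsBelow (proj₂ top)) (signed v′ w′))
    ≡⟨ ∑-*ʳ _ (partsBelow (proj₁ top)) (signed v w) ⟩
  ∑ (partsBelow (proj₁ top)) (signed v w) *ℤ ∑ (partsBelow (proj₂ top)) (signed v′ w′)
    ≡⟨ cong₂ _*ℤ_ (∑-signed-parts p q d) (∑-signed-parts p′ q′ d′) ⟩
  (ind (v ≟ₗ w) *ℤ sgn (sum v)) *ℤ (ind (v′ ≟ₗ w′) *ℤ sgn (sum v′))
    ≡⟨ *ℤ-interchange (ind (v ≟ₗ w)) (sgn (sum v)) (ind (v′ ≟ₗ w′)) (sgn (sum v′)) ⟩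
  (ind (v ≟ₗ w) *ℤ ind (v′ ≟ₗ w′)) *ℤ (sgn (sum v) *ℤ sgn (sum v′))
    ≡⟨ cong₂ _*ℤ_ (trans (sym (ind-× (v ≟ₗ w) (v′ ≟ₗ w′))) (ind-⇔ ((v ≟ₗ w) ×-dec (v′ ≟ₗ w′)) ((v , v′) ≟ₛ (w , w′))
         (λ { (refl , refl) → refl }) (λ { refl → refl , refl }))) (sym (sgn-+ (sum v) (sum v′))) ⟩
  ind ((v , v′) ≟ₛ (w , w′)) *ℤ sgn (sum v + sum v′) ∎
  where
  open ≡-Reasoning
  m : ∀ a b c d e f → (a *ℤ b) *ℤ ((c *ℤ d) *ℤ (e *ℤ f)) ≡ (a *ℤ (c *ℤ e)) *ℤ (b *ℤ (d *ℤ f))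
  m = ℤR.solve-∀
  split : ∀ u u′ → signed₂ (v , v′) (w , w′) (u , u′) ≡ signed v w u *ℤ signed v′ w′ u′
  split u u′ = trans (cong₂ _*ℤ_ (sgn-+ (sum u) (sum u′))
    (cong₂ _*ℤ_ (ind-× (vstrip? v u) (vstrip? v′ u′)) (ind-× (hstrip? u w) (hstrip? u′ w′))))
    (m (sgn (sum u)) (sgn (sum u′)) (ind (vstrip? v u)) (ind (vstrip? v′ u′)) (ind (hstrip? u w))
      (ind (hstrip? u′ w′)))

-- These chains grow from an inner shape up to `top`, whereas those of `VChains` shrink from an
-- outer shape; thus both can start at a common middle shape.
module HChains (top : Shape) where

  open Inside top public

  HRel : ℕ → ℕ → Shape → Shape → Set
  HRel _ n u w = HStrip₂ u w × size w ≡ n + size u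

  hrel? : ∀ e n u → Decidable (HRel e n u)
  hrel? e n u w = hstrip₂? u w ×-dec (_ ≟ _)

  open Chains _≟ₛ_ U U-unique HRel hrel? public hiding ([]; _∷_)

pointwise-≤-sum : ∀ {as bs} → Pointwise _≤_ as bs → sum as ≤ sum bs
pointwise-≤-sum [] = z≤n
pointwise-≤-sum (p ∷ ps) = +-mono-≤ p (pointwise-≤-sum ps)

pointwise-≤-sum-≡ : ∀ {as bs} → Pointwise _≤_ as bs → sum bs ≤ sum as → as ≡ bs
pointwise-≤-sum-≡ [] _ = refl
pointwise-≤-sum-≡ {a ∷ as} {b ∷ bs} (p ∷ ps) h with a ≟ b
... | yes refl = cong (a ∷_) (pointwise-≤-sum-≡ ps (+-cancelˡ-≤ a (sum bs) (sum as) h))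
... | no a≢b = ⊥-elim (<⇒≱ (+-mono-<-≤ (≤∧≢⇒< p a≢b) (pointwise-≤-sum ps)) h)

pointwise-≤-size-≡ : ∀ {A B} → Pointwise _≤_ (proj₁ A) (proj₁ B) → Pointwise _≤_ (proj₂ A) (proj₂ B) → size A ≡ size B
  → A ≡ B
pointwise-≤-size-≡ {A} {B} p q e = cong₂ _,_
  (pointwise-≤-sum-≡ p (+-cancelʳ-≤ (sum (proj₂ A)) _ _
    (≤-trans (+-monoʳ-≤ (sum (proj₁ B)) (pointwise-≤-sum q)) (≤-reflexive (sym e)))))
  (pointwise-≤-sum-≡ q (+-cancelˡ-≤ (sum (proj₁ A)) _ _
    (≤-trans (+-monoˡ-≤ (sum (proj₂ B)) (pointwise-≤-sum p)) (≤-reflexive (sym e)))))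

hstrip-pointwise : ∀ {u w} → HStrip u w → Pointwise _≤_ u w
hstrip-pointwise [] = []
hstrip-pointwise ((p , _) ∷ ps) = p ∷ hstrip-pointwise ps

hstrip-refl : ∀ {u} → Desc u → HStrip u u
hstrip-refl {[]} _ = []
hstrip-refl {x ∷ u} d = (≤-refl , part-head d) ∷ hstrip-refl (desc-tail d)

vstrip-refl : ∀ {u} → VStrip u u
vstrip-refl = PW.refl (≤-refl , n≤1+n _)

hstrip₂-size : ∀ {A B} → HStrip₂ A B → size A ≤ size B
hstrip₂-size (p , p′) = +-mono-≤ (pointwise-≤-sum (hstrip-pointwise p)) (pointwise-≤-sum (hstrip-pointwise p′))

-- Tableaux of shape top/z with vertical-strip letters β, followed by horizontal-strip letters α.
module Mixed (top z : Shape) (top-desc : Desc₂ top) (z∈U : z ∈ Inside.U top) where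
  open Inside top
  private
    module V = VChains top (λ _ → 0)
    module H = HChains top

  top∈U : top ∈ U
  top∈U = inside⇒∈U ((PW.refl ≤-refl , PW.refl ≤-refl) , top-desc)

  v h : Shape → List ℕ → ℤ
  v u β = pos (V.#chains u β z)
  h u α = pos (H.#chains u α top)

  mixed : List ℕ → List ℕ → ℤ
  mixed α β = ∑ U (λ u → v u β *ℤ h u α)

  v-0 : ∀ u β → u ∈ U → v u (0 ∷ β) ≡ v u β
  v-0 u β u∈ = trans (V.#chains-∷ u 0 β z) (trans (∑-single U-unique u∈ _ other)
    (trans (cong (_*ℤ v u β) (ind-yes (V.rel? (length β) 0 u u) ((vstrip-refl , vstrip-refl) , +-identityʳ (size u))))
      (ℤ.*-identityˡ _)))
    where
    other : ∀ {x} → x ∈ U → x ≢ u → ind (V.rel? (length β) 0 u x) *ℤ v x β ≡ 0ℤ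
    other {x} _ x≢u = trans (cong (_*ℤ v x β) (ind-no (V.rel? (length β) 0 u x)
      (λ { ((s , s′) , e) → x≢u (pointwise-≤-size-≡ (PW.map proj₁ s) (PW.map proj₁ s′)
        (sym (trans (sym (+-identityʳ (size u))) e))) }))) (ℤ.*-zeroˡ (v x β))

  h-0 : ∀ u α → u ∈ U → h u (0 ∷ α) ≡ h u α
  h-0 u α u∈ = trans (H.#chains-∷ u 0 α top) (trans (∑-single U-unique u∈ _ other)
    (trans (cong (_*ℤ h u α) (ind-yes (H.hrel? (length α) 0 u u)
      ((hstrip-refl (proj₁ d) , hstrip-refl (proj₂ d)) , refl))) (ℤ.*-identityˡ _)))
    where
    d = proj₂ (∈U⇒inside u∈)
    other : ∀ {x} → x ∈ U → x ≢ u → ind (H.hrel? (length α) 0 u x) *ℤ h x α ≡ 0ℤ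
    other {x} _ x≢u = trans (cong (_*ℤ h x α) (ind-no (H.hrel? (length α) 0 u x)
      (λ { ((s , s′) , e) → x≢u (sym (pointwise-≤-size-≡ (hstrip-pointwise s) (hstrip-pointwise s′) (sym e))) })))
        (ℤ.*-zeroˡ (h x α))

  mixed-0ᵛ : ∀ α β → mixed α (0 ∷ β) ≡ mixed α β
  mixed-0ᵛ α β = ∑-cong U (λ {u} u∈ → cong (_*ℤ h u α) (v-0 u β u∈))

  mixed-0ʰ : ∀ α β → mixed (0 ∷ α) β ≡ mixed α β
  mixed-0ʰ α β = ∑-cong U (λ {u} u∈ → cong (v u β *ℤ_) (h-0 u α u∈))

  mixed-[]ʰ : ∀ β → mixed [] β ≡ v top β
  mixed-[]ʰ β = trans (∑-single U-unique top∈U _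
      (λ {u} _ u≢ → trans (cong (v u β *ℤ_) (trans (H.#chains-[] u top) (ind-no (u ≟ₛ top) u≢))) (ℤ.*-zeroʳ (v u β))))
    (trans (cong (v top β *ℤ_) (trans (H.#chains-[] top top) (ind-yes (top ≟ₛ top) refl))) (ℤ.*-identityʳ (v top β)))

  mixed-[]ᵛ : ∀ α → mixed α [] ≡ h z α
  mixed-[]ᵛ α = trans (∑-single U-unique z∈U _
      (λ {u} _ u≢ → trans (cong (_*ℤ h u α) (trans (V.#chains-[] u z) (ind-no (u ≟ₛ z) u≢))) (ℤ.*-zeroˡ (h u α))))
    (trans (cong (_*ℤ h z α) (trans (V.#chains-[] z z) (ind-yes (z ≟ₛ z) refl))) (ℤ.*-identityˡ (h z α)))

  -- Only `j = |u| − |x|` contributes, and there (-1)^j is the product of the signs of `x` and `u`.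
  -- So the sign of the term depends on the middle shape as `signed₂` demands, up to a factor that
  -- is constant in `u`.
  weight-sum : ∀ n x u y → size x ≤ size u → size u ≤ size y →
    ∑ (upTo (suc n)) (λ j → sgn j *ℤ (ind (size u + 0 ≟ j + size x) *ℤ ind (size y ≟ (n ∸ j) + size u))) ≡
    sgn (size x) *ℤ (sgn (size u) *ℤ ind (size y ≟ n + size x))
  weight-sum n x u y x≤u u≤y with size y ≟ n + size x
  ... | yes e = trans (∑-single (Unique.upTo⁺ (suc n)) (∈-upTo⁺ (s≤s d≤n)) _ off)
      (trans (cong (sgn d *ℤ_) (cong₂ _*ℤ_ (ind-yes (size u + 0 ≟ d + size x) (trans (+-identityʳ _) ud))
        (ind-yes (size y ≟ (n ∸ d) + size u) (trans e
          (trans (cong (_+ size x) (sym (m∸n+n≡m d≤n)))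
            (trans (+-assoc (n ∸ d) d (size x)) (cong (n ∸ d +_) (sym ud))))))))
      (trans (cong (_*ℤ 1ℤ) (trans (sym (trans (cong (_*ℤ sgn d) (sgn-square (size x))) (ℤ.*-identityˡ (sgn d))))
        (l (sgn (size x)) (sgn d))))
      (trans (ℤ.*-identityʳ _) (cong (sgn (size x) *ℤ_)
        (trans (sym (sgn-+ d (size x))) (trans (cong sgn (sym ud)) (sym (ℤ.*-identityʳ _))))))))
    where
    d = size u ∸ size x
    ud : size u ≡ d + size x
    ud = sym (m∸n+n≡m x≤u)
    d≤n : d ≤ n
    d≤n = +-cancelʳ-≤ (size x) d n (≤-trans (≤-reflexive (sym ud)) (≤-trans u≤y (≤-reflexive e)))
    l : ∀ a b → (a *ℤ a) *ℤ b ≡ a *ℤ (b *ℤ a)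
    l = ℤR.solve-∀
    off : ∀ {j} → j ∈ upTo (suc n) → j ≢ d → sgn j *ℤ
      (ind (size u + 0 ≟ j + size x) *ℤ ind (size y ≟ (n ∸ j) + size u)) ≡ 0ℤ
    off {j} _ j≢ = trans (cong (λ z → sgn j *ℤ (z *ℤ ind (size y ≟ (n ∸ j) + size u)))
      (ind-no (size u + 0 ≟ j + size x)
      (λ e → j≢ (+-cancelʳ-≡ (size x) j d (trans (sym e) (trans (+-identityʳ _) ud))))))
      (trans (cong (sgn j *ℤ_) (ℤ.*-zeroˡ (ind (size y ≟ (n ∸ j) + size u)))) (ℤ.*-zeroʳ (sgn j)))
  ... | no ¬e = trans (∑-zero (upTo (suc n)) off)
    (sym (trans (cong (sgn (size x) *ℤ_) (ℤ.*-zeroʳ (sgn (size u)))) (ℤ.*-zeroʳ (sgn (size x)))))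
    where
    off : ∀ {j} → j ∈ upTo (suc n) → sgn j *ℤ (ind (size u + 0 ≟ j + size x) *ℤ ind (size y ≟ (n ∸ j) + size u)) ≡ 0ℤ
    off {j} j∈ with size u + 0 ≟ j + size x | size y ≟ (n ∸ j) + size u
    ... | yes p | yes q = ⊥-elim (¬e (trans q
      (trans (cong (n ∸ j +_) (trans (sym (+-identityʳ _)) p)) (trans (sym (+-assoc (n ∸ j) j (size x)))
      (cong (_+ size x) (m∸n+n≡m (s≤s⁻¹ (∈-upTo⁻ j∈))))))))
    ... | yes _ | no _ = ℤ.*-zeroʳ (sgn j)
    ... | no _ | yes _ = ℤ.*-zeroʳ (sgn j)
    ... | no _ | no _ = ℤ.*-zeroʳ (sgn j)

  -- Σ_j (−1)^j e_j h_{n−j} = 0 for n > 0.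
  mixed-alternating : ∀ n α β → ∑ (upTo (suc (suc n))) (λ j → sgn j *ℤ mixed ((suc n ∸ j) ∷ α) (j ∷ β)) ≡ 0ℤ
  mixed-alternating n α β = begin
    ∑ J (λ j → sgn j *ℤ mixed ((suc n ∸ j) ∷ α) (j ∷ β))
      ≡⟨ ∑-cong J (λ {j} _ → trans (cong (sgn j *ℤ_)
        (∑-cong U (λ {u} _ → trans (cong₂ _*ℤ_ (V.#chains-∷ u j β z) (H.#chains-∷ u (suc n ∸ j) α top))
          (product u j))))
           (trans (sym (∑-*ˡ (sgn j) U _)) (∑-cong U
             (λ {u} _ → trans (sym (∑-*ˡ (sgn j) U _)) (∑-cong U (λ {x} _ → sym (∑-*ˡ (sgn j) U _))))))) ⟩
    ∑ J (λ j → ∑ U (λ u → ∑ U (λ x → ∑ U (λ y → sgn j *ℤ term j u x y))))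
      ≡⟨ ∑-swap J U _ ⟩
    ∑ U (λ u → ∑ J (λ j → ∑ U (λ x → ∑ U (λ y → sgn j *ℤ term j u x y))))
      ≡⟨ ∑-cong U (λ {u} _ → trans (∑-swap J U _) (∑-cong U (λ {x} _ → ∑-swap J U _))) ⟩
    ∑ U (λ u → ∑ U (λ x → ∑ U (λ y → ∑ J (λ j → sgn j *ℤ term j u x y))))
      ≡⟨ ∑-cong U (λ {u} _ → ∑-cong U (λ {x} _ → ∑-cong U (λ {y} _ → inner u x y))) ⟩
    ∑ U (λ u → ∑ U (λ x → ∑ U (λ y → coeff x y *ℤ signed₂ x y u)))
      ≡⟨ trans (∑-swap U U _) (∑-cong U (λ _ → ∑-swap U U _)) ⟩
    ∑ U (λ x → ∑ U (λ y → ∑ U (λ u → coeff x y *ℤ signed₂ x y u)))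
      ≡⟨ ∑-zero U (λ {x} x∈ → ∑-zero U (λ {y} y∈ → trans (∑-*ˡ (coeff x y) U _)
        (trans (cong (coeff x y *ℤ_) (∑-signed₂ top (∈U⇒inside x∈) (∈U⇒inside y∈))) (vanish x y)))) ⟩
    0ℤ ∎
    where
    open ≡-Reasoning
    J = upTo (suc (suc n))
    term : ℕ → Shape → Shape → Shape → ℤ
    term j u x y = (ind (V.rel? (length β) j u x) *ℤ v x β) *ℤ (ind (H.hrel? (length α) (suc n ∸ j) u y) *ℤ h y α)
    coeff : Shape → Shape → ℤ
    coeff x y = ((v x β *ℤ h y α) *ℤ sgn (size x)) *ℤ ind (size y ≟ suc n + size x)
    product : ∀ u j → ∑ U (λ x → ind (V.rel? (length β) j u x) *ℤ v x β) *ℤ ∑ U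
      (λ y → ind (H.hrel? (length α) (suc n ∸ j) u y) *ℤ h y α) ≡
      ∑ U (λ x → ∑ U (λ y → term j u x y))
    product u j = trans (sym (∑-*ʳ _ U _)) (∑-cong U
      (λ {x} _ → sym (∑-*ˡ (ind (V.rel? (length β) j u x) *ℤ v x β) U _)))
    l₁ : ∀ s a b c d f g → s *ℤ (((a *ℤ b) *ℤ f) *ℤ ((c *ℤ d) *ℤ g)) ≡ ((f *ℤ g) *ℤ (a *ℤ c)) *ℤ (s *ℤ (b *ℤ d))
    l₁ = ℤR.solve-∀
    l₂ : ∀ f g a c x u i → ((f *ℤ g) *ℤ (a *ℤ c)) *ℤ (x *ℤ (u *ℤ i)) ≡ (((f *ℤ g) *ℤ x) *ℤ i) *ℤ (u *ℤ (a *ℤ c))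
    l₂ = ℤR.solve-∀
    inner : ∀ u x y → ∑ J (λ j → sgn j *ℤ term j u x y) ≡ coeff x y *ℤ signed₂ x y u
    inner u x y = trans (∑-cong J (λ {j} _ → trans
        (cong₂ (λ p q → sgn j *ℤ ((p *ℤ v x β) *ℤ (q *ℤ h y α))) (ind-× (vstrip₂? x u) (size u + 0 ≟ j + size x))
          (ind-× (hstrip₂? u y) (size y ≟ (suc n ∸ j) + size u)))
        (l₁ (sgn j) (ind (vstrip₂? x u)) (ind (size u + 0 ≟ j + size x)) (ind (hstrip₂? u y))
          (ind (size y ≟ (suc n ∸ j) + size u)) (v x β) (h y α))))
      (trans (∑-*ˡ ((v x β *ℤ h y α) *ℤ (ind (vstrip₂? x u) *ℤ ind (hstrip₂? u y))) J _)
      (trans (strips (vstrip₂? x u) (hstrip₂? u y))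
      (l₂ (v x β) (h y α) (ind (vstrip₂? x u)) (ind (hstrip₂? u y)) (sgn (size x)) (sgn (size u))
        (ind (size y ≟ suc n + size x)))))
      where
      S = ∑ J (λ j → sgn j *ℤ (ind (size u + 0 ≟ j + size x) *ℤ ind (size y ≟ (suc n ∸ j) + size u)))
      R = sgn (size x) *ℤ (sgn (size u) *ℤ ind (size y ≟ suc n + size x))
      zero-left : ∀ a b c → a *ℤ b ≡ 0ℤ → ((v x β *ℤ h y α) *ℤ (a *ℤ b)) *ℤ c ≡ 0ℤ
      zero-left a b c e = trans (cong (λ z → ((v x β *ℤ h y α) *ℤ z) *ℤ c) e)
        (trans (cong (_*ℤ c) (ℤ.*-zeroʳ (v x β *ℤ h y α))) (ℤ.*-zeroˡ c))
      strips : (d : Dec (VStrip₂ x u)) (e : Dec (HStrip₂ u y)) →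
        ((v x β *ℤ h y α) *ℤ (ind d *ℤ ind e)) *ℤ S ≡ ((v x β *ℤ h y α) *ℤ (ind d *ℤ ind e)) *ℤ R
      strips (yes p) (yes q) = cong (((v x β *ℤ h y α) *ℤ 1ℤ) *ℤ_)
        (weight-sum (suc n) x u y (vstrip₂-size p) (hstrip₂-size q))
      strips (yes p) (no q) = trans (zero-left 1ℤ 0ℤ S refl) (sym (zero-left 1ℤ 0ℤ R refl))
      strips (no p) e = trans (zero-left 0ℤ (ind e) S (ℤ.*-zeroˡ (ind e)))
        (sym (zero-left 0ℤ (ind e) R (ℤ.*-zeroˡ (ind e))))
    -- The sum over the middle shape leaves only `x = y`, which contradicts `|y| = suc n + |x|`.
    vanish : ∀ x y → coeff x y *ℤ (ind (x ≟ₛ y) *ℤ sgn (size x)) ≡ 0ℤ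
    vanish x y with x ≟ₛ y
    ... | no _ = ℤ.*-zeroʳ (coeff x y)
    ... | yes refl = trans (cong (λ i → (((v x β *ℤ h y α) *ℤ sgn (size x)) *ℤ i) *ℤ (1ℤ *ℤ sgn (size x)))
        (ind-no (size x ≟ suc n + size x) (λ e → <⇒≢ (s≤s (m≤n+m (size x) n)) e)))
      (trans (cong (_*ℤ (1ℤ *ℤ sgn (size x))) (ℤ.*-zeroʳ ((v x β *ℤ h y α) *ℤ sgn (size x))))
        (ℤ.*-zeroˡ (1ℤ *ℤ sgn (size x))))

-- The relations Σ_j (−1)^j e_j h_{n−j} = 0 express all values through those without horizontal letters.
mixed-vanishing : (W : List ℕ → List ℕ → ℤ) → (∀ β → W [] β ≡ 0ℤ) →
  (∀ α β → W α (0 ∷ β) ≡ W α β) → (∀ α β → W (0 ∷ α) β ≡ W α β) →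
  (∀ n α β → ∑ (upTo (suc (suc n))) (λ j → sgn j *ℤ W ((suc n ∸ j) ∷ α) (j ∷ β)) ≡ 0ℤ) →
  ∀ α β → W α β ≡ 0ℤ
mixed-vanishing W base zeroᵛ zeroʰ alternating [] β = base β
mixed-vanishing W base zeroᵛ zeroʰ alternating (n ∷ α) β = go n n ≤-refl β
  where
  -- Strong induction on the first horizontal letter: in the alternating relation the term `j = 0`
  -- is the wanted value, and every other term has a smaller horizontal letter, the rest of it being
  -- moved to `β`.
  go : ∀ q n → n ≤ q → ∀ β → W (n ∷ α) β ≡ 0ℤ
  go q zero _ β = trans (zeroʰ α β) (mixed-vanishing W base zeroᵛ zeroʰ alternating α β)
  go (suc q) (suc n) (s≤s n≤q) β = trans (sym (zeroᵛ (suc n ∷ α) β)) (trans (sym (ℤ.*-identityˡ _))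
    (trans (sym (∑-single (Unique.upTo⁺ (suc (suc n))) {0} (∈-upTo⁺ (s≤s z≤n))
      (λ j → sgn j *ℤ W ((suc n ∸ j) ∷ α) (j ∷ β)) other)) (alternating n α β)))
    where
    other : ∀ {j} → j ∈ upTo (suc (suc n)) → j ≢ 0 → sgn j *ℤ W ((suc n ∸ j) ∷ α) (j ∷ β) ≡ 0ℤ
    other {zero} _ j≢ = ⊥-elim (j≢ refl)
    other {suc j} _ _ = trans (cong (sgn (suc j) *ℤ_) (go q (n ∸ j) (≤-trans (m∸n≤m n j) n≤q) (suc j ∷ β)))
      (ℤ.*-zeroʳ (sgn (suc j)))

-- Semistandard tableaux as chains of horizontal strips

⟦_⟧ : {P : Set} → Dec P → ℕ
⟦ yes _ ⟧ = 1
⟦ no _ ⟧ = 0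

⟦⟧-yes : {P : Set} (d : Dec P) → P → ⟦ d ⟧ ≡ 1
⟦⟧-yes (yes _) p = refl
⟦⟧-yes (no ¬p) p = ⊥-elim (¬p p)

⟦⟧-no : {P : Set} (d : Dec P) → ¬ P → ⟦ d ⟧ ≡ 0
⟦⟧-no (yes p) ¬p = ⊥-elim (¬p p)
⟦⟧-no (no _) ¬p = refl

⟦⟧-cong : {P Q : Set} (d : Dec P) (e : Dec Q) → (P → Q) → (Q → P) → ⟦ d ⟧ ≡ ⟦ e ⟧
⟦⟧-cong (yes p) e f g = sym (⟦⟧-yes e (f p))
⟦⟧-cong (no ¬p) e f g = sym (⟦⟧-no e (¬p ∘ g))

⟦⟧≤1 : {P : Set} (d : Dec P) → ⟦ d ⟧ ≤ 1
⟦⟧≤1 (yes _) = ≤-refl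
⟦⟧≤1 (no _) = z≤n

⟦≤-suc⟧ : ∀ x k → ⟦ x ≤? suc k ⟧ ≡ ⟦ x ≟ suc k ⟧ + ⟦ x ≤? k ⟧
⟦≤-suc⟧ x k with x ≟ suc k
... | yes refl = trans (⟦⟧-yes (x ≤? x) ≤-refl) (cong suc (sym (⟦⟧-no (x ≤? k) 1+n≰n)))
... | no ne = ⟦⟧-cong (x ≤? suc k) (x ≤? k) (λ p → s≤s⁻¹ (≤∧≢⇒< p ne)) m≤n⇒m≤1+n

sm : ℕ → (ℕ → ℕ) → ℕ
sm zero g = 0
sm (suc n) g = sm n g + g n

sm-cong : ∀ n {g h} → (∀ i → i < n → g i ≡ h i) → sm n g ≡ sm n h
sm-cong zero e = refl
sm-cong (suc n) e = cong₂ _+_ (sm-cong n (λ i p → e i (m<n⇒m<1+n p))) (e n ≤-refl)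

sm-mono : ∀ n {g h} → (∀ i → i < n → g i ≤ h i) → sm n g ≤ sm n h
sm-mono zero e = z≤n
sm-mono (suc n) e = +-mono-≤ (sm-mono n (λ i p → e i (m<n⇒m<1+n p))) (e n ≤-refl)

sm-zero : ∀ n {g} → (∀ i → i < n → g i ≡ 0) → sm n g ≡ 0
sm-zero zero e = refl
sm-zero (suc n) e = cong₂ _+_ (sm-zero n (λ i p → e i (m<n⇒m<1+n p))) (e n ≤-refl)

sm-+ : ∀ n g h → sm n (λ i → g i + h i) ≡ sm n g + sm n h
sm-+ zero g h = refl
sm-+ (suc n) g h = trans (cong (_+ (g n + h n)) (sm-+ n g h)) (+-interchange (sm n g) (sm n h) (g n) (h n))

sm-swap : ∀ m n (g : ℕ → ℕ → ℕ) → sm m (λ i → sm n (g i)) ≡ sm n (λ j → sm m (λ i → g i j))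
sm-swap zero n g = sym (sm-zero n (λ _ _ → refl))
sm-swap (suc m) n g = trans (cong (_+ sm n (g m)) (sm-swap m n g)) (sym (sm-+ n (λ j → sm m (λ i → g i j)) (g m)))

sm-suc : ∀ n g → sm (suc n) g ≡ g 0 + sm n (g ∘ suc)
sm-suc zero g = sym (+-identityʳ (g 0))
sm-suc (suc n) g = trans (cong (_+ g (suc n)) (sm-suc n g)) (+-assoc (g 0) (sm n (g ∘ suc)) (g (suc n)))

sm-≤ : ∀ n {P : ℕ → Set} (P? : Decidable P) → sm n (λ i → ⟦ P? i ⟧) ≤ n
sm-≤ zero P? = z≤n
sm-≤ (suc n) P? = ≤-trans (+-mono-≤ (sm-≤ n P?) (⟦⟧≤1 (P? n))) (≤-reflexive (+-comm n 1))

sm-all : ∀ n {P : ℕ → Set} (P? : Decidable P) → (∀ i → i < n → P i) → sm n (λ i → ⟦ P? i ⟧) ≡ n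
sm-all zero P? p = refl
sm-all (suc n) P? p = trans (cong₂ _+_ (sm-all n P? (λ i q → p i (m<n⇒m<1+n q))) (⟦⟧-yes (P? n) (p n ≤-refl)))
  (+-comm n 1)

down-closed : ∀ {P : ℕ → Set} n → (∀ {i} → suc i < n → P (suc i) → P i) → ∀ {i j} → i ≤ j → j < n → P j → P i
down-closed n d {i} {zero} z≤n _ p = p
down-closed n d {i} {suc j} i≤ j< p with i ≟ suc j
... | yes refl = p
... | no ne = down-closed n d (s≤s⁻¹ (≤∧≢⇒< i≤ ne)) (<⇒≤ j<) (d j< p)

-- A set closed downwards is an initial segment, so its size decides membership. Row lengths, column
-- heights and entries are all encoded as such counts, and this converts them into inequalities.
initial-segment : ∀ {P : ℕ → Set} (P? : Decidable P) n → (∀ {i} → suc i < n → P (suc i) → P i) →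
  ∀ k → k < n → (P k → k < sm n (λ i → ⟦ P? i ⟧)) × (k < sm n (λ i → ⟦ P? i ⟧) → P k)
initial-segment P? (suc n) d k (s≤s k≤n) with P? n
... | yes p = (λ _ → subst (k <_) (sym full) (s≤s k≤n)) , (λ _ → down-closed (suc n) d k≤n ≤-refl p)
  where
  full : sm n (λ i → ⟦ P? i ⟧) + 1 ≡ suc n
  full = trans (cong (_+ 1) (sm-all n P? (λ i i<n → down-closed (suc n) d (<⇒≤ i<n) ≤-refl p))) (+-comm n 1)
... | no ¬p with k ≟ n
... | yes refl = (λ p → ⊥-elim (¬p p)) , (λ k< → ⊥-elim (<⇒≱ k< (≤-trans (≤-reflexive (+-identityʳ _)) (sm-≤ n P?))))
... | no ne with initial-segment P? n (λ i< → d (m<n⇒m<1+n i<)) k (≤∧≢⇒< k≤n ne)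
... | to , from = (λ p → subst (k <_) (sym (+-identityʳ _)) (to p)) , (λ k< → from (subst (k <_) (+-identityʳ _) k<))

sm-below : ∀ n {x} → x ≤ n → sm n (λ k → ⟦ k <? x ⟧) ≡ x
sm-below zero z≤n = refl
sm-below (suc n) {x} x≤ with x ≟ suc n
... | yes refl = sm-all (suc n) (_<? suc n) (λ i p → p)
... | no ne = trans (cong₂ _+_ (sm-below n (s≤s⁻¹ (≤∧≢⇒< x≤ ne))) (⟦⟧-no (n <? x) (λ p → ne (≤-antisym x≤ p))))
  (+-identityʳ x)

sum-∷ʳ : ∀ xs (x : ℕ) → sum (xs ++ x ∷ []) ≡ sum xs + x
sum-∷ʳ xs x = trans (sum-++ xs (x ∷ [])) (cong (sum xs +_) (+-identityʳ x))

sum-upTo : ∀ n g → sum (map g (upTo n)) ≡ sm n g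
sum-upTo zero g = refl
sum-upTo (suc n) g = trans (cong (sum ∘ map g) (sym (List.upTo-∷ʳ n)))
  (trans (cong sum (List.map-++ g (upTo n) (n ∷ [])))
  (trans (sum-∷ʳ (map g (upTo n)) (g n)) (cong (_+ g n) (sum-upTo n g))))

sum-map-concatMap : {A B : Set} (g : B → ℕ) (h : A → List B) (xs : List A) → sum (map g (concatMap h xs)) ≡ sum
  (map (λ x → sum (map g (h x))) xs)
sum-map-concatMap g h [] = refl
sum-map-concatMap g h (x ∷ xs) = trans (cong sum (List.map-++ g (h x) (concatMap h xs)))
  (trans (sum-++ (map g (h x)) _) (cong (sum (map g (h x)) +_) (sum-map-concatMap g h xs)))

length-filter : {A : Set} {P : A → Set} (P? : Decidable P) (xs : List A) → length (filter P? xs) ≡ sum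
  (map (λ x → ⟦ P? x ⟧) xs)
length-filter P? [] = refl
length-filter P? (x ∷ xs) with P? x
... | yes _ = cong suc (length-filter P? xs)
... | no _ = length-filter P? xs

sum-range : ∀ a b g → sum (map g (range a b)) ≡ sm (b ∸ a) (λ i → g (a + i))
sum-range a b g = trans (cong sum (sym (List.map-∘ (upTo (b ∸ a))))) (sum-upTo (b ∸ a) (λ i → g (a + i)))

sum-cells : ∀ (g : Cell → ℕ) λ' μ → sum (map g (cells λ' μ)) ≡
  sm (length λ') (λ r → sm (part λ' r ∸ part μ r) (λ i → g (r , part μ r + i)))
sum-cells g λ' μ = trans (sum-map-concatMap g (λ r → map (r ,_) (range (part μ r) (part λ' r))) (upTo (length λ')))
  (trans (sum-upTo (length λ') _) (sm-cong (length λ')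
    (λ r _ → trans (cong sum (sym (List.map-∘ (range (part μ r) (part λ' r)))))
    (sum-range (part μ r) (part λ' r) (λ c → g (r , c))))))

∈-range⁻ : ∀ {a b c} → c ∈ range a b → a ≤ c × c < b
∈-range⁻ {a} {b} c∈ with ∈-map⁻ (a +_) c∈
... | i , i∈ , refl = m≤m+n a i , subst (_≤ b) (+-suc a i)
  (≤-trans (+-monoʳ-≤ a i<) (≤-reflexive (m+[n∸m]≡n (<⇒≤ a<b))))
  where
  i< : i < b ∸ a
  i< = ∈-upTo⁻ i∈
  a<b : a < b
  a<b = ≰⇒> (λ b≤a → n≮0 (subst (i <_) (m≤n⇒m∸n≡0 b≤a) i<))

∈-range⁺ : ∀ {a b c} → a ≤ c → c < b → c ∈ range a b
∈-range⁺ {a} {b} {c} a≤c c<b = subst (_∈ range a b) (m+[n∸m]≡n a≤c) (∈-map⁺ (a +_) (∈-upTo⁺ (∸-monoˡ-< c<b a≤c)))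

∈-cells⁻ : ∀ {λ' μ r c} → (r , c) ∈ cells λ' μ → r < length λ' × part μ r ≤ c × c < part λ' r
∈-cells⁻ {λ'} {μ} p with ∈-concatMap-elim (λ r → map (r ,_) (range (part μ r) (part λ' r))) {upTo (length λ')} p
... | r , r∈ , q with ∈-map⁻ (r ,_) q
... | c , c∈ , refl = ∈-upTo⁻ r∈ , ∈-range⁻ c∈

∈-cells⁺ : ∀ {λ' μ r c} → r < length λ' → part μ r ≤ c → c < part λ' r → (r , c) ∈ cells λ' μ
∈-cells⁺ {λ'} {μ} {r} r< p q = ∈-concatMap-intro (λ r → map (r ,_) (range (part μ r) (part λ' r))) (∈-upTo⁺ r<)
  (∈-map⁺ (r ,_) (∈-range⁺ p q))

range-unique : ∀ a b → Unique (range a b)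
range-unique a b = Unique.map⁺ (+-cancelˡ-≡ a _ _) (Unique.upTo⁺ (b ∸ a))

cells-unique : ∀ λ' μ → Unique (cells λ' μ)
cells-unique λ' μ = concatMap-unique (λ r → map (r ,_) (range (part μ r) (part λ' r))) (Unique.upTo⁺ (length λ'))
  (λ {r} _ → Unique.map⁺ ,-injectiveʳ (range-unique (part μ r) (part λ' r)))
  (λ {x} {y} _ _ p q → case (∈-map⁻ (x ,_) p , ∈-map⁻ (y ,_) q) of λ { ((_ , _ , refl) , (_ , _ , e))
    → cong proj₁ e })

∈-listsOver⁻ : ∀ k xs {w} → w ∈ listsOver k xs → length w ≡ k × All (_∈ xs) w
∈-listsOver⁻ zero xs (here refl) = refl , []
∈-listsOver⁻ (suc k) xs w∈ with ∈-concatMap-elim (λ x → map (x ∷_) (listsOver k xs)) {xs} w∈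
... | x , x∈ , p with ∈-map⁻ (x ∷_) p
... | w′ , w′∈ , refl with ∈-listsOver⁻ k xs w′∈
... | e , a = cong suc e , x∈ ∷ a

∈-listsOver⁺ : ∀ {xs w} → All (_∈ xs) w → w ∈ listsOver (length w) xs
∈-listsOver⁺ [] = here refl
∈-listsOver⁺ {xs} {x ∷ w} (p ∷ ps) = ∈-concatMap-intro (λ x → map (x ∷_) (listsOver (length w) xs)) p
  (∈-map⁺ (x ∷_) (∈-listsOver⁺ ps))

listsOver-unique : ∀ k {xs} → Unique xs → Unique (listsOver k xs)
listsOver-unique zero u = [] ∷ []
listsOver-unique (suc k) {xs} u = concatMap-unique (λ x → map (x ∷_) (listsOver k xs)) u
  (λ _ → Unique.map⁺ List.∷-injectiveʳ (listsOver-unique k u))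
  (λ {x} {y} _ _ p q → case (∈-map⁻ (x ∷_) p , ∈-map⁻ (y ∷_) q) of λ { ((_ , _ , refl) , (_ , _ , e))
    → List.∷-injectiveˡ e })

letters : ℕ → List ℕ
letters n = map suc (upTo n)

∈-letters⁻ : ∀ {n x} → x ∈ letters n → 1 ≤ x × x ≤ n
∈-letters⁻ x∈ with ∈-map⁻ suc x∈
... | i , i∈ , refl = s≤s z≤n , ∈-upTo⁻ i∈

∈-letters⁺ : ∀ {n x} → 1 ≤ x → x ≤ n → x ∈ letters n
∈-letters⁺ {x = suc x} _ p = ∈-map⁺ suc (∈-upTo⁺ p)

letters-unique : ∀ n → Unique (letters n)
letters-unique n = Unique.map⁺ suc-injective (Unique.upTo⁺ n)

map-proj₁-zip : {A B : Set} (xs : List A) (ys : List B) → length ys ≡ length xs → map proj₁ (zip xs ys) ≡ xs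
map-proj₁-zip [] [] _ = refl
map-proj₁-zip (x ∷ xs) (y ∷ ys) e = cong (x ∷_) (map-proj₁-zip xs ys (suc-injective e))

map-proj₂-zip : {A B : Set} (xs : List A) (ys : List B) → length ys ≡ length xs → map proj₂ (zip xs ys) ≡ ys
map-proj₂-zip [] [] _ = refl
map-proj₂-zip (x ∷ xs) (y ∷ ys) e = cong (y ∷_) (map-proj₂-zip xs ys (suc-injective e))

zip-projections : {A B : Set} (zs : List (A × B)) → zip (map proj₁ zs) (map proj₂ zs) ≡ zs
zip-projections [] = refl
zip-projections (z ∷ zs) = cong (z ∷_) (zip-projections zs)

∈-fillings⁻ : ∀ λ' μ n {z} → z ∈ fillings λ' μ n → map proj₁ z ≡ cells λ' μ × (∀ {c x} → (c , x) ∈ z → 1 ≤ x × x ≤ n)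
∈-fillings⁻ λ' μ n z∈ with ∈-map⁻ (zip (cells λ' μ)) z∈
... | w , w∈ , refl with ∈-listsOver⁻ (length (cells λ' μ)) (letters n) w∈
... | e , a = map-proj₁-zip (cells λ' μ) w e , λ p → ∈-letters⁻
  (All.lookup a (subst (_ ∈_) (map-proj₂-zip (cells λ' μ) w e) (∈-map⁺ proj₂ p)))

∈-fillings⁺ : ∀ λ' μ n {z} → map proj₁ z ≡ cells λ' μ → (∀ {c x} → (c , x) ∈ z → 1 ≤ x × x ≤ n) → z ∈ fillings λ' μ n
∈-fillings⁺ λ' μ n {z} e b = subst (_∈ fillings λ' μ n)
  (trans (cong (λ cs → zip cs (map proj₂ z)) (sym e)) (zip-projections z))
  (∈-map⁺ (zip (cells λ' μ)) (subst (λ k → map proj₂ z ∈ listsOver k (letters n))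
    (trans (List.length-map proj₂ z) (trans (sym (List.length-map proj₁ z)) (cong length e)))
    (∈-listsOver⁺ (All.tabulate (λ p → case ∈-map⁻ proj₂ p of λ { ((c , x) , q , refl) → ∈-letters⁺ (proj₁ (b q))
      (proj₂ (b q)) })))))

fillings-unique : ∀ λ' μ n → Unique (fillings λ' μ n)
fillings-unique λ' μ n = map-unique (zip (cells λ' μ)) (listsOver-unique (length (cells λ' μ)) (letters-unique n))
  (λ {a} {b} p q e → trans (sym (map-proj₂-zip (cells λ' μ) a
    (proj₁ (∈-listsOver⁻ (length (cells λ' μ)) (letters n) p))))
    (trans (cong (map proj₂) e) (map-proj₂-zip (cells λ' μ) b
      (proj₁ (∈-listsOver⁻ (length (cells λ' μ)) (letters n) q)))))

part-applyUpTo : ∀ n g {i} → i < n → part (applyUpTo g n) i ≡ g i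
part-applyUpTo (suc n) g {zero} _ = refl
part-applyUpTo (suc n) g {suc i} (s≤s p) = part-applyUpTo n (g ∘ suc) p

part-beyond : ∀ xs {i} → length xs ≤ i → part xs i ≡ 0
part-beyond [] _ = refl
part-beyond (x ∷ xs) (s≤s p) = part-beyond xs p

part-ext : ∀ xs ys → length xs ≡ length ys → (∀ i → i < length xs → part xs i ≡ part ys i) → xs ≡ ys
part-ext [] [] _ _ = refl
part-ext (x ∷ xs) (y ∷ ys) l e = cong₂ _∷_ (e 0 (s≤s z≤n))
  (part-ext xs ys (suc-injective l) (λ i p → e (suc i) (s≤s p)))

listEqᵇ⇒≡ : ∀ xs ys → T (listEqᵇ xs ys) → xs ≡ ys
listEqᵇ⇒≡ [] [] _ = refl
listEqᵇ⇒≡ (x ∷ xs) (y ∷ ys) t with Equivalence.to T-∧ t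
... | p , q = cong₂ _∷_ (≡ᵇ⇒≡ x y p) (listEqᵇ⇒≡ xs ys q)

listEqᵇ-refl : ∀ xs → T (listEqᵇ xs xs)
listEqᵇ-refl [] = tt
listEqᵇ-refl (x ∷ xs) = Equivalence.from T-∧ (≡⇒≡ᵇ x x refl , listEqᵇ-refl xs)

T-imp⁻ : ∀ a b c → T (not (a ∧ b) ∨ c) → T a → T b → T c
T-imp⁻ true true c t _ _ = t

T-imp⁺ : ∀ a b c → (T a → T b → T c) → T (not (a ∧ b) ∨ c)
T-imp⁺ true true c f = f tt tt
T-imp⁺ true false c f = tt
T-imp⁺ false b c f = tt

record IsSSYT (λ' μ α : List ℕ) (z : List Filled) : Set where
  field
    keys     : map proj₁ z ≡ cells λ' μ
    bounds   : ∀ {c x} → (c , x) ∈ z → 1 ≤ x × x ≤ length α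
    rows     : ∀ {r c c′ x y} → ((r , c) , x) ∈ z → ((r , c′) , y) ∈ z → c < c′ → x ≤ y
    columns  : ∀ {r r′ c x y} → ((r , c) , x) ∈ z → ((r′ , c) , y) ∈ z → r < r′ → x < y
    contents : ∀ k → k < length α → length (filterᵇ (λ x → x ≡ᵇ suc k) (map proj₂ z)) ≡ part α k

SSYTs-sound : ∀ λ' μ α {z} → z ∈ SSYTs λ' μ α → IsSSYT λ' μ α z
SSYTs-sound λ' μ α {z} z∈ with ∈-filter⁻ _ {xs = fillings λ' μ (length α)} z∈
... | z∈′ , t with ∈-fillings⁻ λ' μ (length α) z∈′ | Equivalence.to T-∧ t
... | e , b | s , q = record
  { keys = e
  ; bounds = b
  ; rows = λ {r} {c} {c′} {x} {y} p p′ c<c′ → ≤ᵇ⇒≤ x y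
    (T-imp⁻ (r ≡ᵇ r) (c <ᵇ c′) (x ≤ᵇ y) (proj₁ (Equivalence.to T-∧ (get p p′))) (≡⇒≡ᵇ r r refl) (<⇒<ᵇ c<c′))
  ; columns = λ {r} {r′} {c} {x} {y} p p′ r<r′ → <ᵇ⇒< x y
    (T-imp⁻ (c ≡ᵇ c) (r <ᵇ r′) (x <ᵇ y) (proj₂ (Equivalence.to T-∧ (get p p′))) (≡⇒≡ᵇ c c refl) (<⇒<ᵇ r<r′))
  ; contents = λ k k< → trans (sym (trans (cong (λ l → part l k) (List.map-upTo (count z) (length α)))
    (part-applyUpTo (length α) (count z) k<)))
      (cong (λ l → part l k) (listEqᵇ⇒≡ (content (length α) (map proj₂ z)) α q))
  }
  where
  get = λ {p} {q} (p∈ : p ∈ z) (q∈ : q ∈ z) → All.lookup (All.all⁺ _ z (All.lookup (All.all⁺ _ z s) p∈)) q∈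
  count : List Filled → ℕ → ℕ
  count z k = length (filterᵇ (λ x → x ≡ᵇ suc k) (map proj₂ z))

SSYTs-complete : ∀ λ' μ α {z} → IsSSYT λ' μ α z → z ∈ SSYTs λ' μ α
SSYTs-complete λ' μ α {z} s = ∈-filter⁺ _ (∈-fillings⁺ λ' μ (length α) S.keys S.bounds) (Equivalence.from T-∧
  (All.all⁻ _ (All.tabulate (λ {p} p∈ → All.all⁻ _ (All.tabulate (λ {q} q∈ → ok p q p∈ q∈)))) ,
   subst (λ l → T (listEqᵇ (content (length α) (map proj₂ z)) l)) contents≡
     (listEqᵇ-refl (content (length α) (map proj₂ z)))))
  where
  module S = IsSSYT s
  count : ℕ → ℕ
  count k = length (filterᵇ (λ x → x ≡ᵇ suc k) (map proj₂ z))
  contents≡ : content (length α) (map proj₂ z) ≡ α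
  contents≡ = part-ext _ α len (λ i i< → trans (cong (λ l → part l i) (List.map-upTo count (length α)))
    (trans (part-applyUpTo (length α) count (subst (i <_) len i<)) (S.contents i (subst (i <_) len i<))))
    where
    len : length (content (length α) (map proj₂ z)) ≡ length α
    len = trans (List.length-map count (upTo (length α))) (List.length-upTo (length α))
  ok : ∀ p q → p ∈ z → q ∈ z → _
  ok ((r , c) , x) ((r′ , c′) , y) p∈ q∈ = Equivalence.from T-∧
    (T-imp⁺ (r ≡ᵇ r′) (c <ᵇ c′) (x ≤ᵇ y) (λ e l → ≤⇒≤ᵇ
      (S.rows p∈ (subst (λ r → ((r , c′) , y) ∈ z) (sym (≡ᵇ⇒≡ r r′ e)) q∈) (<ᵇ⇒< c c′ l))) ,
     T-imp⁺ (c ≡ᵇ c′) (r <ᵇ r′) (x <ᵇ y) (λ e l → <⇒<ᵇ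
       (S.columns p∈ (subst (λ c → ((r′ , c) , y) ∈ z) (sym (≡ᵇ⇒≡ c c′ e)) q∈) (<ᵇ⇒< r r′ l))))

SSYTs-unique : ∀ λ' μ α → Unique (SSYTs λ' μ α)
SSYTs-unique λ' μ α = Unique.filter⁺ _ (fillings-unique λ' μ (length α))

_≟ᶜ_ : DecidableEquality Cell
_≟ᶜ_ = ≡-dec _≟_ _≟_

look : List Filled → Cell → ℕ
look [] c = 0
look ((c′ , x) ∷ z) c with c ≟ᶜ c′
... | yes _ = x
... | no _ = look z c

look-∈ : ∀ {z c x} → Unique (map proj₁ z) → (c , x) ∈ z → look z c ≡ x
look-∈ {(c′ , x) ∷ z} {c} (c′∉ ∷ u) (here refl) with c ≟ᶜ c′
... | yes _ = refl
... | no ne = ⊥-elim (ne refl)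
look-∈ {(c′ , x) ∷ z} {c} (c′∉ ∷ u) (there p) with c ≟ᶜ c′
... | yes refl = ⊥-elim (All.lookup c′∉ (∈-map⁺ proj₁ p) refl)
... | no _ = look-∈ u p

tab : (ℕ → ℕ → ℕ) → List Cell → List Filled
tab f = map (λ { (r , c) → (r , c) , f r c })

keys-tab : ∀ f cs → map proj₁ (tab f cs) ≡ cs
keys-tab f [] = refl
keys-tab f (c ∷ cs) = cong (c ∷_) (keys-tab f cs)

∈-tab⁻ : ∀ {f cs r c x} → ((r , c) , x) ∈ tab f cs → (r , c) ∈ cs × x ≡ f r c
∈-tab⁻ {f} p with ∈-map⁻ (λ { (r , c) → (r , c) , f r c }) p
... | _ , q , refl = q , refl

look-tab : ∀ f {cs r c} → Unique cs → (r , c) ∈ cs → look (tab f cs) (r , c) ≡ f r c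
look-tab f {cs} u p = look-∈ (subst Unique (sym (keys-tab f cs)) u) (∈-map⁺ (λ { (r , c) → (r , c) , f r c }) p)

tab-cong : ∀ {f g} cs → (∀ {r c} → (r , c) ∈ cs → f r c ≡ g r c) → tab f cs ≡ tab g cs
tab-cong [] e = refl
tab-cong (c ∷ cs) e = cong₂ _∷_ (cong (_ ,_) (e (here refl))) (tab-cong cs (e ∘ there))

tab-look : ∀ z → Unique (map proj₁ z) → tab (λ r c → look z (r , c)) (map proj₁ z) ≡ z
tab-look z u = trans (sym (List.map-∘ z)) (List.map-id-local (All.tabulate (λ {p} p∈ → cong (_ ,_) (look-∈ u p∈))))

module Tableaux (λ' μ α : List ℕ) where

  In : ℕ → ℕ → Set
  In r c = r < length λ' × part μ r ≤ c × c < part λ' r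

  -- Only the values on the cells of the shape are constrained; accordingly, tableaux are compared
  -- on these cells alone.
  record Tableau (f : ℕ → ℕ → ℕ) : Set where
    field
      bounds   : ∀ {r c} → In r c → 1 ≤ f r c × f r c ≤ length α
      rows     : ∀ {r c c′} → In r c → In r c′ → c < c′ → f r c ≤ f r c′
      columns  : ∀ {r r′ c} → In r c → In r′ c → r < r′ → f r c < f r′ c
      contents : ∀ k → k < length α →
        sm (length λ') (λ r → sm (part λ' r ∸ part μ r) (λ i → ⟦ f r (part μ r + i) ≟ suc k ⟧)) ≡ part α k

  content-tab : ∀ f k → length (filterᵇ (λ x → x ≡ᵇ suc k) (map proj₂ (tab f (cells λ' μ)))) ≡
    sm (length λ') (λ r → sm (part λ' r ∸ part μ r) (λ i → ⟦ f r (part μ r + i) ≟ suc k ⟧))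
  content-tab f k = trans (length-filter _ (map proj₂ (tab f (cells λ' μ))))
    (trans (cong sum (trans (sym (List.map-∘ (tab f (cells λ' μ)))) (trans (sym (List.map-∘ (cells λ' μ)))
      (List.map-cong (λ { (r , c) → ⟦⟧-cong (T? (f r c ≡ᵇ suc k)) (f r c ≟ suc k) (≡ᵇ⇒≡ _ _) (≡⇒≡ᵇ _ _) })
        (cells λ' μ)))))
    (sum-cells (λ { (r , c) → ⟦ f r c ≟ suc k ⟧ }) λ' μ))

  tableau⇒SSYT : ∀ {f} → Tableau f → IsSSYT λ' μ α (tab f (cells λ' μ))
  tableau⇒SSYT {f} t = record
    { keys = keys-tab f (cells λ' μ)
    ; bounds = λ p → case ∈-tab⁻ {f} p of λ { (q , refl) → Tableau.bounds t (∈-cells⁻ {λ'} {μ} q) }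
    ; rows = λ p p′ → case (∈-tab⁻ {f} p , ∈-tab⁻ {f} p′) of λ { ((q , refl) , (q′ , refl)) → Tableau.rows t
      (∈-cells⁻ {λ'} {μ} q) (∈-cells⁻ {λ'} {μ} q′) }
    ; columns = λ p p′ → case (∈-tab⁻ {f} p , ∈-tab⁻ {f} p′) of λ { ((q , refl) , (q′ , refl)) → Tableau.columns t
      (∈-cells⁻ {λ'} {μ} q) (∈-cells⁻ {λ'} {μ} q′) }
    ; contents = λ k k< → trans (content-tab f k) (Tableau.contents t k k<)
    }

  module _ {z : List Filled} (s : IsSSYT λ' μ α z) where

    SSYT-keys-unique : Unique (map proj₁ z)
    SSYT-keys-unique = subst Unique (sym (IsSSYT.keys s)) (cells-unique λ' μ)

    SSYT-∈ : ∀ {r c} → In r c → ((r , c) , look z (r , c)) ∈ z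
    SSYT-∈ {r} {c} (p , q , q′) with ∈-map⁻ proj₁
      (subst ((r , c) ∈_) (sym (IsSSYT.keys s)) (∈-cells⁺ {λ'} {μ} p q q′))
    ... | (_ , x) , m , refl = subst (λ y → ((r , c) , y) ∈ z) (sym (look-∈ SSYT-keys-unique m)) m

    SSYT-tab : tab (λ r c → look z (r , c)) (cells λ' μ) ≡ z
    SSYT-tab = trans (cong (tab _) (sym (IsSSYT.keys s))) (tab-look z SSYT-keys-unique)

    SSYT⇒tableau : Tableau (λ r c → look z (r , c))
    SSYT⇒tableau = record
      { bounds = λ p → IsSSYT.bounds s (SSYT-∈ p)
      ; rows = λ p q → IsSSYT.rows s (SSYT-∈ p) (SSYT-∈ q)
      ; columns = λ p q → IsSSYT.columns s (SSYT-∈ p) (SSYT-∈ q)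
      ; contents = λ k k< → trans (sym (content-tab _ k))
        (trans (cong (λ z → length (filterᵇ (λ x → x ≡ᵇ suc k) (map proj₂ z))) SSYT-tab) (IsSSYT.contents s k k<))
      }

isPartition⇒≤ : ∀ λ' → IsPartition λ' → ∀ {r r′} → r ≤ r′ → part λ' r′ ≤ part λ' r
isPartition⇒≤ λ' p {r} {zero} z≤n = ≤-refl
isPartition⇒≤ λ' p {r} {suc r′} r≤ with r ≟ suc r′
... | yes refl = ≤-refl
... | no ne = ≤-trans (p r′) (isPartition⇒≤ λ' p (s≤s⁻¹ (≤∧≢⇒< r≤ ne)))

isPartition⇒desc : ∀ {λ'} → IsPartition λ' → Desc λ'
isPartition⇒desc {[]} p = []
isPartition⇒desc {x ∷ []} p = [-]
isPartition⇒desc {x ∷ y ∷ λ'} p = p 0 ∷ isPartition⇒desc (p ∘ suc)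

desc⇒isPartition : ∀ {λ'} → Desc λ' → IsPartition λ'
desc⇒isPartition {[]} d i = z≤n
desc⇒isPartition {x ∷ []} d i = z≤n
desc⇒isPartition {x ∷ y ∷ λ'} (p ∷ d) zero = p
desc⇒isPartition {x ∷ y ∷ λ'} (p ∷ d) (suc i) = desc⇒isPartition d i

sum-applyUpTo : ∀ n g → sum (applyUpTo g n) ≡ sm n g
sum-applyUpTo n g = trans (cong sum (sym (List.map-upTo g n))) (sum-upTo n g)

applyUpTo-part : ∀ xs → applyUpTo (part xs) (length xs) ≡ xs
applyUpTo-part [] = refl
applyUpTo-part (x ∷ xs) = cong (x ∷_) (applyUpTo-part xs)

applyUpTo-desc : ∀ n {g} → (∀ i → suc i < n → g (suc i) ≤ g i) → Desc (applyUpTo g n)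
applyUpTo-desc zero h = []
applyUpTo-desc (suc zero) h = [-]
applyUpTo-desc (suc (suc n)) h = h 0 (s≤s (s≤s z≤n)) ∷ applyUpTo-desc (suc n) (λ i p → h (suc i) (s≤s p))

applyUpTo-pointwise : ∀ {R : ℕ → ℕ → Set} n {g h} → (∀ i → i < n → R (g i) (h i)) → Pointwise R (applyUpTo g n)
  (applyUpTo h n)
applyUpTo-pointwise zero r = []
applyUpTo-pointwise (suc n) r = r 0 (s≤s z≤n) ∷ applyUpTo-pointwise n (λ i p → r (suc i) (s≤s p))

applyUpTo-hstrip : ∀ n {g h} → (∀ i → i < n → g i ≤ h i) → (∀ i → suc i < n → h (suc i) ≤ g i) → HStrip
  (applyUpTo g n) (applyUpTo h n)
applyUpTo-hstrip zero p q = []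
applyUpTo-hstrip (suc zero) p q = (p 0 (s≤s z≤n) , z≤n) ∷ []
applyUpTo-hstrip (suc (suc n)) p q = (p 0 (s≤s z≤n) , q 0 (s≤s (s≤s z≤n))) ∷
  applyUpTo-hstrip (suc n) (λ i l → p (suc i) (s≤s l)) (λ i l → q (suc i) (s≤s l))

pointwise-part : ∀ {R : ℕ → ℕ → Set} {xs ys} → R 0 0 → Pointwise R xs ys → ∀ i → R (part xs i) (part ys i)
pointwise-part z [] i = z
pointwise-part z (r ∷ rs) zero = r
pointwise-part z (r ∷ rs) (suc i) = pointwise-part z rs i

hstrip-part : ∀ {v w} → HStrip v w → ∀ i → part w (suc i) ≤ part v i
hstrip-part [] i = z≤n
hstrip-part ((_ , h) ∷ s) zero = h
hstrip-part (_ ∷ s) (suc i) = hstrip-part s i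

-- All shapes of a chain have equally many rows, so an inner partition is padded with zeros to the
-- length of the outer one.
fit : ℕ → List ℕ → List ℕ
fit n μ = applyUpTo (part μ) n

module HChains₁ (top : List ℕ) where

  HRel : ℕ → ℕ → List ℕ → List ℕ → Set
  HRel _ n u w = HStrip u w × sum w ≡ n + sum u

  hrel? : ∀ e n u → Decidable (HRel e n u)
  hrel? e n u w = hstrip? u w ×-dec (_ ≟ _)

  open Chains _≟ₗ_ (partsBelow top) (partsBelow-unique top) HRel hrel? public hiding ([]; _∷_)

sum-part : ∀ xs {n} → length xs ≡ n → sum xs ≡ sm n (part xs)
sum-part xs refl = trans (cong sum (sym (applyUpTo-part xs))) (sum-applyUpTo (length xs) (part xs))

module _ (λ' μ α : List ℕ) (λ-part : IsPartition λ') (μ-part : IsPartition μ) (μ⊆λ : μ ⊆ₚ λ') where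
  open Tableaux λ' μ α
  private
    module H = HChains₁ λ'
    ℓ = length λ'
    n = length α
    width : ℕ → ℕ
    width r = part λ' r ∸ part μ r

  -- Row r of the subtableau of entries ≤ k.
  below : (ℕ → ℕ → ℕ) → ℕ → ℕ → ℕ
  below f k r = part μ r + sm (width r) (λ i → ⟦ f r (part μ r + i) ≤? k ⟧)

  belowShape : (ℕ → ℕ → ℕ) → ℕ → List ℕ
  belowShape f k = applyUpTo (below f k) ℓ

  tableau→chain : (ℕ → ℕ → ℕ) → List (List ℕ)
  tableau→chain f = applyUpTo (belowShape f ∘ suc) n

  below-≥ : ∀ f k r → part μ r ≤ below f k r
  below-≥ f k r = m≤m+n (part μ r) _

  below-≤ : ∀ f k r → below f k r ≤ part λ' r
  below-≤ f k r = ≤-trans (+-monoʳ-≤ (part μ r) (sm-≤ (width r) (λ i → f r (part μ r + i) ≤? k)))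
    (≤-reflexive (m+[n∸m]≡n (μ⊆λ r)))

  In-shift : ∀ {r i} → r < ℓ → i < width r → In r (part μ r + i)
  In-shift {r} {i} r< i< = r< , m≤m+n (part μ r) i , ≤-trans (+-monoʳ-< (part μ r) i<)
    (≤-reflexive (m+[n∸m]≡n (μ⊆λ r)))

  below-suc : ∀ f k r → below f (suc k) r ≡ sm (width r) (λ i → ⟦ f r (part μ r + i) ≟ suc k ⟧) + below f k r
  below-suc f k r = trans (cong (part μ r +_) (trans (sm-cong (width r) (λ i _ → ⟦≤-suc⟧ (f r (part μ r + i)) k))
      (sm-+ (width r) (λ i → ⟦ f r (part μ r + i) ≟ suc k ⟧) (λ i → ⟦ f r (part μ r + i) ≤? k ⟧))))
    (x∙yz≈y∙xz (part μ r) (sm (width r) (λ i → ⟦ f r (part μ r + i) ≟ suc k ⟧))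
      (sm (width r) (λ i → ⟦ f r (part μ r + i) ≤? k ⟧)))

  module FromTableau {f : ℕ → ℕ → ℕ} (t : Tableau f) where
    open Tableau t

    below-iff : ∀ {r c} k → In r c → (f r c ≤ k → c < below f k r) × (c < below f k r → f r c ≤ k)
    below-iff {r} {c} k (r< , μ≤c , c<λ) = (λ p → subst (_< below f k r) eq
      (+-monoʳ-< (part μ r) (proj₁ seg (subst (λ c → f r c ≤ k) (sym eq) p)))) ,
      (λ p → subst (λ c → f r c ≤ k) eq (proj₂ seg (+-cancelˡ-< (part μ r) i _ (subst (_< below f k r) (sym eq) p))))
      where
      i = c ∸ part μ r
      eq : part μ r + i ≡ c
      eq = m+[n∸m]≡n μ≤c
      i< : i < width r
      i< = ∸-monoˡ-< c<λ μ≤c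
      seg = initial-segment (λ i → f r (part μ r + i) ≤? k) (width r)
        (λ {i} i< p → ≤-trans (rows (In-shift r< (<⇒≤ i<)) (In-shift r< i<) (+-monoʳ-< (part μ r) (n<1+n i))) p) i i<

    -- Otherwise the cell of row `r + 1` in column `below f k r` would have an entry at most
    -- `k + 1`, so the cell above it an entry at most `k`; but then that column is already counted
    -- in `below f k r`.
    below-interlace : ∀ k r → suc r < ℓ → below f (suc k) (suc r) ≤ below f k r
    below-interlace k r r< = ≮⇒≥ λ lt →
      let c = below f k r
          c< : c < part λ' (suc r)
          c< = ≤-trans lt (below-≤ f (suc k) (suc r))
          inₛ : In (suc r) c
          inₛ = r< , ≤-trans (μ-part r) (below-≥ f k r) , c<
          in₀ : In r c
          in₀ = <⇒≤ r< , below-≥ f k r , ≤-trans c< (λ-part r)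
      in <-irrefl refl (proj₁ (below-iff k in₀)
        (s≤s⁻¹ (≤-trans (columns in₀ inₛ (n<1+n r)) (proj₂ (below-iff (suc k) inₛ) lt))))

    below-mono : ∀ k r → below f k r ≤ below f (suc k) r
    below-mono k r = +-monoʳ-≤ (part μ r) (sm-mono (width r)
      (λ i _ → mono (f r (part μ r + i) ≤? k) (f r (part μ r + i) ≤? suc k)))
      where
      mono : ∀ {x} (d : Dec (x ≤ k)) (e : Dec (x ≤ suc k)) → ⟦ d ⟧ ≤ ⟦ e ⟧
      mono (no _) e = z≤n
      mono (yes p) e = ≤-reflexive (sym (⟦⟧-yes e (m≤n⇒m≤1+n p)))

    belowShape-∈ : ∀ k → belowShape f k ∈ partsBelow λ'
    belowShape-∈ k = ∈-partsBelow⁺ (subst (Pointwise _≤_ (belowShape f k)) (applyUpTo-part λ')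
      (applyUpTo-pointwise ℓ (λ r _ → below-≤ f k r)))
      (applyUpTo-desc ℓ (λ r r< → ≤-trans (below-mono k (suc r)) (below-interlace k r r<)))

    belowShape-0 : belowShape f 0 ≡ fit ℓ μ
    belowShape-0 = applyUpTo-cong ℓ (λ r r< → trans (cong (part μ r +_) (sm-zero (width r) (λ i i< →
      ⟦⟧-no (f r (part μ r + i) ≤? 0) (λ p → 1+n≰n (≤-trans (proj₁ (bounds (In-shift r< i<))) p))))) (+-identityʳ _))

    belowShape-n : belowShape f n ≡ λ'
    belowShape-n = trans (applyUpTo-cong ℓ (λ r r< → trans
      (cong (part μ r +_) (sm-all (width r) (λ i → f r (part μ r + i) ≤? n)
      (λ i i< → proj₂ (bounds (In-shift r< i<))))) (m+[n∸m]≡n (μ⊆λ r)))) (applyUpTo-part λ')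

    tableau-chain : H.IsChain (fit ℓ μ) α (tableau→chain f) λ'
    tableau-chain = subst₂ (λ u t → H.IsChain u α (tableau→chain f) t) belowShape-0 belowShape-n
      (H.steps-chain (belowShape f) α (λ k k< → belowShape-∈ (suc k) , λ _ →
        applyUpTo-hstrip ℓ (λ r _ → below-mono k r) (λ r r< → below-interlace k r r<) ,
        trans (sum-applyUpTo ℓ (below f (suc k))) (trans (sm-cong ℓ (λ r _ → below-suc f k r))
          (trans (sm-+ ℓ (λ r → sm (width r) (λ i → ⟦ f r (part μ r + i) ≟ suc k ⟧)) (below f k))
            (cong₂ _+_ (contents k k<) (sym (sum-applyUpTo ℓ (below f k))))))))

  -- The index of the first shape that contains the cell, found by counting the shapes that do not.
  -- The starting shape is counted as well, hence `suc n` and entries from 1 on.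
  entry : List (List ℕ) → ℕ → ℕ → ℕ
  entry F r c = sm (suc n) (λ k → ⟦ part (nth (fit ℓ μ) F k) r ≤? c ⟧)

  module FromChain {F : List (List ℕ)} (ch : H.IsChain (fit ℓ μ) α F λ') where

    S : ℕ → List ℕ
    S = nth (fit ℓ μ) F

    S-step : ∀ k → k < n → HStrip (S k) (S (suc k)) × sum (S (suc k)) ≡ part α k + sum (S k)
    S-step k k< = proj₂ (proj₂ (H.chain-step ch k k<))

    S-n : S n ≡ λ'
    S-n = H.chain-end ch

    S-mono : ∀ k → k < n → ∀ r → part (S k) r ≤ part (S (suc k)) r
    S-mono k k< = pointwise-part ≤-refl (hstrip-pointwise (proj₁ (S-step k k<)))

    S-props : ∀ k → k ≤ n → Pointwise _≤_ (S k) λ' × Desc (S k)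
    S-props zero _ = subst (Pointwise _≤_ (fit ℓ μ)) (applyUpTo-part λ')
      (applyUpTo-pointwise ℓ (λ r _ → μ⊆λ r)) , applyUpTo-desc ℓ (λ r _ → μ-part r)
    S-props (suc k) k< = ∈-partsBelow⁻ (proj₁ (H.chain-step ch k k<))

    S-length : ∀ k → k ≤ n → length (S k) ≡ ℓ
    S-length k k≤ = PW.Pointwise-length (proj₁ (S-props k k≤))

    S-≤λ : ∀ k → k ≤ n → ∀ r → part (S k) r ≤ part λ' r
    S-≤λ k k≤ = pointwise-part ≤-refl (proj₁ (S-props k k≤))

    S-0 : ∀ {r} → r < ℓ → part (S 0) r ≡ part μ r
    S-0 r< = part-applyUpTo ℓ (part μ) r<

    S-≥μ : ∀ k → k ≤ n → ∀ {r} → r < ℓ → part μ r ≤ part (S k) r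
    S-≥μ zero _ r< = ≤-reflexive (sym (S-0 r<))
    S-≥μ (suc k) k< {r} r< = ≤-trans (S-≥μ k (<⇒≤ k<) r<) (S-mono k k< r)

    entry-iff : ∀ k → k ≤ n → ∀ r c → (c < part (S k) r → entry F r c ≤ k) × (entry F r c ≤ k → c < part (S k) r)
    entry-iff k k≤ r c = (λ p → ≮⇒≥ (λ q → <⇒≱ p (proj₂ seg q))) , (λ p → ≰⇒> (λ q → <⇒≱ (proj₁ seg q) p))
      where
      seg = initial-segment (λ k → part (S k) r ≤? c) (suc n) (λ {k} k< p → ≤-trans (S-mono k (s≤s⁻¹ k<) r) p) k
        (s≤s k≤)

    entry-≤n : ∀ {r c} → In r c → entry F r c ≤ n
    entry-≤n {r} {c} (_ , _ , c<) = proj₁ (entry-iff n ≤-refl r c) (subst (λ S → c < part S r) (sym S-n) c<)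

    entry-≥1 : ∀ {r c} → In r c → 1 ≤ entry F r c
    entry-≥1 {r} {c} (r< , μ≤ , _) = ≰⇒> (λ p → <⇒≱ (proj₂ (entry-iff 0 z≤n r c) p) (subst (_≤ c) (sym (S-0 r<)) μ≤))

    -- If the lower cell lies in `S (suc k)`, interlacing puts the upper one into `S k`.
    entry-columns : ∀ {r r′ c} → In r c → In r′ c → r < r′ → entry F r c < entry F r′ c
    entry-columns {r} {r′} {c} i i′ r<r′ with entry F r c in eq | entry-≥1 i | entry-≤n i
    ... | suc k | _ | k<n = ≰⇒> λ p → 1+n≰n (subst (_≤ k) eq (proj₁ (entry-iff k (<⇒≤ k<n) r c)
      (≤-trans (proj₂ (entry-iff (suc k) k<n r′ c) p)
        (≤-trans (isPartition⇒≤ (S (suc k)) (desc⇒isPartition (proj₂ (S-props (suc k) k<n))) r<r′)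
          (hstrip-part (proj₁ (S-step k k<n)) r)))))

    below-entry : ∀ k → k ≤ n → ∀ {r} → r < ℓ → below (entry F) k r ≡ part (S k) r
    below-entry k k≤ {r} r< = trans (cong (part μ r +_) (trans (sm-cong (width r) (λ i _ →
        ⟦⟧-cong (entry F r (part μ r + i) ≤? k) (i <? part (S k) r ∸ part μ r)
          (λ p → subst (_< part (S k) r ∸ part μ r) (m+n∸m≡n (part μ r) i)
            (∸-monoˡ-< (proj₂ (entry-iff k k≤ r _) p) (m≤m+n (part μ r) i)))
          (λ p → proj₁ (entry-iff k k≤ r _) (≤-trans (+-monoʳ-< (part μ r) p)
            (≤-reflexive (m+[n∸m]≡n (S-≥μ k k≤ r<)))))))
        (sm-below (width r) (∸-monoˡ-≤ (part μ r) (S-≤λ k k≤ r)))))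
      (m+[n∸m]≡n (S-≥μ k k≤ r<))

    entry-contents : ∀ k → k < n → sm ℓ (λ r → sm (width r) (λ i → ⟦ entry F r (part μ r + i) ≟ suc k ⟧)) ≡ part α k
    entry-contents k k< = +-cancelʳ-≡ (sum (S k)) (sm ℓ count) (part α k) (begin
      sm ℓ count + sum (S k)                    ≡⟨ cong (sm ℓ count +_) (sum-part (S k) (S-length k (<⇒≤ k<))) ⟩
      sm ℓ count + sm ℓ (part (S k))            ≡⟨ cong (sm ℓ count +_)
        (sm-cong ℓ (λ r r< → sym (below-entry k (<⇒≤ k<) r<))) ⟩
      sm ℓ count + sm ℓ (below (entry F) k)     ≡⟨ sym (sm-+ ℓ count (below (entry F) k)) ⟩
      sm ℓ (λ r → count r + below (entry F) k r) ≡⟨ sm-cong ℓ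
        (λ r r< → trans (sym (below-suc (entry F) k r)) (below-entry (suc k) k< r<)) ⟩
      sm ℓ (part (S (suc k)))                   ≡⟨ sym (sum-part (S (suc k)) (S-length (suc k) k<)) ⟩
      sum (S (suc k))                           ≡⟨ proj₂ (S-step k k<) ⟩
      part α k + sum (S k)                      ∎)
      where
      open ≡-Reasoning
      count : ℕ → ℕ
      count r = sm (width r) (λ i → ⟦ entry F r (part μ r + i) ≟ suc k ⟧)

    chain-tableau : Tableau (entry F)
    chain-tableau = record
      { bounds = λ i → entry-≥1 i , entry-≤n i
      ; rows = λ {r} {c} {c′} i i′ c<c′ → proj₁ (entry-iff (entry F r c′) (entry-≤n i′) r c)
        (<-trans c<c′ (proj₂ (entry-iff (entry F r c′) (entry-≤n i′) r c′) ≤-refl))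
      ; columns = entry-columns
      ; contents = entry-contents
      }

  skewSchur-chains : skewSchur λ' μ α ≡ H.#chains (fit ℓ μ) α λ'
  skewSchur-chains = length-bij (SSYTs-unique λ' μ α) (H.chains-unique (fit ℓ μ) α λ')
    (λ z → tableau→chain (λ r c → look z (r , c))) (λ F → tab (entry F) (cells λ' μ))
    (λ z∈ → H.chains-complete (FromTableau.tableau-chain (SSYT⇒tableau (SSYTs-sound λ' μ α z∈))))
    (λ F∈ → SSYTs-complete λ' μ α (tableau⇒SSYT (FromChain.chain-tableau (H.chains-sound (fit ℓ μ) α λ' F∈))))
    (λ {z} z∈ → left z (SSYTs-sound λ' μ α z∈))
    (λ {F} F∈ → right F (H.chains-sound (fit ℓ μ) α λ' F∈))
    where
    left : ∀ z → IsSSYT λ' μ α z → tab (entry (tableau→chain (λ r c → look z (r , c)))) (cells λ' μ) ≡ z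
    left z s = trans (tab-cong (cells λ' μ) (λ {r} {c} p → eq r c (∈-cells⁻ {λ'} {μ} p))) (SSYT-tab s)
      where
      f : ℕ → ℕ → ℕ
      f r c = look z (r , c)
      module T = FromTableau (SSYT⇒tableau s)
      eq : ∀ r c → In r c → entry (tableau→chain f) r c ≡ f r c
      eq r c i = trans (sm-cong (suc n) (λ k k< → trans
          (cong (λ S → ⟦ part S r ≤? c ⟧) (trans (cong (λ u → nth u (tableau→chain f) k) (sym T.belowShape-0))
            (nth-applyUpTo (belowShape f) n (s≤s⁻¹ k<))))
          (⟦⟧-cong (part (belowShape f k) r ≤? c) (k <? f r c)
            (λ p → ≰⇒> (λ q → <⇒≱ (subst (c <_) (sym (part-applyUpTo ℓ (below f k) (proj₁ i)))
              (proj₁ (T.below-iff k i) q)) p))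
            (λ p → ≮⇒≥ (λ q → <⇒≱ p (proj₂ (T.below-iff k i)
              (subst (c <_) (part-applyUpTo ℓ (below f k) (proj₁ i)) q)))))))
        (sm-below (suc n) (m≤n⇒m≤1+n (proj₂ (Tableau.bounds (SSYT⇒tableau s) i))))
    right : ∀ F → H.IsChain (fit ℓ μ) α F λ' → tableau→chain (λ r c → look (tab (entry F) (cells λ' μ)) (r , c)) ≡ F
    right F ch = trans (applyUpTo-cong n (λ k k< → part-ext _ _
      (trans (List.length-applyUpTo _ ℓ) (sym (C.S-length (suc k) k<)))
        (λ r r<′ → let r< = subst (r <_) (List.length-applyUpTo _ ℓ) r<′ in
          trans (part-applyUpTo ℓ _ r<) (trans
            (cong (part μ r +_) (sm-cong (width r) (λ i i< → cong (λ x → ⟦ x ≤? suc k ⟧)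
            (look-tab (entry F) (cells-unique λ' μ) (let (a , b , c) = In-shift r< i< in ∈-cells⁺ {λ'} {μ} a b c)))))
            (C.below-entry (suc k) k< r<)))))
      (sym (H.chain-nth ch))
      where module C = FromChain ch

-- Products of skew Schur functions as chains of pairs of shapes

module _ (s s′ : List ℕ) where
  private
    module H  = HChains₁ s
    module H′ = HChains₁ s′
    module H₂ = HChains (s , s′)
    S S′ : List (List ℕ)
    S = partsBelow s
    S′ = partsBelow s′

  split-size : ∀ a {u w u′ w′} → Pointwise _≤_ u w → Pointwise _≤_ u′ w′ →
    ∑ (upTo (suc a)) (λ b → ind (sum w ≟ b + sum u) *ℤ ind (sum w′ ≟ (a ∸ b) + sum u′)) ≡
    ind (sum w + sum w′ ≟ a + (sum u + sum u′))
  split-size a {u} {w} {u′} {w′} p p′ with sum w + sum w′ ≟ a + (sum u + sum u′)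
  ... | yes e = trans (∑-single (Unique.upTo⁺ (suc a)) (∈-upTo⁺ (s≤s d≤a)) _ off)
      (cong₂ _*ℤ_ (ind-yes (sum w ≟ d + sum u) wd) (ind-yes (sum w′ ≟ (a ∸ d) + sum u′) wd′))
    where
    d = sum w ∸ sum u
    wd : sum w ≡ d + sum u
    wd = sym (m∸n+n≡m (pointwise-≤-sum p))
    l : ∀ d u w′ → d + u + w′ ≡ d + w′ + u
    l = solve-∀
    m : ∀ a u u′ → a + (u + u′) ≡ a + u′ + u
    m = solve-∀
    e′ : d + sum w′ ≡ a + sum u′
    e′ = +-cancelʳ-≡ (sum u) _ _ (trans (sym (l d (sum u) (sum w′)))
      (trans (cong (_+ sum w′) (sym wd)) (trans e (m a (sum u) (sum u′)))))
    d≤a : d ≤ a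
    d≤a = +-cancelʳ-≤ (sum u′) d a (≤-trans (+-monoʳ-≤ d (pointwise-≤-sum p′)) (≤-reflexive e′))
    wd′ : sum w′ ≡ (a ∸ d) + sum u′
    wd′ = +-cancelˡ-≡ d _ _ (trans e′ (trans (cong (_+ sum u′) (sym (m+[n∸m]≡n d≤a))) (+-assoc d (a ∸ d) (sum u′))))
    off : ∀ {b} → b ∈ upTo (suc a) → b ≢ d → ind (sum w ≟ b + sum u) *ℤ ind (sum w′ ≟ (a ∸ b) + sum u′) ≡ 0ℤ
    off {b} _ b≢ = trans (cong (_*ℤ ind (sum w′ ≟ (a ∸ b) + sum u′))
      (ind-no (sum w ≟ b + sum u) (λ q → b≢ (+-cancelʳ-≡ (sum u) b d (trans (sym q) wd)))))
      (ℤ.*-zeroˡ (ind (sum w′ ≟ (a ∸ b) + sum u′)))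
  ... | no ¬e = ∑-zero (upTo (suc a)) off
    where
    l : ∀ b c u u′ → (b + u) + (c + u′) ≡ (b + c) + (u + u′)
    l = solve-∀
    off : ∀ {b} → b ∈ upTo (suc a) → ind (sum w ≟ b + sum u) *ℤ ind (sum w′ ≟ (a ∸ b) + sum u′) ≡ 0ℤ
    off {b} b∈ with sum w ≟ b + sum u | sum w′ ≟ (a ∸ b) + sum u′
    ... | yes q | yes q′ = ⊥-elim (¬e (trans (cong₂ _+_ q q′)
      (trans (l b (a ∸ b) (sum u) (sum u′)) (cong (_+ (sum u + sum u′)) (m+[n∸m]≡n (s≤s⁻¹ (∈-upTo⁻ b∈)))))))
    ... | yes _ | no _ = refl
    ... | no _ | yes _ = refl
    ... | no _ | no _ = refl

  -- A horizontal strip in a pair of shapes is a pair of horizontal strips. Summing over the ways in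
  -- which each letter divides its multiplicity between the components gives the coefficient of a
  -- product.
  convolution : ∀ α u u′ → pos (H₂.#chains (u , u′) α (s , s′)) ≡
    ∑ (belowVec α) (λ β → pos (H.#chains u β s) *ℤ pos (H′.#chains u′ (zipWith _∸_ α β) s′))
  convolution [] u u′ = trans (H₂.#chains-[] (u , u′) (s , s′)) (trans
    (trans (ind-⇔ ((u , u′) ≟ₛ (s , s′)) ((u ≟ₗ s) ×-dec (u′ ≟ₗ s′)) (λ { refl → refl , refl })
      (λ { (refl , refl) → refl })) (ind-× (u ≟ₗ s) (u′ ≟ₗ s′)))
    (sym (trans (ℤ.+-identityʳ (pos (H.#chains u [] s) *ℤ pos (H′.#chains u′ [] s′)))
      (cong₂ _*ℤ_ (H.#chains-[] u s) (H′.#chains-[] u′ s′)))))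
  convolution (a ∷ α) u u′ = begin
    pos (H₂.#chains (u , u′) (a ∷ α) (s , s′))
      ≡⟨ H₂.#chains-∷ (u , u′) a α (s , s′) ⟩
    ∑ (cartesianProduct S S′) (λ w → ind (H₂.hrel? (length α) a (u , u′) w) *ℤ pos (H₂.#chains w α (s , s′)))
      ≡⟨ ∑-cartesian S S′ _ ⟩
    ∑ S (λ w → ∑ S′ (λ w′ → ind (H₂.hrel? (length α) a (u , u′) (w , w′)) *ℤ pos (H₂.#chains (w , w′) α (s , s′))))
      ≡⟨ ∑-cong S (λ {w} _ → ∑-cong S′ (λ {w′} _ → trans (cong₂ _*ℤ_ (rel w w′) (convolution α w w′))
        (spread w w′))) ⟩
    ∑ S (λ w → ∑ S′ (λ w′ → ∑ B (λ b → ∑ Β (λ β → term b β w w′))))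
      ≡⟨ trans (∑-cong S (λ _ → ∑-swap S′ B _))
        (trans (∑-swap S B _) (∑-cong B (λ _ → trans (∑-cong S (λ _ → ∑-swap S′ Β _)) (∑-swap S Β _)))) ⟩
    ∑ B (λ b → ∑ Β (λ β → ∑ S (λ w → ∑ S′ (λ w′ → term b β w w′))))
      ≡⟨ ∑-cong B (λ {b} _ → ∑-cong Β (λ {β} _ → product b β)) ⟩
    ∑ B (λ b → ∑ Β (λ β → pos (H.#chains u (b ∷ β) s) *ℤ pos (H′.#chains u′ ((a ∸ b) ∷ zipWith _∸_ α β) s′)))
      ≡⟨ sym (trans (∑-concatMap (λ b → map (b ∷_) Β) B _) (∑-cong B (λ {b} _ → ∑-map (b ∷_) Β _))) ⟩
    ∑ (belowVec (a ∷ α)) (λ β → pos (H.#chains u β s) *ℤ pos (H′.#chains u′ (zipWith _∸_ (a ∷ α) β) s′)) ∎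
    where
    open ≡-Reasoning
    B = upTo (suc a)
    Β = belowVec α
    r : ℕ → List ℕ → ℤ
    r b w = ind (H.hrel? (length α) b u w)
    r′ : ℕ → List ℕ → ℤ
    r′ b w′ = ind (H′.hrel? (length α) (a ∸ b) u′ w′)
    f : List ℕ → List ℕ → ℤ
    f w β = pos (H.#chains w β s)
    f′ : List ℕ → List ℕ → ℤ
    f′ w′ β = pos (H′.#chains w′ (zipWith _∸_ α β) s′)
    term : ℕ → List ℕ → List ℕ → List ℕ → ℤ
    term b β w w′ = (r b w *ℤ f w β) *ℤ (r′ b w′ *ℤ f′ w′ β)
    rel : ∀ w w′ → ind (H₂.hrel? (length α) a (u , u′) (w , w′)) ≡ ∑ B (λ b → r b w *ℤ r′ b w′)
    rel w w′ = trans (ind-× (hstrip₂? (u , u′) (w , w′)) (sum w + sum w′ ≟ a + (sum u + sum u′)))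
      (trans (cong (_*ℤ ind (sum w + sum w′ ≟ a + (sum u + sum u′))) (ind-× (hstrip? u w) (hstrip? u′ w′)))
      (trans (strips (hstrip? u w) (hstrip? u′ w′))
      (trans (sym (∑-*ˡ (ind (hstrip? u w) *ℤ ind (hstrip? u′ w′)) B
        (λ b → ind (sum w ≟ b + sum u) *ℤ ind (sum w′ ≟ (a ∸ b) + sum u′)))) (∑-cong B (λ {b} _ → trans
        (*ℤ-interchange (ind (hstrip? u w)) (ind (hstrip? u′ w′)) (ind (sum w ≟ b + sum u))
          (ind (sum w′ ≟ (a ∸ b) + sum u′)))
        (sym (cong₂ _*ℤ_ (ind-× (hstrip? u w) (sum w ≟ b + sum u))
          (ind-× (hstrip? u′ w′) (sum w′ ≟ (a ∸ b) + sum u′)))))))))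
      where
      R = ind (sum w + sum w′ ≟ a + (sum u + sum u′))
      L = ∑ B (λ b → ind (sum w ≟ b + sum u) *ℤ ind (sum w′ ≟ (a ∸ b) + sum u′))
      strips : (d : Dec (HStrip u w)) (e : Dec (HStrip u′ w′)) → (ind d *ℤ ind e) *ℤ R ≡ (ind d *ℤ ind e) *ℤ L
      strips (yes p) (yes p′) = cong ((1ℤ *ℤ 1ℤ) *ℤ_) (sym (split-size a (hstrip-pointwise p) (hstrip-pointwise p′)))
      strips (yes p) (no _) = trans (ℤ.*-zeroˡ R) (sym (ℤ.*-zeroˡ L))
      strips (no _) (yes _) = trans (ℤ.*-zeroˡ R) (sym (ℤ.*-zeroˡ L))
      strips (no _) (no _) = trans (ℤ.*-zeroˡ R) (sym (ℤ.*-zeroˡ L))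
    spread : ∀ w w′ → ∑ B (λ b → r b w *ℤ r′ b w′) *ℤ ∑ Β (λ β → f w β *ℤ f′ w′ β) ≡ ∑ B
      (λ b → ∑ Β (λ β → term b β w w′))
    spread w w′ = trans (sym (∑-*ʳ (∑ Β (λ β → f w β *ℤ f′ w′ β)) B (λ b → r b w *ℤ r′ b w′)))
      (∑-cong B (λ {b} _ → trans (sym (∑-*ˡ (r b w *ℤ r′ b w′) Β (λ β → f w β *ℤ f′ w′ β)))
      (∑-cong Β (λ {β} _ → *ℤ-interchange (r b w) (r′ b w′) (f w β) (f′ w′ β)))))
    product : ∀ b β → ∑ S (λ w → ∑ S′ (λ w′ → term b β w w′)) ≡ pos (H.#chains u (b ∷ β) s) *ℤ pos
      (H′.#chains u′ ((a ∸ b) ∷ zipWith _∸_ α β) s′)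
    product b β = trans (∑-cong S (λ {w} _ → ∑-*ˡ (r b w *ℤ f w β) S′ (λ w′ → r′ b w′ *ℤ f′ w′ β)))
      (trans (∑-*ʳ (∑ S′ (λ w′ → r′ b w′ *ℤ f′ w′ β)) S (λ w → r b w *ℤ f w β)) (sym (cong₂ _*ℤ_
      (trans (H.#chains-∷ u b β s) (∑-cong S (λ {w} _ → refl)))
      (trans (H′.#chains-∷ u′ (a ∸ b) (zipWith _∸_ α β) s′) (∑-cong S′ (λ {w′} _ → refl))))))

-- A straight shape is treated as a pair with empty second component, so that one theory of chains
-- serves both sides of the identity.
hchains-single : ∀ s α u → pos (HChains.#chains (s , []) (u , []) α (s , [])) ≡ pos (HChains₁.#chains s u α s)
hchains-single s [] u = trans (HChains.#chains-[] (s , []) (u , []) (s , [])) (trans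
  (ind-⇔ ((u , []) ≟ₛ (s , [])) (u ≟ₗ s) (cong proj₁) (cong (_, []))) (sym (HChains₁.#chains-[] s u s)))
hchains-single s (a ∷ α) u = begin
  pos (HChains.#chains (s , []) (u , []) (a ∷ α) (s , []))
    ≡⟨ HChains.#chains-∷ (s , []) (u , []) a α (s , []) ⟩
  ∑ (cartesianProduct (partsBelow s) ([] ∷ []))
    (λ w → ind (HChains.hrel? (s , []) (length α) a (u , []) w) *ℤ pos (HChains.#chains (s , []) w α (s , [])))
    ≡⟨ ∑-cartesian (partsBelow s) ([] ∷ []) _ ⟩
  ∑ (partsBelow s) (λ w → ind (HChains.hrel? (s , []) (length α) a (u , []) (w , [])) *ℤ pos
    (HChains.#chains (s , []) (w , []) α (s , [])) +ℤ 0ℤ)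
    ≡⟨ ∑-cong (partsBelow s) (λ {w} _ → trans (ℤ.+-identityʳ _) (cong₂ _*ℤ_
         (ind-⇔ (HChains.hrel? (s , []) (length α) a (u , []) (w , [])) (HChains₁.hrel? s (length α) a u w)
           (λ { ((p , []) , e) → p , trans (sym (+-identityʳ (sum w)))
             (trans e (cong (a +_) (+-identityʳ (sum u)))) })
           (λ { (p , e) → (p , []) , trans (+-identityʳ (sum w))
             (trans e (cong (a +_) (sym (+-identityʳ (sum u))))) }))
         (hchains-single s α w))) ⟩
  ∑ (partsBelow s) (λ w → ind (HChains₁.hrel? s (length α) a u w) *ℤ pos (HChains₁.#chains s w α s))
    ≡⟨ sym (HChains₁.#chains-∷ s u a α s) ⟩
  pos (HChains₁.#chains s u (a ∷ α) s) ∎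
  where open ≡-Reasoning

-- Peelability

distinctᵇ⇒unique : ∀ xs → T (distinctᵇ xs) → Unique xs
memᵇ⇒∈ : ∀ p xs → T (memᵇ p xs) → p ∈ xs
memᵇ⇒∈ (a , b) xs t = Any.map (λ {x} e → case Equivalence.to T-∧ e of λ { (p , q) → cong₂ _,_ (≡ᵇ⇒≡ a (proj₁ x) p)
  (≡ᵇ⇒≡ b (proj₂ x) q) }) (Any.any⁻ (cellEqᵇ (a , b)) xs t)

∈⇒memᵇ : ∀ {p xs} → p ∈ xs → T (memᵇ p xs)
∈⇒memᵇ {a , b} p∈ = Any.any⁺ (cellEqᵇ (a , b))
  (Any.map (λ { refl → Equivalence.from T-∧ (≡⇒≡ᵇ a a refl , ≡⇒≡ᵇ b b refl) }) p∈)

T-not⁻ : ∀ b → T (not b) → ¬ T b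
T-not⁻ false _ ()

T-not⁺ : ∀ b → ¬ T b → T (not b)
T-not⁺ true f = f tt
T-not⁺ false f = tt

distinctᵇ⇒unique [] _ = []
distinctᵇ⇒unique (p ∷ ps) t with Equivalence.to T-∧ t
... | n , d = All.tabulate (λ q∈ e → T-not⁻ (memᵇ p ps) n (∈⇒memᵇ (subst (_∈ ps) (sym e) q∈))) ∷ distinctᵇ⇒unique ps d

unique⇒distinctᵇ : ∀ xs → Unique xs → T (distinctᵇ xs)
unique⇒distinctᵇ [] _ = tt
unique⇒distinctᵇ (p ∷ ps) (p∉ ∷ u) = Equivalence.from T-∧
  (T-not⁺ (memᵇ p ps) (λ t → All.lookup p∉ (memᵇ⇒∈ p ps t) refl) , unique⇒distinctᵇ ps u)

∈-sublists⁻ : {A : Set} (xs : List A) {s : List A} → s ∈ sublists xs → All (_∈ xs) s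
∈-sublists⁻ [] (here refl) = []
∈-sublists⁻ (x ∷ xs) s∈ with ∈-++⁻ (sublists xs) s∈
... | inj₁ p = All.map there (∈-sublists⁻ xs p)
... | inj₂ p with ∈-map⁻ (x ∷_) p
... | s′ , q , refl = here refl ∷ All.map there (∈-sublists⁻ xs q)

filter-∈-sublists : {A : Set} {P : A → Set} (P? : Decidable P) (xs : List A) → filter P? xs ∈ sublists xs
filter-∈-sublists P? [] = here refl
filter-∈-sublists P? (x ∷ xs) with P? x
... | yes _ = ∈-++⁺ʳ (sublists xs) (∈-map⁺ (x ∷_) (filter-∈-sublists P? xs))
... | no _ = ∈-++⁺ˡ (filter-∈-sublists P? xs)

unique-map-injective : {A B : Set} (f : A → B) {xs : List A} → Unique (map f xs) → ∀ {x y} → x ∈ xs → y ∈ xs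
  → f x ≡ f y → x ≡ y
unique-map-injective f u (here refl) (here refl) e = refl
unique-map-injective f (x∉ ∷ u) (here refl) (there q) e = ⊥-elim (All.lookup x∉ (∈-map⁺ f q) e)
unique-map-injective f (x∉ ∷ u) (there p) (here refl) e = ⊥-elim (All.lookup x∉ (∈-map⁺ f p) (sym e))
unique-map-injective f (_ ∷ u) (there p) (there q) e = unique-map-injective f u p q e

-- Distinctness within each coordinate amounts to disjointness of the pairs, since the two cells of
-- a candidate carry different entries.
Matching : (Cell × Cell → Set) → ℕ → List (Cell × Cell) → Set
Matching C a s = a ≤ length s × Unique (map proj₁ s) × Unique (map proj₂ s) × (∀ x → x ∈ s → C x)

module _ {cs : List (Cell × Cell)} (cs-unique : Unique cs) (a : ℕ) where
  private
    test : List (Cell × Cell) → Bool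
    test s = (a ≤ᵇ length s) ∧ distinctᵇ (map proj₁ s) ∧ distinctᵇ (map proj₂ s)
    _≟₂_ : DecidableEquality (Cell × Cell)
    _≟₂_ = ≡-dec _≟ᶜ_ _≟ᶜ_

  sublist⇒matching : T (any test (sublists cs)) → ∃ (Matching (_∈ cs) a)
  sublist⇒matching t with find (Any.any⁻ test (sublists cs) t)
  ... | s , s∈ , p with Equivalence.to T-∧ p
  ... | q , r with Equivalence.to T-∧ r
  ... | u , v = s , ≤ᵇ⇒≤ a (length s) q , distinctᵇ⇒unique _ u , distinctᵇ⇒unique _ v , λ _ → All.lookup
    (∈-sublists⁻ cs s∈)

  -- A matching may list its pairs in any order, while `sublists` follows the order of `cs`.
  -- Filtering `cs` by membership in the matching puts it into that order.
  matching⇒sublist : ∀ {s} → Matching (_∈ cs) a s → T (any test (sublists cs))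
  matching⇒sublist {s} (a≤ , u , v , s⊆) = Any.any⁺ test (lose (filter-∈-sublists (λ x → x ∈? s) cs)
    (Equivalence.from T-∧ (≤⇒≤ᵇ (≤-trans a≤ (unique-⊆⇒length-≤ (Unique.map⁻ u)
      (λ p → ∈-filter⁺ (λ x → x ∈? s) (s⊆ _ p) p))) ,
      Equivalence.from T-∧ (unique⇒distinctᵇ _ (injective-unique proj₁ u) , unique⇒distinctᵇ _
        (injective-unique proj₂ v)))))
    where
    open import Data.List.Membership.DecPropositional _≟₂_ using (_∈?_)
    s′ = filter (λ x → x ∈? s) cs
    injective-unique : (g : Cell × Cell → Cell) → Unique (map g s) → Unique (map g s′)
    injective-unique g u = map-unique g (Unique.filter⁺ (λ x → x ∈? s) cs-unique)
      (λ p q → unique-map-injective g u (proj₂ (∈-filter⁻ (λ x → x ∈? s) {xs = cs} p))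
        (proj₂ (∈-filter⁻ (λ x → x ∈? s) {xs = cs} q)))

Candidate : List Filled → ℕ → Cell × Cell → Set
Candidate z r ((rp , cp) , (rq , cq)) = ((rp , cp) , suc r) ∈ z × ((rq , cq) , r + 3) ∈ z × rp ≤ rq × cq ≤ cp

if-∈⁻ : {A : Set} {x y : A} (b : Bool) → x ∈ (if b then y ∷ [] else []) → T b × x ≡ y
if-∈⁻ true (here refl) = tt , refl

if-∈⁺ : {A : Set} {x : A} (b : Bool) → T b → x ∈ (if b then x ∷ [] else [])
if-∈⁺ true _ = here refl

T-∧₄ : ∀ a b c d → T (a ∧ b ∧ c ∧ d) → T a × T b × T c × T d
T-∧₄ true true true true _ = tt , tt , tt , tt

T-∧₄⁺ : ∀ a b c d → T a → T b → T c → T d → T (a ∧ b ∧ c ∧ d)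
T-∧₄⁺ true true true true _ _ _ _ = tt

-- G and H stand for the anonymous functions in the definition of peelCondition.
module _ {z : List Filled} (r : ℕ) (u : Unique (map proj₁ z))
  {G : Filled → List (Cell × Cell)} {H : ℕ → ℕ → ℕ → Filled → List (Cell × Cell)}
  (G≡ : ∀ rp cp x → G ((rp , cp) , x) ≡ concatMap (H rp cp x) z)
  (H≡ : ∀ rp cp x rq cq y → H rp cp x ((rq , cq) , y) ≡
    (if (x ≡ᵇ suc r) ∧ (y ≡ᵇ r + 3) ∧ (rp ≤ᵇ rq) ∧ (cq ≤ᵇ cp) then ((rp , cp) , (rq , cq)) ∷ [] else [])) where

  private
    z-unique : Unique z
    z-unique = Unique.map⁻ u

    same-key : ∀ {c c′ x y} → (c , x) ∈ z → (c′ , y) ∈ z → c ≡ c′ → (c , x) ≡ (c′ , y)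
    same-key p q refl = cong (_ ,_) (trans (sym (look-∈ u p)) (look-∈ u q))

    H-∈⁻ : ∀ {rp cp x rq cq y a} → a ∈ H rp cp x ((rq , cq) , y) →
      T ((x ≡ᵇ suc r) ∧ (y ≡ᵇ r + 3) ∧ (rp ≤ᵇ rq) ∧ (cq ≤ᵇ cp)) × a ≡ ((rp , cp) , (rq , cq))
    H-∈⁻ {rp} {cp} {x} {rq} {cq} {y} a∈ = if-∈⁻ ((x ≡ᵇ suc r) ∧ (y ≡ᵇ r + 3) ∧ (rp ≤ᵇ rq) ∧ (cq ≤ᵇ cp))
      (subst (_ ∈_) (H≡ rp cp x rq cq y) a∈)

    G-∈⁻ : ∀ {rp cp x a} → a ∈ G ((rp , cp) , x) → ∃ λ q → q ∈ z × a ∈ H rp cp x q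
    G-∈⁻ {rp} {cp} {x} a∈ = ∈-concatMap-elim (H rp cp x) {z} (subst (_ ∈_) (G≡ rp cp x) a∈)

    G-key : ∀ {rp cp x a} → a ∈ G ((rp , cp) , x) → proj₁ a ≡ (rp , cp)
    G-key a∈ with G-∈⁻ a∈
    ... | ((rq , cq) , y) , _ , a∈′ = cong proj₁ (proj₂ (H-∈⁻ a∈′))

  candidates-unique : Unique (concatMap G z)
  candidates-unique = concatMap-unique G z-unique
    (λ { {(rp , cp) , x} _ → subst Unique (sym (G≡ rp cp x)) (concatMap-unique (H rp cp x) z-unique
      (λ { {(rq , cq) , y} _ → subst Unique (sym (H≡ rp cp x rq cq y))
        (if-unique ((x ≡ᵇ suc r) ∧ (y ≡ᵇ r + 3) ∧ (rp ≤ᵇ rq) ∧ (cq ≤ᵇ cp))) })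
      (λ { {(rq , cq) , y} {(rq′ , cq′) , y′} p q a b → same-key p q
        (trans (sym (cong proj₂ (proj₂ (H-∈⁻ a)))) (cong proj₂ (proj₂ (H-∈⁻ b)))) })) })
    (λ { {(rp , cp) , x} {(rp′ , cp′) , x′} p q a b → same-key p q (trans (sym (G-key a)) (G-key b)) })
    where
    if-unique : {A : Set} {x : A} (b : Bool) → Unique (if b then x ∷ [] else [])
    if-unique true = [] ∷ []
    if-unique false = []

  candidates-sound : ∀ {x} → x ∈ concatMap G z → Candidate z r x
  candidates-sound x∈ with ∈-concatMap-elim G {z} x∈
  ... | ((rp , cp) , x) , p∈ , x∈′ with G-∈⁻ x∈′
  ... | ((rq , cq) , y) , q∈ , x∈″ with H-∈⁻ x∈″
  ... | t , refl with T-∧₄ (x ≡ᵇ suc r) (y ≡ᵇ r + 3) (rp ≤ᵇ rq) (cq ≤ᵇ cp) t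
  ... | t₁ , t₂ , t₃ , t₄ = subst (λ x → ((rp , cp) , x) ∈ z) (≡ᵇ⇒≡ x (suc r) t₁) p∈ , subst
    (λ y → ((rq , cq) , y) ∈ z) (≡ᵇ⇒≡ y (r + 3) t₂) q∈ ,
    ≤ᵇ⇒≤ rp rq t₃ , ≤ᵇ⇒≤ cq cp t₄

  candidates-complete : ∀ {x} → Candidate z r x → x ∈ concatMap G z
  candidates-complete {(rp , cp) , (rq , cq)} (p∈ , q∈ , r≤ , c≤) = ∈-concatMap-intro G p∈
    (subst (_ ∈_) (sym (G≡ rp cp (suc r))) (∈-concatMap-intro (H rp cp (suc r)) q∈
    (subst (_ ∈_) (sym (H≡ rp cp (suc r) rq cq (r + 3)))
      (if-∈⁺ ((suc r ≡ᵇ suc r) ∧ (r + 3 ≡ᵇ r + 3) ∧ (rp ≤ᵇ rq) ∧ (cq ≤ᵇ cp))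
      (T-∧₄⁺ (suc r ≡ᵇ suc r) (r + 3 ≡ᵇ r + 3) (rp ≤ᵇ rq) (cq ≤ᵇ cp) (≡⇒≡ᵇ r r refl) (≡⇒≡ᵇ (r + 3) (r + 3) refl)
        (≤⇒≤ᵇ r≤) (≤⇒≤ᵇ c≤))))))

  candidates-matching : ∀ a → let test = λ (s : List (Cell × Cell)) → (a ≤ᵇ length s) ∧ distinctᵇ (map proj₁ s) ∧ distinctᵇ (map proj₂ s) in
    (T (any test (sublists (concatMap G z))) → ∃ (Matching (Candidate z r) a)) ×
    (∃ (Matching (Candidate z r) a) → T (any test (sublists (concatMap G z))))
  candidates-matching a =
    (λ t → case sublist⇒matching candidates-unique a t of λ { (s , l , v , v′ , s⊆) → s , l , v , v′ , λ x p
      → candidates-sound (s⊆ x p) }) ,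
    (λ { (s , l , v , v′ , c) → matching⇒sublist candidates-unique a
      (l , v , v′ , λ x p → candidates-complete (c x p)) })

peelCondition-matching : ∀ D z r → Unique (map proj₁ z) →
  (T (peelCondition D z r) → ∃ (Matching (Candidate z r) (aCoeff D r))) ×
  (∃ (Matching (Candidate z r) (aCoeff D r)) → T (peelCondition D z r))
peelCondition-matching D z r u = candidates-matching {z} r u (λ _ _ _ → refl) (λ _ _ _ _ _ _ → refl) (aCoeff D r)

length-partition : {A : Set} {P : A → Set} (P? : Decidable P) (xs : List A) →
  length xs ≡ length (filter P? xs) + length (filter (λ x → ¬? (P? x)) xs)
length-partition P? [] = refl
length-partition P? (x ∷ xs) with P? x
... | yes _ = cong suc (length-partition P? xs)
... | no _ = trans (cong suc (length-partition P? xs)) (sym (+-suc _ _))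

zero-or-one : ∀ {m} → m ≤ 1 → m ≡ 0 ⊎ m ≡ 1
zero-or-one z≤n = inj₁ refl
zero-or-one (s≤s z≤n) = inj₂ refl

-- Greedy matching of the positions of p with weakly earlier positions of q: after the last
-- unmatched position of p, just before index threshold, every position of p is matched.
module Greedy (p q : ℕ → ℕ) (p≤1 : ∀ k → p k ≤ 1) (q≤1 : ∀ k → q k ≤ 1) where

  record Scan (k : ℕ) : Set where
    field
      matched   : List (ℕ × ℕ)
      pool      : List ℕ
      threshold : ℕ
      valid     : ∀ a b → (a , b) ∈ matched → p a ≡ 1 × q b ≡ 1 × b ≤ a × a < k
      valid′    : ∀ b → b ∈ pool → q b ≡ 1 × b < k
      unique₁   : Unique (map proj₁ matched)
      unique₂   : Unique (map proj₂ matched)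
      unique₃   : Unique pool
      disjoint  : ∀ b → b ∈ pool → b ∉ map proj₂ matched
      bound     : threshold ≤ k
      count     : length matched + length pool ≡ sm k q
      -- So there are as many pairs as positions of `q` before `threshold` plus positions of `p`
      -- from `threshold` on. This is König's bound, valid for every matching, attained here.
      balance   : length matched + sm threshold p ≡ sm threshold q + sm k p

  private
    module _ {k : ℕ} (s : Scan k) where
      open Scan s
      below-k : ∀ a b → (a , b) ∈ matched → b < k
      below-k a b m = ≤-<-trans (proj₁ (proj₂ (proj₂ (valid a b m)))) (proj₂ (proj₂ (proj₂ (valid a b m))))
      fresh₁ : ∀ {c} → c ∈ map proj₁ matched → k ≢ c
      fresh₁ c∈ refl with ∈-map⁻ proj₁ c∈
      ... | (a , b) , m , refl = <-irrefl refl (proj₂ (proj₂ (proj₂ (valid a b m))))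
      fresh₂ : ∀ {c} → c ∈ map proj₂ matched → k ≢ c
      fresh₂ c∈ refl with ∈-map⁻ proj₂ c∈
      ... | (a , b) , m , refl = <-irrefl refl (below-k a b m)

  record Pool (k : ℕ) (s : Scan k) : Set where
    field
      pool     : List ℕ
      valid    : ∀ b → b ∈ pool → q b ≡ 1 × b ≤ k
      unique   : Unique pool
      disjoint : ∀ b → b ∈ pool → b ∉ map proj₂ (Scan.matched s)
      count    : length (Scan.matched s) + length pool ≡ sm (suc k) q

  extend : ∀ k (s : Scan k) → Pool k s
  extend k s with zero-or-one (q≤1 k)
  ... | inj₁ e = record
    { pool = pool ; valid = λ b m → proj₁ (valid′ b m) , <⇒≤
      (proj₂ (valid′ b m)) ; unique = unique₃ ; disjoint = disjoint
    ; count = trans count (sym (trans (cong (sm k q +_) e) (+-identityʳ _))) }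
    where open Scan s
  ... | inj₂ e = record
    { pool = k ∷ pool
    ; valid = λ { b (here refl) → e , ≤-refl ; b (there m) → proj₁ (valid′ b m) , <⇒≤ (proj₂ (valid′ b m)) }
    ; unique = All.tabulate (λ m → λ { refl → <-irrefl refl (proj₂ (valid′ k m)) }) ∷ unique₃
    ; disjoint = λ { b (here refl) m → fresh₂ s m refl ; b (there m′) m → disjoint b m′ m }
    ; count = trans (+-suc _ _) (trans (cong suc count) (sym (trans (cong (sm k q +_) e) (+-comm (sm k q) 1)))) }
    where open Scan s

  next-scan : ∀ k → Scan k → Scan (suc k)
  next-scan k s with zero-or-one (p≤1 k) | extend k s
  ... | inj₁ e | x = record
    { matched = matched ; pool = X.pool ; threshold = threshold
    ; valid = λ a b m → let (u , v , w , y) = valid a b m in u , v , w , m<n⇒m<1+n y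
    ; valid′ = λ b m → proj₁ (X.valid b m) , s≤s (proj₂ (X.valid b m))
    ; unique₁ = unique₁ ; unique₂ = unique₂ ; unique₃ = X.unique ; disjoint = X.disjoint ; bound = m≤n⇒m≤1+n bound
    ; count = X.count
    ; balance = trans balance (cong (sm threshold q +_) (sym (trans (cong (sm k p +_) e) (+-identityʳ _)))) }
    where
    open Scan s
    module X = Pool x
  -- No partner is free: all positions of `q` up to `k` are matched, so the bound is attained for
  -- the cut just behind `k`.
  ... | inj₂ e | x@(record { pool = [] }) = record
    { matched = matched ; pool = [] ; threshold = suc k
    ; valid = λ a b m → let (u , v , w , y) = valid a b m in u , v , w , m<n⇒m<1+n y
    ; valid′ = λ b () ; unique₁ = unique₁ ; unique₂ = unique₂ ; unique₃ = [] ; disjoint = λ b () ; bound = ≤-refl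
    ; count = Pool.count x
    ; balance = cong (_+ sm (suc k) p) (trans (sym (+-identityʳ _)) (Pool.count x)) }
    where open Scan s
  ... | inj₂ e | x@(record { pool = c ∷ cs ; unique = c∉ ∷ cs-unique }) = record
    { matched = (k , c) ∷ matched ; pool = cs ; threshold = threshold
    ; valid = λ { a b (here refl) → e , proj₁ (X.valid c (here refl)) , proj₂ (X.valid c (here refl)) , ≤-refl
                ; a b (there m) → let (u , v , w , y) = valid a b m in u , v , w , m<n⇒m<1+n y }
    ; valid′ = λ b m → proj₁ (X.valid b (there m)) , s≤s (proj₂ (X.valid b (there m)))
    ; unique₁ = All.tabulate (fresh₁ s) ∷ unique₁
    ; unique₂ = All.tabulate (λ { m refl → X.disjoint c (here refl) m }) ∷ unique₂
    ; unique₃ = cs-unique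
    ; disjoint = λ { b m (here refl) → All.lookup c∉ m refl ; b m (there m′) → X.disjoint b (there m) m′ }
    ; bound = m≤n⇒m≤1+n bound
    ; count = trans (sym (+-suc _ _)) X.count
    ; balance = trans (cong suc balance) (trans (sym (+-suc _ _))
      (cong (sm threshold q +_) (sym (trans (cong (sm k p +_) e) (+-comm (sm k p) 1))))) }
    where
    open Scan s
    module X = Pool x

  scan : ∀ k → Scan k
  scan zero = record
    { matched = [] ; pool = [] ; threshold = 0 ; valid = λ a b () ; valid′ = λ b
      () ; unique₁ = [] ; unique₂ = [] ; unique₃ = []
    ; disjoint = λ b () ; bound = z≤n ; count = refl ; balance = refl }
  scan (suc k) = next-scan k (scan k)

-- Rows of alternating pairs and columns of partitions

tl : List ℕ → List ℕ
tl [] = []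
tl (_ ∷ xs) = xs

part-tl : ∀ xs i → part (tl xs) i ≡ part xs (suc i)
part-tl [] i = refl
part-tl (_ ∷ xs) i = refl

row-2+ : ∀ t as as′ → row (suc (suc t)) (as , as′) ≡ row t (tl as , tl as′)
row-2+ t as as′ with ⌈ t /2⌉ | ⌊ t /2⌋ | halves t
... | _ | _ | even {i} = sym (part-tl as i)
... | _ | _ | odd {i} = sym (part-tl as′ i)

row-even : ∀ a as as′ → row (a + a) (as , as′) ≡ part as a
row-even zero as as′ = refl
row-even (suc a) as as′ = trans (cong (λ t → row (suc t) (as , as′)) (+-suc a a))
  (trans (row-2+ (a + a) as as′) (trans (row-even a (tl as) (tl as′)) (part-tl as a)))

row-odd : ∀ a as as′ → row (suc (a + a)) (as , as′) ≡ part as′ a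
row-odd zero as as′ = refl
row-odd (suc a) as as′ = trans (cong (λ t → row (suc (suc t)) (as , as′)) (+-suc a a))
  (trans (row-2+ (suc (a + a)) as as′) (trans (row-odd a (tl as) (tl as′)) (part-tl as′ a)))

data Parity : ℕ → Set where
  even : ∀ a → Parity (a + a)
  odd  : ∀ a → Parity (suc (a + a))

parity : ∀ r → Parity r
parity zero = even 0
parity (suc r) with parity r
... | even a = odd a
... | odd a = subst Parity (cong suc (+-suc a a)) (even (suc a))

row-rel : ∀ {R : ℕ → ℕ → Set} → R 0 0 → ∀ {A B} → Pointwise R (proj₁ A) (proj₁ B) → Pointwise R (proj₂ A) (proj₂ B)
  → ∀ r → R (row r A) (row r B)
row-rel {R} z {A} {B} p q r with parity r
... | even a = subst₂ R (sym (row-even a (proj₁ A) (proj₂ A))) (sym (row-even a (proj₁ B) (proj₂ B)))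
  (pointwise-part z p a)
... | odd a = subst₂ R (sym (row-odd a (proj₁ A) (proj₂ A))) (sym (row-odd a (proj₁ B) (proj₂ B)))
  (pointwise-part z q a)

row-desc : ∀ {A} → Desc₂ A → ∀ r → row (suc (suc r)) A ≤ row r A
row-desc {A} (d , d′) r with parity r
... | even a = subst₂ _≤_ (trans (sym (row-even (suc a) (proj₁ A) (proj₂ A)))
  (cong (λ t → row (suc t) A) (+-suc a a))) (sym (row-even a (proj₁ A) (proj₂ A))) (desc⇒isPartition d a)
... | odd a = subst₂ _≤_ (trans (sym (row-odd (suc a) (proj₁ A) (proj₂ A)))
  (cong (λ t → row (suc (suc t)) A) (+-suc a a))) (sym (row-odd a (proj₁ A) (proj₂ A))) (desc⇒isPartition d′ a)

pre-rows : ∀ t S → pre t S ≡ sm t (λ r → row r S)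
pre-rows zero S = refl
pre-rows (suc t) S = trans (pre-suc t S) (cong (_+ row t S) (pre-rows t S))

psum-all : ∀ p xs → length xs ≤ p → psum p xs ≡ sum xs
psum-all zero [] _ = refl
psum-all (suc p) [] _ = refl
psum-all (suc p) (x ∷ xs) (s≤s h) = cong (x +_) (psum-all p xs h)

size-rows : ∀ n S → length (proj₁ S) ≤ n → length (proj₂ S) ≤ n → size S ≡ sm (n + n) (λ r → row r S)
size-rows n S p q = trans (sym (cong₂ _+_
  (trans (cong (λ m → psum m (proj₁ S)) (sym (n≡⌈n+n/2⌉ n))) (psum-all n (proj₁ S) p))
  (trans (cong (λ m → psum m (proj₂ S)) (sym (n≡⌊n+n/2⌋ n))) (psum-all n (proj₂ S) q)))) (pre-rows (n + n) S)

sm-trim : ∀ n m g → m ≤ n → sm n (λ k → ⟦ k <? m ⟧ * g k) ≡ sm m g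
sm-trim zero zero g z≤n = refl
sm-trim (suc n) m g h with m ≟ suc n
... | yes refl = sm-cong (suc n) (λ i p → trans (cong (_* g i) (⟦⟧-yes (i <? suc n) p)) (+-identityʳ (g i)))
... | no ne = trans (cong₂ _+_ (sm-trim n m g (s≤s⁻¹ (≤∧≢⇒< h ne)))
  (cong (_* g n) (⟦⟧-no (n <? m) (λ p → ne (≤-antisym h p))))) (+-identityʳ _)

-- The parts of the conjugate partition.
col : List ℕ → ℕ → ℕ
col κ k = sm (length κ) (λ i → ⟦ k <? part κ i ⟧)

module _ {κ : List ℕ} (κ-desc : Desc κ) where

  col-iff : ∀ i k → (k < part κ i → i < col κ k) × (i < col κ k → k < part κ i)
  col-iff i k with i <? length κ
  ... | yes p = initial-segment (λ i → k <? part κ i) (length κ)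
    (λ {i} _ q → ≤-trans q (desc⇒isPartition κ-desc i)) i p
  ... | no ¬p = (λ q → ⊥-elim (n≮0 (subst (k <_) (part-beyond κ (≮⇒≥ ¬p)) q))) ,
                (λ q → ⊥-elim (¬p (≤-trans q (sm-≤ (length κ) (λ i → k <? part κ i)))))

  col-≤ : ∀ k → col κ k ≤ length κ
  col-≤ k = sm-≤ (length κ) (λ i → k <? part κ i)

  sm-columns : ∀ K → part κ 0 ≤ K → ∀ (g : ℕ → ℕ → ℕ) → sm K (λ k → sm (col κ k) (λ i → g i k)) ≡ sm (length κ)
    (λ i → sm (part κ i) (g i))
  sm-columns K K≥ g = begin
    sm K (λ k → sm (col κ k) (λ i → g i k))
      ≡⟨ sm-cong K (λ k _ → sym (sm-trim (length κ) (col κ k) (λ i → g i k) (col-≤ k))) ⟩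
    sm K (λ k → sm (length κ) (λ i → ⟦ i <? col κ k ⟧ * g i k))
      ≡⟨ sm-swap K (length κ) (λ k i → ⟦ i <? col κ k ⟧ * g i k) ⟩
    sm (length κ) (λ i → sm K (λ k → ⟦ i <? col κ k ⟧ * g i k))
      ≡⟨ sm-cong (length κ) (λ i _ → trans (sm-cong K
        (λ k _ → cong (_* g i k) (⟦⟧-cong (i <? col κ k) (k <? part κ i) (proj₂ (col-iff i k))
          (proj₁ (col-iff i k)))))
           (sm-trim K (part κ i) (g i) (≤-trans (isPartition⇒≤ κ (desc⇒isPartition κ-desc) z≤n) K≥))) ⟩
    sm (length κ) (λ i → sm (part κ i) (g i)) ∎
    where open ≡-Reasoning

tailSum : ℕ → (ℕ → ℕ) → ℕ → ℕ
tailSum K g k = sm (K ∸ k) (λ i → g (k + i))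

tailSum-step : ∀ K g k → k < K → tailSum K g k ≡ g k + tailSum K g (suc k)
tailSum-step K g k k<K = trans (cong (λ m → sm m (λ i → g (k + i))) (sym (suc-pred-∸ k<K)))
  (trans (sm-suc (K ∸ suc k) (λ i → g (k + i)))
    (cong₂ _+_ (cong g (+-identityʳ k)) (sm-cong (K ∸ suc k) (λ i _ → cong g (+-suc k i)))))
  where
  suc-pred-∸ : ∀ {k K} → k < K → suc (K ∸ suc k) ≡ K ∸ k
  suc-pred-∸ {k} {suc K} (s≤s p) = sym (+-∸-assoc 1 p)

tailSum-end : ∀ K g → tailSum K g K ≡ 0
tailSum-end K g = cong (λ m → sm m (λ i → g (K + i))) (n∸n≡0 K)

at-nth⁻ : ∀ {P : Shape → Shape → Shape → Set} j {u F} → At P j u F → P (nth u F (suc (suc j))) (nth u F (suc j))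
  (nth u F j)
at-nth⁻ zero {F = _ ∷ _ ∷ _} p = p
at-nth⁻ (suc j) {F = _ ∷ _} p = at-nth⁻ j p

at-nth⁺ : ∀ {P : Shape → Shape → Shape → Set} j {u F} → suc (suc j) ≤ length F → P (nth u F (suc (suc j)))
  (nth u F (suc j)) (nth u F j) → At P j u F
at-nth⁺ zero {F = _ ∷ _ ∷ _} _ p = p
at-nth⁺ zero {F = _ ∷ []} (s≤s ()) p
at-nth⁺ (suc j) {F = _ ∷ _} (s≤s h) p = at-nth⁺ j h p

at-length : ∀ {P : Shape → Shape → Shape → Set} j {u F} → At P j u F → suc (suc j) ≤ length F
at-length zero {F = _ ∷ _ ∷ _} _ = s≤s (s≤s z≤n)
at-length (suc j) {F = _ ∷ _} p = s≤s (at-length j p)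

-- Peelable tableaux against lattice chains of vertical strips

module Peel (top base : Shape) (w : List ℕ) (n : ℕ) (κ : List ℕ) (K : ℕ)
  (top-desc : Desc₂ top) (base-desc : Desc₂ base)
  (base≤₁ : Pointwise _≤_ (proj₁ base) (proj₁ top)) (base≤₂ : Pointwise _≤_ (proj₂ base) (proj₂ top))
  (ℓ₁≤n : length (proj₁ top) ≤ n) (ℓ₂≤n : length (proj₂ top) ≤ n)
  (w-length : length w ≡ n + n) (w-part : ∀ r → part w r ≡ row r top ∸ row r base)
  (κ-desc : Desc κ) (κ≤K : part κ 0 ≤ K) where

  open Tableaux κ [] w
  private
    module N = VChains top (λ _ → 0)
    ℓ₁ = length (proj₁ top)
    ℓ₂ = length (proj₂ top)
    W = n + n
    q = col κ

  base≤top : ∀ r → row r base ≤ row r top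
  base≤top = row-rel {_≤_} ≤-refl base≤₁ base≤₂

  column-In : ∀ {i k} → i < q k → In i k
  column-In {i} {k} p = ≤-trans p (col-≤ κ-desc k) , z≤n , proj₂ (col-iff κ-desc i k) p

  In-column : ∀ {i k} → In i k → i < q k
  In-column {i} {k} (_ , _ , p) = proj₁ (col-iff κ-desc i k) p

  In-K : ∀ {i k} → In i k → k < K
  In-K {i} (_ , _ , p) = ≤-trans p (≤-trans (isPartition⇒≤ κ (desc⇒isPartition κ-desc) z≤n) κ≤K)

  -- Occurrences of the entry r+1 in column k, the height of the entries ≤ r in column k, and
  -- row r of the shape obtained by placing a square for every r+1 in a column ≥ k.
  occ height : (ℕ → ℕ → ℕ) → ℕ → ℕ → ℕ
  occ f r k = sm (q k) (λ i → ⟦ f i k ≟ suc r ⟧)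
  height f r k = sm (q k) (λ i → ⟦ f i k ≤? r ⟧)

  shapeRow : (ℕ → ℕ → ℕ) → ℕ → ℕ → ℕ
  shapeRow f k r = row r base + tailSum K (occ f r) k

  shape : (ℕ → ℕ → ℕ) → ℕ → Shape
  shape f k = applyUpTo (λ a → shapeRow f k (a + a)) ℓ₁ , applyUpTo (λ a → shapeRow f k (suc (a + a))) ℓ₂

  -- Rows `r` and `r + 2` are consecutive rows of the same component, so this asks that every
  -- `shape f k` be a pair of partitions.
  Peelable : (ℕ → ℕ → ℕ) → Set
  Peelable f = ∀ r k → k ≤ K → shapeRow f k (suc (suc r)) ≤ shapeRow f k r

  β : List ℕ
  β = applyUpTo q K

  β-length : length β ≡ K
  β-length = List.length-applyUpTo q K

  -- Column `k` of the tableau becomes letter `k` of the chain, with a square in row `r` for each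
  -- `r + 1` in the column. Column lengths become the content, strictness down the columns makes the
  -- strips vertical, weak increase along the rows becomes the lattice condition, and peelability
  -- makes the shapes partitions.
  tableau→vchain : (ℕ → ℕ → ℕ) → List Shape
  tableau→vchain f = applyUpTo (shape f ∘ suc) (length β)

  height-suc : ∀ f r k → height f (suc r) k ≡ occ f r k + height f r k
  height-suc f r k = trans (sm-cong (q k) (λ i _ → ⟦≤-suc⟧ (f i k) r))
    (sm-+ (q k) (λ i → ⟦ f i k ≟ suc r ⟧) (λ i → ⟦ f i k ≤? r ⟧))

  sum-occ : ∀ f r → tailSum K (occ f r) 0 ≡ sm (length κ) (λ i → sm (part κ i) (λ k → ⟦ f i k ≟ suc r ⟧))
  sum-occ f r = sm-columns κ-desc K κ≤K (λ i k → ⟦ f i k ≟ suc r ⟧)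

  shapeRow-step : ∀ f k r → k < K → shapeRow f k r ≡ occ f r k + shapeRow f (suc k) r
  shapeRow-step f k r k<K = trans (cong (row r base +_) (tailSum-step K (occ f r) k k<K))
    (x∙yz≈y∙xz (row r base) (occ f r k) (tailSum K (occ f r) (suc k)))

  shapeRow-K : ∀ f r → shapeRow f K r ≡ row r base
  shapeRow-K f r = trans (cong (row r base +_) (tailSum-end K (occ f r))) (+-identityʳ _)

  module Forward {f : ℕ → ℕ → ℕ} (t : Tableau f) where
    open Tableau t

    height-iff : ∀ r {i k} → i < q k → (f i k ≤ r → i < height f r k) × (i < height f r k → f i k ≤ r)
    height-iff r {i} {k} i< = initial-segment (λ i → f i k ≤? r) (q k)
      (λ {i} si< p → ≤-trans (<⇒≤ (columns (column-In (<⇒≤ si<)) (column-In si<) (n<1+n i))) p) i i<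

    height-≤ : ∀ r k → height f r k ≤ q k
    height-≤ r k = sm-≤ (q k) (λ i → f i k ≤? r)

    occ-≤1 : ∀ r k → occ f r k ≤ 1
    occ-≤1 r k = +-cancelʳ-≤ (height f r k) (occ f r k) 1 (≤-trans (≤-reflexive (sym (height-suc f r k))) (≮⇒≥ λ lt →
      let h = height f r k
          sh< : suc h < q k
          sh< = ≤-trans lt (height-≤ (suc r) k)
          f≤ : f (suc h) k ≤ suc r
          f≤ = proj₂ (height-iff (suc r) sh<) lt
          f> : f h k < f (suc h) k
          f> = columns (column-In (<⇒≤ sh<)) (column-In sh<) (n<1+n h)
      in <-irrefl refl (proj₁ (height-iff r (<⇒≤ sh<)) (s≤s⁻¹ (≤-trans f> f≤)))))

    height-columns : ∀ r k → height f r (suc k) ≤ height f r k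
    height-columns r k = ≮⇒≥ λ lt →
      let h = height f r k
          h<ₛ : h < q (suc k)
          h<ₛ = ≤-trans lt (height-≤ r (suc k))
          h< : h < q k
          h< = proj₁ (col-iff κ-desc h k) (<⇒≤ (proj₂ (col-iff κ-desc h (suc k)) h<ₛ))
      in <-irrefl refl (proj₁ (height-iff r h<)
        (≤-trans (rows (column-In h<) (column-In h<ₛ) (n<1+n k)) (proj₂ (height-iff r h<ₛ) lt)))

    height-0 : ∀ k → height f 0 k ≡ 0
    height-0 k = sm-zero (q k) (λ i i< → ⟦⟧-no (f i k ≤? 0) (λ p → 1+n≰n (≤-trans (proj₁ (bounds (column-In i<))) p)))

    height-W : ∀ k → height f W k ≡ q k
    height-W k = sm-all (q k) (λ i → f i k ≤? W) (λ i i< → subst (f i k ≤_) w-length (proj₂ (bounds (column-In i<))))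

    sum-occ-rows : ∀ t k → sm t (λ r → occ f r k) ≡ height f t k
    sum-occ-rows zero k = sym (height-0 k)
    sum-occ-rows (suc t) k = trans (cong (_+ occ f t k) (sum-occ-rows t k))
      (trans (+-comm (height f t k) (occ f t k)) (sym (height-suc f t k)))

    occ-total : ∀ r → tailSum K (occ f r) 0 ≡ part w r
    occ-total r with r <? length w
    ... | yes r< = trans (sum-occ f r) (contents r r<)
    ... | no ¬r< = trans (trans (sum-occ f r) (sm-zero (length κ) (λ i i< → sm-zero (part κ i) (λ k k< →
        ⟦⟧-no (f i k ≟ suc r) (λ e → ¬r< (≤-trans (≤-reflexive (sym e)) (proj₂ (bounds (i< , z≤n , k<)))))))))
      (sym (part-beyond w (≮⇒≥ ¬r<)))

    shapeRow-0 : ∀ r → shapeRow f 0 r ≡ row r top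
    shapeRow-0 r = trans (cong (row r base +_) (trans (occ-total r) (w-part r))) (m+[n∸m]≡n (base≤top r))

    shapeRow-≤ : ∀ k r → k ≤ K → shapeRow f k r ≤ row r top
    shapeRow-≤ zero r _ = ≤-reflexive (shapeRow-0 r)
    shapeRow-≤ (suc k) r k<K = ≤-trans (≤-trans (m≤n+m _ (occ f r k)) (≤-reflexive (sym (shapeRow-step f k r k<K))))
      (shapeRow-≤ k r (<⇒≤ k<K))

    row-shape : ∀ k r → k ≤ K → row r (shape f k) ≡ shapeRow f k r
    row-shape k r k≤ with parity r
    ... | even a = trans (row-even a (proj₁ (shape f k)) (proj₂ (shape f k))) (go (a <? ℓ₁))
      where
      go : Dec (a < ℓ₁) → part (proj₁ (shape f k)) a ≡ shapeRow f k (a + a)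
      go (yes p) = part-applyUpTo ℓ₁ (λ a → shapeRow f k (a + a)) p
      go (no ¬p) = trans (part-beyond (proj₁ (shape f k))
        (≤-trans (≤-reflexive (List.length-applyUpTo _ ℓ₁)) (≮⇒≥ ¬p)))
        (sym (n≤0⇒n≡0 (≤-trans (shapeRow-≤ k (a + a) k≤)
          (≤-reflexive (trans (row-even a (proj₁ top) (proj₂ top)) (part-beyond (proj₁ top) (≮⇒≥ ¬p)))))))
    ... | odd a = trans (row-odd a (proj₁ (shape f k)) (proj₂ (shape f k))) (go (a <? ℓ₂))
      where
      go : Dec (a < ℓ₂) → part (proj₂ (shape f k)) a ≡ shapeRow f k (suc (a + a))
      go (yes p) = part-applyUpTo ℓ₂ (λ a → shapeRow f k (suc (a + a))) p
      go (no ¬p) = trans (part-beyond (proj₂ (shape f k))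
        (≤-trans (≤-reflexive (List.length-applyUpTo _ ℓ₂)) (≮⇒≥ ¬p)))
        (sym (n≤0⇒n≡0 (≤-trans (shapeRow-≤ k (suc (a + a)) k≤)
          (≤-reflexive (trans (row-odd a (proj₁ top) (proj₂ top)) (part-beyond (proj₂ top) (≮⇒≥ ¬p)))))))

    -- The occurrences of 1, ..., t in a column add up to its height. Hence the lattice condition
    -- after `t` rows compares the heights of adjacent columns of the subtableau of entries at most
    -- `t`.
    pre-shape-step : ∀ k t → k < K → pre t (shape f k) ≡ height f t k + pre t (shape f (suc k))
    pre-shape-step k t k<K = trans (pre-rows t (shape f k)) (trans (sm-cong t (λ r _ →
        trans (row-shape k r (<⇒≤ k<K)) (trans (shapeRow-step f k r k<K)
          (cong (occ f r k +_) (sym (row-shape (suc k) r k<K))))))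
      (trans (sm-+ t (λ r → occ f r k) (λ r → row r (shape f (suc k))))
        (cong₂ _+_ (sum-occ-rows t k) (sym (pre-rows t (shape f (suc k)))))))

    shape-length₁ : ∀ k → length (proj₁ (shape f k)) ≤ n
    shape-length₁ k = ≤-trans (≤-reflexive (List.length-applyUpTo _ ℓ₁)) ℓ₁≤n

    shape-length₂ : ∀ k → length (proj₂ (shape f k)) ≤ n
    shape-length₂ k = ≤-trans (≤-reflexive (List.length-applyUpTo _ ℓ₂)) ℓ₂≤n

    shape-size : ∀ k → k < K → size (shape f k) ≡ q k + size (shape f (suc k))
    shape-size k k<K = trans (size-rows n (shape f k) (shape-length₁ k) (shape-length₂ k))
      (trans (sym (pre-rows W (shape f k)))
      (trans (pre-shape-step k W k<K) (cong₂ _+_ (height-W k)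
        (trans (pre-rows W (shape f (suc k)))
          (sym (size-rows n (shape f (suc k)) (shape-length₁ (suc k)) (shape-length₂ (suc k))))))))

    shape-0 : shape f 0 ≡ top
    shape-0 = cong₂ _,_
      (trans (applyUpTo-cong ℓ₁ (λ a _ → trans (shapeRow-0 (a + a)) (row-even a (proj₁ top) (proj₂ top))))
        (applyUpTo-part (proj₁ top)))
      (trans (applyUpTo-cong ℓ₂ (λ a _ → trans (shapeRow-0 (suc (a + a))) (row-odd a (proj₁ top) (proj₂ top))))
        (applyUpTo-part (proj₂ top)))

    shape-K : shape f K ≡ base
    shape-K = cong₂ _,_
      (trans (applyUpTo-cong ℓ₁ (λ a _ → trans (shapeRow-K f (a + a)) (row-even a (proj₁ base) (proj₂ base))))
        (trans (cong (applyUpTo (part (proj₁ base))) (sym (PW.Pointwise-length base≤₁)))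
          (applyUpTo-part (proj₁ base))))
      (trans (applyUpTo-cong ℓ₂ (λ a _ → trans (shapeRow-K f (suc (a + a))) (row-odd a (proj₁ base) (proj₂ base))))
        (trans (cong (applyUpTo (part (proj₂ base))) (sym (PW.Pointwise-length base≤₂)))
          (applyUpTo-part (proj₂ base))))

    module _ (peelable : Peelable f) where

      shape-∈ : ∀ k → k ≤ K → shape f k ∈ N.U
      shape-∈ k k≤ = N.inside⇒∈U ((subst (Pointwise _≤_ (proj₁ (shape f k))) (applyUpTo-part (proj₁ top))
            (applyUpTo-pointwise ℓ₁ (λ a _ → ≤-trans (shapeRow-≤ k (a + a) k≤)
              (≤-reflexive (row-even a (proj₁ top) (proj₂ top))))) ,
          subst (Pointwise _≤_ (proj₂ (shape f k))) (applyUpTo-part (proj₂ top))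
            (applyUpTo-pointwise ℓ₂ (λ a _ → ≤-trans (shapeRow-≤ k (suc (a + a)) k≤)
              (≤-reflexive (row-odd a (proj₁ top) (proj₂ top)))))) ,
        (applyUpTo-desc ℓ₁ (λ a _ → subst (λ m → shapeRow f k (suc m) ≤ shapeRow f k (a + a)) (sym (+-suc a a))
          (peelable (a + a) k k≤)) ,
         applyUpTo-desc ℓ₂ (λ a _ → subst (λ m → shapeRow f k (suc (suc m)) ≤ shapeRow f k (suc (a + a)))
           (sym (+-suc a a)) (peelable (suc (a + a)) k k≤))))

      shape-vstrip : ∀ k → k < K → VStrip₂ (shape f (suc k)) (shape f k)
      shape-vstrip k k<K = applyUpTo-pointwise ℓ₁ (λ a _ → step (a + a)) , applyUpTo-pointwise ℓ₂
        (λ a _ → step (suc (a + a)))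
        where
        step : ∀ r → Step (shapeRow f (suc k) r) (shapeRow f k r)
        step r = ≤-trans (m≤n+m _ (occ f r k)) (≤-reflexive (sym (shapeRow-step f k r k<K))) ,
          ≤-trans (≤-reflexive (shapeRow-step f k r k<K)) (+-monoˡ-≤ (shapeRow f (suc k) r) (occ-≤1 r k))

      vchain : N.IsChain top β (tableau→vchain f) base
      vchain = subst₂ (λ u t → N.IsChain u β (tableau→vchain f) t) shape-0 (trans (cong (shape f) β-length) shape-K)
        (N.steps-chain (shape f) β (λ k k< → let k<K = subst (k <_) β-length k< in
          shape-∈ (suc k) k<K , λ e → shape-vstrip k k<K ,
          trans (+-identityʳ _) (trans (shape-size k k<K)
            (cong (_+ size (shape f (suc k))) (sym (part-applyUpTo K q k<K))))))

      nth-shape : ∀ k → k ≤ K → nth top (tableau→vchain f) k ≡ shape f k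
      nth-shape k k≤ = trans (cong (λ u → nth u (tableau→vchain f) k) (sym shape-0))
        (nth-applyUpTo (shape f) (length β) (subst (k ≤_) (sym β-length) k≤))

      lattice : ∀ T J → NoExcess (codes T J) top (tableau→vchain f)
      lattice T J = All.tabulate (λ {c} _ e → no-excess (proj₁ c) (proj₂ c) e)
        where
        no-excess : ∀ t j → ¬ At (Excess t) j top (tableau→vchain f)
        no-excess t j e = <⇒≱ ex (begin
          pre t B + pre t B                          ≡⟨ cong (pre t B +_) (pre-shape-step (suc j) t j<K) ⟩
          pre t B + (height f t (suc j) + pre t A)   ≤⟨ +-monoʳ-≤ (pre t B)
            (+-monoˡ-≤ (pre t A) (height-columns t j)) ⟩
          pre t B + (height f t j + pre t A)         ≡⟨ x∙yz≈z∙yx (pre t B) (height f t j) (pre t A) ⟩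
          pre t A + (height f t j + pre t B)         ≡⟨ cong (pre t A +_) (sym (pre-shape-step j t (<⇒≤ j<K))) ⟩
          pre t A + pre t C                          ∎)
          where
          open ≤-Reasoning
          A = shape f (suc (suc j))
          B = shape f (suc j)
          C = shape f j
          j<K : suc j < K
          j<K = ≤-trans (at-length j e) (≤-reflexive (trans (List.length-applyUpTo _ (length β)) β-length))
          ex : Excess t A B C
          ex = subst₂ (λ A BC → Excess t A (proj₁ BC) (proj₂ BC)) (nth-shape (suc (suc j)) j<K)
            (cong₂ _,_ (nth-shape (suc j) (<⇒≤ j<K)) (nth-shape j (<⇒≤ (<⇒≤ j<K)))) (at-nth⁻ j e)

  row-beyond : ∀ {r} → W ≤ r → row r top ≡ 0
  row-beyond {r} W≤ with parity r
  ... | even a = trans (row-even a (proj₁ top) (proj₂ top))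
    (part-beyond (proj₁ top) (≤-trans ℓ₁≤n (≮⇒≥ (λ a<n → <⇒≱ (+-mono-< a<n a<n) W≤))))
  ... | odd a = trans (row-odd a (proj₁ top) (proj₂ top))
    (part-beyond (proj₂ top) (≤-trans ℓ₂≤n (≮⇒≥
      (λ a<n → <⇒≱ (subst (_≤ n + n) (cong suc (+-suc a a)) (+-mono-≤ a<n a<n)) W≤))))

  vheight : List Shape → ℕ → ℕ → ℕ
  vheight F r k = pre r (nth top F k) ∸ pre r (nth top F (suc k))

  -- The least `r` with `i < vheight F r k`, again found by counting the smaller ones.
  ventry : List Shape → ℕ → ℕ → ℕ
  ventry F i k = sm (suc W) (λ r → ⟦ vheight F r k ≤? i ⟧)

  occ-cong : ∀ {f g} → (∀ {i k} → In i k → f i k ≡ g i k) → ∀ r k → occ f r k ≡ occ g r k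
  occ-cong e r k = sm-cong (q k) (λ i i< → cong (λ x → ⟦ x ≟ suc r ⟧) (e (column-In i<)))

  shapeRow-cong : ∀ {f g} → (∀ {i k} → In i k → f i k ≡ g i k) → ∀ k r → shapeRow f k r ≡ shapeRow g k r
  shapeRow-cong {f} {g} e k r = cong (row r base +_) (sm-cong (K ∸ k) (λ i _ → occ-cong {f} {g} e r (k + i)))

  -- `K = suc J` letters form `J` adjacent pairs, and `suc W` admits the prefix of all `W` rows, so
  -- the codes cover the whole lattice condition.
  module Backward {J : ℕ} (K≡ : K ≡ suc J) {F : List Shape} (ch : N.IsChain top β F base)
    (lat : NoExcess (codes (suc W) J) top F) where

    S : ℕ → Shape
    S = nth top F

    f : ℕ → ℕ → ℕ
    f = ventry F

    G : ℕ → ℕ → ℕ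
    G = vheight F

    S-step : ∀ k → k < K → VStrip₂ (S (suc k)) (S k) × size (S k) ≡ q k + size (S (suc k))
    S-step k k<K with N.chain-step ch k (subst (k <_) (sym β-length) k<K)
    ... | _ , _ , v , e = v , trans (sym (+-identityʳ _))
      (trans e (cong (_+ size (S (suc k))) (part-applyUpTo K q k<K)))

    S-inside : ∀ k → k ≤ K → N.Inside (S k)
    S-inside zero _ = (PW.refl ≤-refl , PW.refl ≤-refl) , top-desc
    S-inside (suc k) k<K = N.∈U⇒inside (proj₁ (N.chain-step ch k (subst (k <_) (sym β-length) k<K)))

    S-K : S K ≡ base
    S-K = trans (cong S (sym β-length)) (N.chain-end ch)

    row-step : ∀ k r → k < K → Step (row r (S (suc k))) (row r (S k))
    row-step k r k<K with S-step k k<K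
    ... | (v , v′) , _ = row-rel {Step} (z≤n , z≤n) v v′ r

    row-≤top : ∀ k r → k ≤ K → row r (S k) ≤ row r top
    row-≤top k r k≤ with S-inside k k≤
    ... | (p , p′) , _ = row-rel {_≤_} ≤-refl p p′ r

    G-eq : ∀ r k → k < K → pre r (S k) ≡ G r k + pre r (S (suc k))
    G-eq r k k<K = sym (m∸n+n≡m (subst₂ _≤_ (sym (pre-rows r (S (suc k)))) (sym (pre-rows r (S k)))
      (sm-mono r (λ i _ → proj₁ (row-step k i k<K)))))

    G-suc : ∀ r k → k < K → G (suc r) k + row r (S (suc k)) ≡ row r (S k) + G r k
    G-suc r k k<K = +-cancelʳ-≡ (pre r (S (suc k))) _ _ (begin
      G (suc r) k + row r (S (suc k)) + pre r (S (suc k)) ≡⟨ l₁ (G (suc r) k) (row r (S (suc k)))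
        (pre r (S (suc k))) ⟩
      G (suc r) k + (pre r (S (suc k)) + row r (S (suc k))) ≡⟨ cong (G (suc r) k +_) (sym (pre-suc r (S (suc k)))) ⟩
      G (suc r) k + pre (suc r) (S (suc k))               ≡⟨ sym (G-eq (suc r) k k<K) ⟩
      pre (suc r) (S k)                                   ≡⟨ pre-suc r (S k) ⟩
      pre r (S k) + row r (S k)                           ≡⟨ cong (_+ row r (S k)) (G-eq r k k<K) ⟩
      G r k + pre r (S (suc k)) + row r (S k)             ≡⟨ l₂ (G r k) (pre r (S (suc k))) (row r (S k)) ⟩
      row r (S k) + G r k + pre r (S (suc k))             ∎)
      where
      open ≡-Reasoning
      l₁ : ∀ a b c → a + b + c ≡ a + (c + b)
      l₁ = solve-∀
      l₂ : ∀ a b c → a + b + c ≡ c + a + b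
      l₂ = solve-∀

    G-mono : ∀ r k → k < K → G r k ≤ G (suc r) k
    G-mono r k k<K = +-cancelʳ-≤ (row r (S (suc k))) (G r k) (G (suc r) k)
      (≤-trans (+-monoʳ-≤ (G r k) (proj₁ (row-step k r k<K)))
      (≤-reflexive (trans (+-comm (G r k) (row r (S k))) (sym (G-suc r k k<K)))))

    G-suc-≤ : ∀ r k → k < K → G (suc r) k ≤ suc (G r k)
    G-suc-≤ r k k<K = +-cancelʳ-≤ (row r (S (suc k))) (G (suc r) k) (suc (G r k))
      (≤-trans (≤-reflexive (G-suc r k k<K))
      (≤-trans (+-monoˡ-≤ (G r k) (proj₂ (row-step k r k<K)))
        (≤-reflexive (cong suc (+-comm (row r (S (suc k))) (G r k))))))

    S-length : ∀ k → k ≤ K → length (proj₁ (S k)) ≡ ℓ₁ × length (proj₂ (S k)) ≡ ℓ₂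
    S-length k k≤ with S-inside k k≤
    ... | (p , p′) , _ = PW.Pointwise-length p , PW.Pointwise-length p′

    pre-W : ∀ k → k ≤ K → pre W (S k) ≡ size (S k)
    pre-W k k≤ = trans (pre-rows W (S k)) (sym (size-rows n (S k)
      (subst (_≤ n) (sym (proj₁ (S-length k k≤))) ℓ₁≤n) (subst (_≤ n) (sym (proj₂ (S-length k k≤))) ℓ₂≤n)))

    G-W : ∀ k → k < K → G W k ≡ q k
    G-W k k<K = +-cancelʳ-≡ (size (S (suc k))) _ _ (trans (cong (G W k +_) (sym (pre-W (suc k) k<K)))
      (trans (sym (G-eq W k k<K)) (trans (pre-W k (<⇒≤ k<K)) (proj₂ (S-step k k<K)))))

    G-≤q : ∀ r k → k < K → r ≤ W → G r k ≤ q k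
    G-≤q r k k<K r≤ = ≤-trans (mono W r≤) (≤-reflexive (G-W k k<K))
      where
      mono : ∀ t → r ≤ t → G r k ≤ G t k
      mono t r≤t with r ≟ t
      mono t r≤t | yes refl = ≤-refl
      mono zero z≤n | no ne = ⊥-elim (ne refl)
      mono (suc t) r≤t | no ne = ≤-trans (mono t (s≤s⁻¹ (≤∧≢⇒< r≤t ne))) (G-mono t k k<K)

    F-length : length F ≡ K
    F-length = trans (trans (cong length (N.chain-nth ch)) (List.length-applyUpTo _ (length β))) β-length

    -- The absence of an excess of letter `k + 1` over letter `k` after `r` rows, rewritten with
    -- `G-eq` for both strips.
    G-column : ∀ r k → suc k < K → r ≤ W → G r (suc k) ≤ G r k
    G-column r k sk<K r≤ = +-cancelʳ-≤ (pre r A) (G r (suc k)) (G r k) (+-cancelˡ-≤ (pre r B) _ _ (begin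
      pre r B + (G r (suc k) + pre r A)  ≡⟨ cong (pre r B +_) (sym (G-eq r (suc k) sk<K)) ⟩
      pre r B + pre r B                  ≤⟨ ≮⇒≥
        (λ ex → All.lookup lat (codes-∈ (suc W) (s≤s r≤) (s≤s⁻¹ (subst (suc k <_) K≡ sk<K)))
                                              (at-nth⁺ {Excess r} k
                                                (subst (suc (suc k) ≤_) (sym F-length) sk<K) ex)) ⟩
      pre r A + pre r C                  ≡⟨ cong (pre r A +_) (G-eq r k (<⇒≤ sk<K)) ⟩
      pre r A + (G r k + pre r B)        ≡⟨ x∙yz≈z∙yx (pre r A) (G r k) (pre r B) ⟩
      pre r B + (G r k + pre r A)        ∎))
      where
      open ≤-Reasoning
      A = S (suc (suc k))
      B = S (suc k)
      C = S k

    G-columns : ∀ r k k′ → k ≤ k′ → k′ < K → r ≤ W → G r k′ ≤ G r k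
    G-columns r k k′ k≤ k′< r≤ with k ≟ k′
    G-columns r k k′ k≤ k′< r≤ | yes refl = ≤-refl
    G-columns r k zero z≤n k′< r≤ | no ne = ⊥-elim (ne refl)
    G-columns r k (suc k′) k≤ k′< r≤ | no ne = ≤-trans (G-column r k′ k′< r≤)
      (G-columns r k k′ (s≤s⁻¹ (≤∧≢⇒< k≤ ne)) (<⇒≤ k′<) r≤)

    f-iff : ∀ r i k → k < K → r ≤ W → (i < G r k → f i k ≤ r) × (f i k ≤ r → i < G r k)
    f-iff r i k k<K r≤ = (λ p → ≮⇒≥ (λ lt → <⇒≱ p (proj₂ seg lt))) , (λ p → ≰⇒> (λ le → <⇒≱ (proj₁ seg le) p))
      where
      seg = initial-segment (λ r → G r k ≤? i) (suc W) (λ {r} _ p → ≤-trans (G-mono r k k<K) p) r (s≤s r≤)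

    f-≤W : ∀ {i k} → In i k → f i k ≤ W
    f-≤W {i} {k} p = proj₁ (f-iff W i k (In-K p) ≤-refl) (subst (i <_) (sym (G-W k (In-K p))) (In-column p))

    f-≥1 : ∀ {i k} → In i k → 1 ≤ f i k
    f-≥1 {i} {k} p = ≰⇒> (λ le → n≮0 (proj₂ (f-iff 0 i k (In-K p) z≤n) le))

    -- The height of a column grows by at most one from `r` to `r + 1`, so no two of its cells
    -- receive the same entry.
    f-columns : ∀ {i i′ k} → In i k → In i′ k → i < i′ → f i k < f i′ k
    f-columns {i} {i′} {k} p p′ i<i′ with f i k in eq | f-≥1 p | f-≤W p
    ... | suc r | _ | r<W = ≰⇒> λ le → 1+n≰n (subst (_≤ r) eq (proj₁ (f-iff r i k (In-K p) (<⇒≤ r<W))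
      (s≤s⁻¹ (≤-trans (s≤s i<i′) (≤-trans (proj₂ (f-iff (suc r) i′ k (In-K p) r<W) le) (G-suc-≤ r k (In-K p)))))))

    height-G : ∀ r k → k < K → r ≤ W → height f r k ≡ G r k
    height-G r k k<K r≤ = trans (sm-cong (q k)
      (λ i _ → ⟦⟧-cong (f i k ≤? r) (i <? G r k) (proj₂ (f-iff r i k k<K r≤)) (proj₁ (f-iff r i k k<K r≤))))
      (sm-below (q k) (G-≤q r k k<K r≤))

    occ-row : ∀ r k → k < K → r < W → occ f r k + row r (S (suc k)) ≡ row r (S k)
    occ-row r k k<K r<W = +-cancelʳ-≡ (G r k) _ _ (begin
      occ f r k + row r (S (suc k)) + G r k  ≡⟨ l (occ f r k) (row r (S (suc k))) (G r k) ⟩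
      occ f r k + G r k + row r (S (suc k))  ≡⟨ cong (λ g → occ f r k + g + row r (S (suc k)))
        (sym (height-G r k k<K (<⇒≤ r<W))) ⟩
      occ f r k + height f r k + row r (S (suc k)) ≡⟨ cong (_+ row r (S (suc k)))
        (trans (sym (height-suc f r k)) (height-G (suc r) k k<K r<W)) ⟩
      G (suc r) k + row r (S (suc k))        ≡⟨ G-suc r k k<K ⟩
      row r (S k) + G r k                    ∎)
      where
      open ≡-Reasoning
      l : ∀ a b c → a + b + c ≡ a + c + b
      l = solve-∀

    -- Induction from the inner end of the chain, where both sides are the row of `base`; `d` is the
    -- number of remaining steps.
    shapeRow-S< : ∀ d k r → k + d ≡ K → r < W → shapeRow f k r ≡ row r (S k)
    shapeRow-S< zero k r e r<W rewrite trans (sym (+-identityʳ k)) e = trans (shapeRow-K f r) (cong (row r) (sym S-K))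
    shapeRow-S< (suc d) k r e r<W = trans (shapeRow-step f k r k<K)
      (trans (cong (occ f r k +_) (shapeRow-S< d (suc k) r (trans (sym (+-suc k d)) e) r<W)) (occ-row r k k<K r<W))
      where
      k<K : k < K
      k<K = subst (k <_) e (m<m+n k (s≤s z≤n))

    vchain-tableau : Tableau f
    vchain-tableau = record
      { bounds = λ {i} {k} p → f-≥1 p , subst (f i k ≤_) (sym w-length) (f-≤W p)
      ; rows = λ {i} {k} {k′} p p′ k<k′ → proj₁ (f-iff (f i k′) i k (In-K p) (f-≤W p′))
          (≤-trans (proj₂ (f-iff (f i k′) i k′ (In-K p′) (f-≤W p′)) ≤-refl)
            (G-columns (f i k′) k k′ (<⇒≤ k<k′) (In-K p′) (f-≤W p′)))
      ; columns = f-columns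
      ; contents = λ r r< → trans (sym (sum-occ f r)) (trans (sym (m+n∸m≡n (row r base) _))
          (trans (cong (_∸ row r base) (shapeRow-S< K 0 r refl (subst (r <_) w-length r<))) (sym (w-part r))))
      }

    private module T = Forward vchain-tableau

    shapeRow-S : ∀ k r → k ≤ K → shapeRow f k r ≡ row r (S k)
    shapeRow-S k r k≤ with r <? W
    ... | yes r<W = shapeRow-S< (K ∸ k) k r (m+[n∸m]≡n k≤) r<W
    ... | no ¬r<W = trans (n≤0⇒n≡0 (subst (shapeRow f k r ≤_) (row-beyond (≮⇒≥ ¬r<W)) (T.shapeRow-≤ k r k≤)))
      (sym (n≤0⇒n≡0 (subst (row r (S k) ≤_) (row-beyond (≮⇒≥ ¬r<W)) (row-≤top k r k≤))))

    vchain-peelable : Peelable f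
    vchain-peelable r k k≤ = subst₂ _≤_ (sym (shapeRow-S k (suc (suc r)) k≤)) (sym (shapeRow-S k r k≤))
      (row-desc (proj₂ (S-inside k k≤)) r)

    shape-S : ∀ {g} → (∀ {i k} → In i k → g i k ≡ f i k) → ∀ k → k ≤ K → shape g k ≡ S k
    shape-S {g} e k k≤ = cong₂ _,_
      (trans (applyUpTo-cong ℓ₁ (λ a _ → trans (shapeRow-cong {g} {f} e k (a + a))
        (trans (shapeRow-S k (a + a) k≤) (row-even a (proj₁ (S k)) (proj₂ (S k))))))
        (trans (cong (applyUpTo (part (proj₁ (S k)))) (sym (proj₁ (S-length k k≤)))) (applyUpTo-part (proj₁ (S k)))))
      (trans (applyUpTo-cong ℓ₂ (λ a _ → trans (shapeRow-cong {g} {f} e k (suc (a + a)))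
        (trans (shapeRow-S k (suc (a + a)) k≤) (row-odd a (proj₁ (S k)) (proj₂ (S k))))))
        (trans (cong (applyUpTo (part (proj₂ (S k)))) (sym (proj₂ (S-length k k≤)))) (applyUpTo-part (proj₂ (S k)))))

    vchain-recovered : ∀ {g} → (∀ {i k} → In i k → g i k ≡ f i k) → tableau→vchain g ≡ F
    vchain-recovered e = trans (applyUpTo-cong (length β) (λ k k< → shape-S e (suc k) (subst (k <_) β-length k<)))
      (sym (N.chain-nth ch))

  ventry-recovered : ∀ {f} → Tableau f → Peelable f → ∀ {i k} → In i k → ventry (tableau→vchain f) i k ≡ f i k
  ventry-recovered {f} t p {i} {k} ik = trans (sm-cong (suc W) (λ r _ → trans (cong (λ h → ⟦ h ≤? i ⟧) (height≡ r))
      (⟦⟧-cong (height f r k ≤? i) (r <? f i k)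
        (λ le → ≰⇒> (λ f≤ → <⇒≱ (proj₁ (T.height-iff r (In-column ik)) f≤) le))
        (λ lt → ≮⇒≥ (λ i< → <⇒≱ lt (proj₂ (T.height-iff r (In-column ik)) i<))))))
    (sm-below (suc W) (m≤n⇒m≤1+n (subst (f i k ≤_) w-length (proj₂ (Tableau.bounds t ik)))))
    where
    module T = Forward t
    height≡ : ∀ r → vheight (tableau→vchain f) r k ≡ height f r k
    height≡ r = trans (cong₂ (λ A B → pre r A ∸ pre r B) (T.nth-shape p k (<⇒≤ (In-K ik)))
      (T.nth-shape p (suc k) (In-K ik)))
      (trans (cong (_∸ pre r (shape f (suc k))) (T.pre-shape-step k r (In-K ik)))
        (m+n∸n≡m (height f r k) (pre r (shape f (suc k)))))

  peelable-count : ∀ {J} → K ≡ suc J → (Z : List (List Filled)) → Unique Z →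
    (∀ {z} → z ∈ Z → IsSSYT κ [] w z × Peelable (λ i k → look z (i , k))) →
    (∀ {z} → IsSSYT κ [] w z → Peelable (λ i k → look z (i , k)) → z ∈ Z) →
    length Z ≡ length (filter (noExcess? (codes (suc W) J) top) (N.chains top β base))
  peelable-count {J} K≡ Z Z-unique sound complete = length-bij Z-unique
    (Unique.filter⁺ (noExcess? (codes (suc W) J) top) (N.chains-unique top β base))
    (λ z → tableau→vchain (λ i k → look z (i , k))) (λ F → tab (ventry F) (cells κ []))
    (λ {z} z∈ → let (s , p) = sound z∈ ; t = SSYT⇒tableau s in
      ∈-filter⁺ (noExcess? (codes (suc W) J) top) (N.chains-complete (Forward.vchain t p))
        (Forward.lattice t p (suc W) J))
    (λ {F} F∈ → let (c , l) = unfilter F∈ in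
      complete (tableau⇒SSYT (Backward.vchain-tableau K≡ c l))
        (λ r k k≤ → subst₂ _≤_ (sym (shapeRow-cong {look′ F} {ventry F} (look-ventry F) k (suc (suc r))))
        (sym (shapeRow-cong {look′ F} {ventry F} (look-ventry F) k r)) (Backward.vchain-peelable K≡ c l r k k≤)))
    (λ {z} z∈ → let (s , p) = sound z∈ in
      trans (tab-cong (cells κ []) (λ {r} {c} q → ventry-recovered (SSYT⇒tableau s) p (∈-cells⁻ {κ} {[]} q)))
        (SSYT-tab s))
    (λ {F} F∈ → let (c , l) = unfilter F∈ in Backward.vchain-recovered K≡ c l (look-ventry F))
    where
    unfilter : ∀ {F} → F ∈ filter (noExcess? (codes (suc W) J) top) (N.chains top β base)
      → N.IsChain top β F base × NoExcess (codes (suc W) J) top F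
    unfilter F∈ with ∈-filter⁻ (noExcess? (codes (suc W) J) top) {xs = N.chains top β base} F∈
    ... | c , l = N.chains-sound top β base c , l
    look′ : List Shape → ℕ → ℕ → ℕ
    look′ F i k = look (tab (ventry F) (cells κ [])) (i , k)
    look-ventry : ∀ F {i k} → In i k → look′ F i k ≡ ventry F i k
    look-ventry F (a , b , c) = look-tab (ventry F) (cells-unique κ []) (∈-cells⁺ {κ} {[]} a b c)

  sm-split : ∀ g {k} → k ≤ K → tailSum K g 0 ≡ sm k g + tailSum K g k
  sm-split g {zero} _ = refl
  sm-split g {suc k} k<K = trans (sm-split g (<⇒≤ k<K))
    (trans (cong (sm k g +_) (tailSum-step K g k k<K)) (sym (+-assoc (sm k g) (g k) _)))

  module Matched {z : List Filled} (s : IsSSYT κ [] w z) where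

    f : ℕ → ℕ → ℕ
    f i k = look z (i , k)

    t : Tableau f
    t = SSYT⇒tableau s

    open Forward t

    ∈-z : ∀ {i k x} → ((i , k) , x) ∈ z → In i k × f i k ≡ x
    ∈-z {i} {k} p = ∈-cells⁻ {κ} {[]} (subst ((i , k) ∈_) (IsSSYT.keys s) (∈-map⁺ proj₁ p)) , look-∈
      (SSYT-keys-unique s) p

    occ-positive : ∀ {e i k} → In i k → f i k ≡ suc e → occ f e k ≡ 1
    occ-positive {e} {i} {k} p q with zero-or-one (occ-≤1 e k)
    ... | inj₂ r = r
    ... | inj₁ r = ⊥-elim (1+n≰n (≤-trans (≤-reflexive (sym q)) (proj₂ (height-iff e (In-column p))
      (subst (i <_) (trans (height-suc f e k) (cong (_+ height f e k) r))
        (proj₁ (height-iff (suc e) (In-column p)) (≤-reflexive q))))))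

    cell-of : ∀ {e k} → occ f e k ≡ 1 → In (height f e k) k × f (height f e k) k ≡ suc e
    cell-of {e} {k} o = column-In h<q , ≤-antisym (proj₂ (height-iff (suc e) h<q) h<)
      (≰⇒> (λ le → <-irrefl refl (proj₁ (height-iff e h<q) le)))
      where
      h< : height f e k < height f (suc e) k
      h< = ≤-reflexive (sym (trans (height-suc f e k) (cong (_+ height f e k) o)))
      h<q : height f e k < q k
      h<q = ≤-trans h< (height-≤ (suc e) k)

    -- Columns are strict, so cells with the same entry lie in different columns and can be counted
    -- by these.
    cells-count : ∀ e lo hi (L : List Cell) → Unique L →
      (∀ {c} → c ∈ L → (c , suc e) ∈ z × lo ≤ proj₂ c × proj₂ c < hi) →
      length L ≤ sm (hi ∸ lo) (λ i → occ f e (lo + i))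
    cells-count e lo hi L L-unique h = ≤-trans
      (length-inj {ys = filter (λ k → occ f e k ≟ 1) (range lo hi)} L-unique proj₂
        (λ {c} c∈ → let (p , l , u) = h c∈ ; (i , v) = ∈-z p in ∈-filter⁺ (λ k → occ f e k ≟ 1) (∈-range⁺ l u) (occ-positive i v))
        same)
      (≤-reflexive (trans (length-filter (λ k → occ f e k ≟ 1) (range lo hi)) (trans (sum-range lo hi _)
        (sm-cong (hi ∸ lo) (λ i _ → one (occ-≤1 e (lo + i)))))))
      where
      one : ∀ {m} → m ≤ 1 → ⟦ m ≟ 1 ⟧ ≡ m
      one z≤n = refl
      one (s≤s z≤n) = refl
      same : ∀ {a b} → a ∈ L → b ∈ L → proj₂ a ≡ proj₂ b → a ≡ b
      same {i , k} {i′ , _} a∈ b∈ refl with ∈-z (proj₁ (h a∈)) | ∈-z (proj₁ (h b∈)) | <-cmp i i′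
      ... | _ | _ | tri≈ _ refl _ = refl
      ... | p , u | p′ , v | tri< lt _ _ = ⊥-elim (<-irrefl (trans u (sym v)) (Tableau.columns t p p′ lt))
      ... | p , u | p′ , v | tri> _ _ gt = ⊥-elim (<-irrefl (trans v (sym u)) (Tableau.columns t p′ p gt))

    r+3≡ : ∀ r → r + 3 ≡ suc (suc (suc r))
    r+3≡ r = +-comm r 3

    top-split : ∀ r {k} → k ≤ K → row r top ≡ sm k (occ f r) + shapeRow f k r
    top-split r {k} k≤ = trans (sym (shapeRow-0 r))
      (trans (cong (row r base +_) (sm-split (occ f r) k≤)) (x∙yz≈y∙xz (row r base) (sm k (occ f r)) _))

    module _ (r : ℕ) where
      private
        a = row (suc (suc r)) top ∸ row r base

      -- The easy half of Hall's theorem, for the cut at column `k`: a pair has its `r + 3` to the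
      -- left of `k`, or else its `r + 1` in a column at or beyond `k`. This bounds the matching by
      -- the two numbers of such cells, and `top-split` turns the bound into the inequality of rows.
      matching⇒peelable : ∃ (Matching (Candidate z r) a) → ∀ k → k ≤ K → shapeRow f k (suc (suc r)) ≤ shapeRow f k r
      matching⇒peelable (m , a≤ , u₁ , u₂ , c) k k≤ = +-cancelˡ-≤ (sm k (occ f (suc (suc r)))) _ _ (begin
        sm k (occ f (suc (suc r))) + shapeRow f k (suc (suc r)) ≡⟨ sym (top-split (suc (suc r)) k≤) ⟩
        row (suc (suc r)) top                                   ≤⟨ m≤n+m∸n (row (suc (suc r)) top) (row r base) ⟩
        row r base + a                                          ≤⟨ +-monoʳ-≤ (row r base) (≤-trans a≤ length-m) ⟩
        row r base + (sm k (occ f (suc (suc r))) + tailSum K (occ f r) k) ≡⟨ x∙yz≈y∙xz (row r base)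
          (sm k (occ f (suc (suc r)))) _ ⟩
        sm k (occ f (suc (suc r))) + shapeRow f k r             ∎)
        where
        open ≤-Reasoning
        left? : Decidable (λ (x : Cell × Cell) → proj₂ (proj₂ x) < k)
        left? x = proj₂ (proj₂ x) <? k
        right? : Decidable (λ (x : Cell × Cell) → ¬ proj₂ (proj₂ x) < k)
        right? x = ¬? (left? x)
        m-unique : Unique m
        m-unique = Unique.map⁻ u₁
        length-m : length m ≤ sm k (occ f (suc (suc r))) + tailSum K (occ f r) k
        length-m = ≤-trans (≤-reflexive (length-partition left? m)) (+-mono-≤
          (≤-trans (≤-reflexive (sym (List.length-map proj₂ (filter left? m))))
            (cells-count (suc (suc r)) 0 k (map proj₂ (filter left? m))
            (map-unique proj₂ (Unique.filter⁺ left? m-unique)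
              (λ p p′ → unique-map-injective proj₂ u₂ (proj₁ (∈-filter⁻ left? {xs = m} p))
                (proj₁ (∈-filter⁻ left? {xs = m} p′))))
            (λ c∈ → case ∈-map⁻ proj₂ c∈ of λ { (x , x∈ , refl) → let (x∈m , lt) = ∈-filter⁻ left? {xs = m} x∈ in
              subst (λ e → (proj₂ x , e) ∈ z) (r+3≡ r) (proj₁ (proj₂ (c x x∈m))) , z≤n , lt })))
          (≤-trans (≤-reflexive (sym (List.length-map proj₁ (filter right? m))))
            (cells-count r k K (map proj₁ (filter right? m))
            (map-unique proj₁ (Unique.filter⁺ right? m-unique)
              (λ p p′ → unique-map-injective proj₁ u₁ (proj₁ (∈-filter⁻ right? {xs = m} p))
                (proj₁ (∈-filter⁻ right? {xs = m} p′))))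
            (λ c∈ → case ∈-map⁻ proj₁ c∈ of λ { (x , x∈ , refl) → let (x∈m , ge) = ∈-filter⁻ right? {xs = m} x∈ ; (p∈ , q∈ , _ , col≤) = c x x∈m in
              p∈ , ≤-trans (≮⇒≥ ge) col≤ , In-K (proj₁ (∈-z p∈)) }))))

      module _ (sc : Greedy.Scan (occ f r) (occ f (suc (suc r))) (occ-≤1 r) (occ-≤1 (suc (suc r))) K) where
        open Greedy.Scan sc

        pair : ℕ × ℕ → Cell × Cell
        pair (kp , kq) = (height f r kp , kp) , (height f (suc (suc r)) kq , kq)

        length-matched : length matched ≡ sm threshold (occ f (suc (suc r))) + tailSum K (occ f r) threshold
        length-matched = +-cancelʳ-≡ (sm threshold (occ f r)) _ _
          (trans balance (trans (cong (sm threshold (occ f (suc (suc r))) +_)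
            (trans (sm-split (occ f r) bound) (+-comm (sm threshold (occ f r)) (tailSum K (occ f r) threshold))))
            (sym (+-assoc (sm threshold (occ f (suc (suc r)))) (tailSum K (occ f r) threshold)
              (sm threshold (occ f r))))))

        -- The greedy matching attains the bound at `threshold`, so the inequality of rows at this
        -- one column gives its size.
        enough : (∀ k → k ≤ K → shapeRow f k (suc (suc r)) ≤ shapeRow f k r) → a ≤ length matched
        enough peel = m≤n+o⇒m∸n≤o (row (suc (suc r)) top) (row r base) (begin
          row (suc (suc r)) top ≡⟨ top-split (suc (suc r)) bound ⟩
          sm threshold (occ f (suc (suc r))) + shapeRow f threshold (suc (suc r)) ≤⟨ +-monoʳ-≤
            (sm threshold (occ f (suc (suc r)))) (peel threshold bound) ⟩
          sm threshold (occ f (suc (suc r))) + shapeRow f threshold r ≡⟨ x∙yz≈y∙xz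
            (sm threshold (occ f (suc (suc r)))) (row r base) (tailSum K (occ f r) threshold) ⟩
          row r base + (sm threshold (occ f (suc (suc r))) + tailSum K (occ f r) threshold) ≡⟨ cong (row r base +_)
            (sym length-matched) ⟩
          row r base + length matched ∎)
          where
          open ≤-Reasoning

        first-unique : Unique (map proj₁ (map pair matched))
        first-unique = subst Unique (List.map-∘ {g = proj₁} {f = pair} matched)
          (map-unique (proj₁ ∘ pair) (Unique.map⁻ unique₁)
          (λ p p′ e → unique-map-injective proj₁ unique₁ p p′ (cong proj₂ e)))

        second-unique : Unique (map proj₂ (map pair matched))
        second-unique = subst Unique (List.map-∘ {g = proj₂} {f = pair} matched)
          (map-unique (proj₂ ∘ pair) (Unique.map⁻ unique₁)
          (λ p p′ e → unique-map-injective proj₂ unique₂ p p′ (cong proj₂ e)))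

        -- Only columns were matched; the condition on rows is automatic. In the row of the cell
        -- with `r + 1`, the cell in column `kq ≤ kp` has an entry at most `r + 1`, so the `r + 3`
        -- of that column lies below it.
        candidate : ∀ kp kq → occ f r kp ≡ 1 → occ f (suc (suc r)) kq ≡ 1 → kq ≤ kp → Candidate z r (pair (kp , kq))
        candidate kp kq op oq kq≤kp =
          subst (λ e → ((height f r kp , kp) , e) ∈ z) fp (SSYT-∈ s inp) ,
          subst (λ e → ((height f (suc (suc r)) kq , kq) , e) ∈ z) (trans (proj₂ (cell-of oq)) (sym (r+3≡ r)))
            (SSYT-∈ s (proj₁ (cell-of oq))) ,
          <⇒≤ (≤-trans (proj₁ (height-iff (suc r) (In-column inpq)) (≤-trans weak (≤-reflexive fp)))
            (≤-trans (m≤n+m (height f (suc r) kq) (occ f (suc r) kq))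
              (≤-reflexive (sym (height-suc f (suc r) kq))))) , kq≤kp
          where
          inp : In (height f r kp) kp
          inp = proj₁ (cell-of op)
          fp : f (height f r kp) kp ≡ suc r
          fp = proj₂ (cell-of op)
          inpq : In (height f r kp) kq
          inpq = proj₁ inp , z≤n , ≤-<-trans kq≤kp (proj₂ (proj₂ inp))
          weak : f (height f r kp) kq ≤ f (height f r kp) kp
          weak with kq ≟ kp
          ... | yes refl = ≤-refl
          ... | no ne = Tableau.rows t inpq inp (≤∧≢⇒< kq≤kp ne)

        scan-matching : (∀ k → k ≤ K → shapeRow f k (suc (suc r)) ≤ shapeRow f k r) → ∃ (Matching (Candidate z r) a)
        scan-matching peel = map pair matched , subst (a ≤_) (sym (List.length-map pair matched))
          (enough peel) , first-unique , second-unique ,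
          λ x x∈ → case ∈-map⁻ pair x∈ of λ { ((kp , kq) , m∈ , refl) → let (op , oq , kq≤kp , _) = valid kp kq m∈ in candidate kp kq op oq kq≤kp }

      peelable⇒matching : (∀ k → k ≤ K → shapeRow f k (suc (suc r)) ≤ shapeRow f k r) → ∃ (Matching (Candidate z r) a)
      peelable⇒matching = scan-matching (Greedy.scan (occ f r) (occ f (suc (suc r))) (occ-≤1 r)
        (occ-≤1 (suc (suc r))) K)

    peelable-iff : ∀ D → (∀ r → aCoeff D r ≡ row (suc (suc r)) top ∸ row r base) →
      (T (all (peelCondition D z) (upTo (length w))) → Peelable f) ×
        (Peelable f → T (all (peelCondition D z) (upTo (length w))))
    peelable-iff D a≡ = (λ p r k k≤ → to p r k k≤ (r <? length w)) ,
      (λ p → All.all⁻ (peelCondition D z) (All.tabulate {xs = upTo (length w)}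
        (λ {r} _ → proj₂ (peelCondition-matching D z r (SSYT-keys-unique s))
        (subst (λ a → ∃ (Matching (Candidate z r) a)) (sym (a≡ r)) (peelable⇒matching r (p r))))))
      where
      to : T (all (peelCondition D z) (upTo (length w))) → ∀ r k → k ≤ K → Dec (r < length w) → shapeRow f k
        (suc (suc r)) ≤ shapeRow f k r
      to p r k k≤ (yes r<) = matching⇒peelable r (subst (λ a → ∃ (Matching (Candidate z r) a)) (a≡ r)
        (proj₁ (peelCondition-matching D z r (SSYT-keys-unique s))
          (All.lookup (All.all⁺ (peelCondition D z) (upTo (length w)) p) (∈-upTo⁺ r<)))) k k≤
      -- The test runs over `r < length w` only; beyond that, row `r + 2` of every shape is empty.
      to p r k k≤ (no ¬r<) = ≤-trans (subst (shapeRow f k (suc (suc r)) ≤_)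
        (row-beyond (≤-trans (subst (_≤ r) w-length (≮⇒≥ ¬r<)) (≤-trans (n≤1+n r) (n≤1+n (suc r)))))
          (shapeRow-≤ k (suc (suc r)) k≤)) z≤n

-- Contents and overlaps of the shuffle diagram

sm-single : ∀ n g {a} → a < n → (∀ i → i < n → i ≢ a → g i ≡ 0) → sm n g ≡ g a
sm-single (suc n) g {a} a< z with a ≟ n
... | yes refl = cong (_+ g n) (sm-zero n (λ i i<n → z i (m<n⇒m<1+n i<n) (<⇒≢ i<n)))
... | no ne = trans (cong₂ _+_ (sm-single n g (≤∧≢⇒< (s≤s⁻¹ a<) ne) (λ i i<n → z i (m<n⇒m<1+n i<n)))
  (z n ≤-refl (ne ∘ sym))) (+-identityʳ (g a))

-- Columns meeting rows a and a+1 of a skew shape.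
overlap-count : ∀ λ' μ → IsPartition λ' → IsPartition μ → μ ⊆ₚ λ' → ∀ a {P : ℕ → ℕ → Set} (P? : ∀ i j → Dec (P i j)) →
  (∀ i j → P i j → i ≡ a × (suc a , j) ∈ cells λ' μ) → (∀ j → (suc a , j) ∈ cells λ' μ → P a j) →
  sm (length λ') (λ i → sm (part λ' i ∸ part μ i) (λ x → ⟦ P? i (part μ i + x) ⟧)) ≡ part λ' (suc a) ∸ part μ a
overlap-count λ' μ λ-part μ-part μ⊆λ a P? to from with a <? length λ'
... | no ¬a< = trans (sm-zero (length λ') (λ i i< → sm-zero (part λ' i ∸ part μ i)
  (λ x _ → ⟦⟧-no (P? i (part μ i + x))
    (λ p → ¬a< (subst (_< length λ') (proj₁ (to i _ p)) i<)))))
  (sym (trans (cong (_∸ part μ a) (part-beyond λ' (m≤n⇒m≤1+n (≮⇒≥ ¬a<)))) (0∸n≡0 (part μ a))))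
... | yes a< = trans (sm-single (length λ') _ a<
  (λ i i< ne → sm-zero (part λ' i ∸ part μ i) (λ x _ → ⟦⟧-no (P? i (part μ i + x)) (λ p → ne (proj₁ (to i _ p))))))
  (trans (sm-cong (part λ' a ∸ part μ a) (λ x _ → ⟦⟧-cong (P? a (part μ a + x)) (x <? part λ' (suc a) ∸ part μ a)
    (lower x) (raise x)))
  (sm-below (part λ' a ∸ part μ a) (∸-monoˡ-≤ (part μ a) (λ-part a))))
  where
  lower : ∀ x → _ → x < part λ' (suc a) ∸ part μ a
  lower x p = subst (_< part λ' (suc a) ∸ part μ a) (m+n∸m≡n (part μ a) x)
    (∸-monoˡ-< (proj₂ (proj₂ (∈-cells⁻ {λ'} {μ} (proj₂ (to a (part μ a + x) p))))) (m≤m+n (part μ a) x))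
  raise : ∀ x → x < part λ' (suc a) ∸ part μ a → _
  raise x lt = from (part μ a + x) (∈-cells⁺ {λ'} {μ} sa< (≤-trans (μ-part a) (m≤m+n (part μ a) x)) j<)
    where
    j< : part μ a + x < part λ' (suc a)
    j< = ≤-trans (+-monoʳ-< (part μ a) lt) (≤-reflexive (m+[n∸m]≡n {part μ a} {part λ' (suc a)} (<⇒≤ μ<λ)))
      where
      μ<λ : part μ a < part λ' (suc a)
      μ<λ = ≰⇒> (λ le → n≮0 (subst (x <_) (m≤n⇒m∸n≡0 {part λ' (suc a)} {part μ a} le) lt))
    sa< : suc a < length λ'
    sa< = ≰⇒> (λ le → n≮0 (subst (part μ a + x <_) (part-beyond λ' le) j<))

module Shuffle (λ' μ ν ρ : List ℕ) (λ-part : IsPartition λ') (μ-part : IsPartition μ) (μ⊆λ : μ ⊆ₚ λ')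
  (ν-part : IsPartition ν) (ρ-part : IsPartition ρ) (ρ⊆ν : ρ ⊆ₚ ν) where

  D : List Cell
  D = shuffleDiagram λ' μ ν ρ

  w : List ℕ
  w = shuffleContent λ' μ ν ρ

  top base : Shape
  top = λ' , ν
  base = fit (length λ') μ , fit (length ν) ρ

  rows : ℕ
  rows = length λ' + length ν

  ∈-even⁻ : ∀ {i j} → (2 * i , 2 * j) ∈ D → (i , j) ∈ cells λ' μ
  ∈-even⁻ {i} {j} p with ∈-++⁻ (map _ (cells λ' μ)) p
  ... | inj₁ q with ∈-map⁻ _ q
  ... | (i′ , j′) , c , e = subst₂ (λ a b → (a , b) ∈ cells λ' μ) (sym (*-cancelˡ-≡ i i′ 2 (,-injectiveˡ e)))
    (sym (*-cancelˡ-≡ j j′ 2 (,-injectiveʳ e))) c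
  ∈-even⁻ {i} {j} p | inj₂ q with ∈-map⁻ _ q
  ... | (i′ , j′) , c , e = ⊥-elim (even≢odd i i′ (,-injectiveˡ e))

  ∈-odd⁻ : ∀ {i j} → (suc (2 * i) , suc (2 * j)) ∈ D → (i , j) ∈ cells ν ρ
  ∈-odd⁻ {i} {j} p with ∈-++⁻ (map _ (cells λ' μ)) p
  ... | inj₂ q with ∈-map⁻ _ q
  ... | (i′ , j′) , c , e = subst₂ (λ a b → (a , b) ∈ cells ν ρ)
    (sym (*-cancelˡ-≡ i i′ 2 (suc-injective (,-injectiveˡ e))))
      (sym (*-cancelˡ-≡ j j′ 2 (suc-injective (,-injectiveʳ e)))) c
  ∈-odd⁻ {i} {j} p | inj₁ q with ∈-map⁻ _ q
  ... | (i′ , j′) , c , e = ⊥-elim (even≢odd i′ i (sym (,-injectiveˡ e)))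

  ∈-even⁺ : ∀ {i j} → (i , j) ∈ cells λ' μ → (2 * i , 2 * j) ∈ D
  ∈-even⁺ c = ∈-++⁺ˡ (∈-map⁺ _ c)

  ∈-odd⁺ : ∀ {i j} → (i , j) ∈ cells ν ρ → (suc (2 * i) , suc (2 * j)) ∈ D
  ∈-odd⁺ c = ∈-++⁺ʳ (map _ (cells λ' μ)) (∈-map⁺ _ c)

  count-shuffle : ∀ (G : Cell → Bool) (E E′ : Cell → Cell) → length
    (filterᵇ G (map E (cells λ' μ) ++ map E′ (cells ν ρ))) ≡
    sm (length λ') (λ i → sm (part λ' i ∸ part μ i) (λ x → ⟦ T? (G (E (i , part μ i + x))) ⟧)) +
    sm (length ν) (λ i → sm (part ν i ∸ part ρ i) (λ x → ⟦ T? (G (E′ (i , part ρ i + x))) ⟧))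
  count-shuffle G E E′ = trans (length-filter (λ c → T? (G c)) (map E (cells λ' μ) ++ map E′ (cells ν ρ)))
    (trans (cong sum (List.map-++ g (map E (cells λ' μ)) (map E′ (cells ν ρ))))
      (trans (sum-++ (map g (map E (cells λ' μ))) (map g (map E′ (cells ν ρ))))
    (cong₂ _+_ (trans (cong sum (sym (List.map-∘ (cells λ' μ)))) (sum-cells (g ∘ E) λ' μ))
      (trans (cong sum (sym (List.map-∘ (cells ν ρ)))) (sum-cells (g ∘ E′) ν ρ)))))
    where
    g : Cell → ℕ
    g c = ⟦ T? (G c) ⟧

  aCoeff-even : ∀ a → aCoeff D (2 * a) ≡ part λ' (suc a) ∸ part μ a
  aCoeff-even a = trans (count-shuffle _ _ _) (trans (cong₂ _+_
      (overlap-count λ' μ λ-part μ-part μ⊆λ a (λ i j → T? ((2 * i ≡ᵇ 2 * a) ∧ memᵇ (2 * a + 2 , 2 * j) D)) to from)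
      (sm-zero (length ν) (λ i _ → sm-zero (part ν i ∸ part ρ i)
        (λ x _ → ⟦⟧-no (T? ((suc (2 * i) ≡ᵇ 2 * a) ∧ memᵇ (2 * a + 2 , suc (2 * (part ρ i + x))) D))
        (λ t → even≢odd a i (sym (≡ᵇ⇒≡ (suc (2 * i)) (2 * a) (proj₁ (Equivalence.to T-∧ t)))))))))
    (+-identityʳ _))
    where
    e : 2 * a + 2 ≡ 2 * suc a
    e = trans (+-comm (2 * a) 2) (sym (*-suc 2 a))
    to : ∀ i j → T ((2 * i ≡ᵇ 2 * a) ∧ memᵇ (2 * a + 2 , 2 * j) D) → i ≡ a × (suc a , j) ∈ cells λ' μ
    to i j t with Equivalence.to T-∧ t
    ... | p , m = *-cancelˡ-≡ i a 2 (≡ᵇ⇒≡ (2 * i) (2 * a) p) , ∈-even⁻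
      (subst (λ r → (r , 2 * j) ∈ D) e (memᵇ⇒∈ (2 * a + 2 , 2 * j) D m))
    from : ∀ j → (suc a , j) ∈ cells λ' μ → T ((2 * a ≡ᵇ 2 * a) ∧ memᵇ (2 * a + 2 , 2 * j) D)
    from j c = Equivalence.from T-∧ (≡⇒≡ᵇ (2 * a) (2 * a) refl , ∈⇒memᵇ
      (subst (λ r → (r , 2 * j) ∈ D) (sym e) (∈-even⁺ c)))

  aCoeff-odd : ∀ a → aCoeff D (suc (2 * a)) ≡ part ν (suc a) ∸ part ρ a
  aCoeff-odd a = trans (count-shuffle _ _ _) (cong₂ _+_
      (sm-zero (length λ') (λ i _ → sm-zero (part λ' i ∸ part μ i)
        (λ x _ → ⟦⟧-no (T? ((2 * i ≡ᵇ suc (2 * a)) ∧ memᵇ (suc (2 * a) + 2 , 2 * (part μ i + x)) D))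
        (λ t → even≢odd i a (≡ᵇ⇒≡ (2 * i) (suc (2 * a)) (proj₁ (Equivalence.to T-∧ t)))))))
      (overlap-count ν ρ ν-part ρ-part ρ⊆ν a (λ i j → T?
        ((suc (2 * i) ≡ᵇ suc (2 * a)) ∧ memᵇ (suc (2 * a) + 2 , suc (2 * j)) D)) to from))
    where
    e : suc (2 * a) + 2 ≡ suc (2 * suc a)
    e = cong suc (trans (+-comm (2 * a) 2) (sym (*-suc 2 a)))
    to : ∀ i j → T ((suc (2 * i) ≡ᵇ suc (2 * a)) ∧ memᵇ (suc (2 * a) + 2 , suc (2 * j)) D) → i ≡ a ×
      (suc a , j) ∈ cells ν ρ
    to i j t with Equivalence.to T-∧ t
    ... | p , m = *-cancelˡ-≡ i a 2 (≡ᵇ⇒≡ (2 * i) (2 * a) p) , ∈-odd⁻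
      (subst (λ r → (r , suc (2 * j)) ∈ D) e (memᵇ⇒∈ (suc (2 * a) + 2 , suc (2 * j)) D m))
    from : ∀ j → (suc a , j) ∈ cells ν ρ → T ((suc (2 * a) ≡ᵇ suc (2 * a)) ∧ memᵇ (suc (2 * a) + 2 , suc (2 * j)) D)
    from j c = Equivalence.from T-∧ (≡⇒≡ᵇ (2 * a) (2 * a) refl , ∈⇒memᵇ
      (subst (λ r → (r , suc (2 * j)) ∈ D) (sym e) (∈-odd⁺ c)))

  part-fit : ∀ ξ κ → κ ⊆ₚ ξ → ∀ a → part (fit (length ξ) κ) a ≡ part κ a
  part-fit ξ κ κ⊆ξ a with a <? length ξ
  ... | yes a< = part-applyUpTo (length ξ) (part κ) a<
  ... | no ¬a< = trans (part-beyond (fit (length ξ) κ)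
    (≤-trans (≤-reflexive (List.length-applyUpTo (part κ) (length ξ))) (≮⇒≥ ¬a<)))
    (sym (n≤0⇒n≡0 (≤-trans (κ⊆ξ a) (≤-reflexive (part-beyond ξ (≮⇒≥ ¬a<))))))

  2*≡ : ∀ a → 2 * a ≡ a + a
  2*≡ a = cong (a +_) (+-identityʳ a)

  row-base-even : ∀ a → row (a + a) base ≡ part μ a
  row-base-even a = trans (row-even a (proj₁ base) (proj₂ base)) (part-fit λ' μ μ⊆λ a)

  row-base-odd : ∀ a → row (suc (a + a)) base ≡ part ρ a
  row-base-odd a = trans (row-odd a (proj₁ base) (proj₂ base)) (part-fit ν ρ ρ⊆ν a)

  -- Rows `r` and `r + 2` of the diagram are consecutive rows of one component. Their common columns
  -- run from the inner end of the upper row to the outer end of the lower one; truncated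
  -- subtraction covers the case of no overlap.
  aCoeff-row : ∀ r → aCoeff D r ≡ row (suc (suc r)) top ∸ row r base
  aCoeff-row r with parity r
  ... | even a = trans (cong (aCoeff D) (sym (2*≡ a))) (trans (aCoeff-even a) (cong₂ _∸_
    (sym (trans (cong (λ m → row (suc m) top) (sym (+-suc a a))) (row-even (suc a) λ' ν))) (sym (row-base-even a))))
  ... | odd a = trans (cong (aCoeff D ∘ suc) (sym (2*≡ a))) (trans (aCoeff-odd a) (cong₂ _∸_
    (sym (trans (cong (λ m → row (suc (suc m)) top) (sym (+-suc a a))) (row-odd (suc a) λ' ν)))
      (sym (row-base-odd a))))

  private
    pairs : (ℕ → ℕ) → (ℕ → ℕ) → List ℕ → List ℕ
    pairs x y = concatMap (λ i → x i ∷ y i ∷ [])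

    pairs-length : ∀ x y is → length (pairs x y is) ≡ length is + length is
    pairs-length x y [] = refl
    pairs-length x y (i ∷ is) = cong suc (trans (cong suc (pairs-length x y is))
      (sym (+-suc (length is) (length is))))

    pairs-even : ∀ x y h n {a} → a < n → part (pairs x y (applyUpTo h n)) (a + a) ≡ x (h a)
    pairs-even x y h (suc n) {zero} _ = refl
    pairs-even x y h (suc n) {suc a} (s≤s p) = trans (cong (part (pairs x y (applyUpTo h (suc n))) ∘ suc) (+-suc a a))
      (pairs-even x y (h ∘ suc) n p)

    pairs-odd : ∀ x y h n {a} → a < n → part (pairs x y (applyUpTo h n)) (suc (a + a)) ≡ y (h a)
    pairs-odd x y h (suc n) {zero} _ = refl
    pairs-odd x y h (suc n) {suc a} (s≤s p) = trans
      (cong (part (pairs x y (applyUpTo h (suc n))) ∘ suc ∘ suc) (+-suc a a)) (pairs-odd x y (h ∘ suc) n p)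

  w-length : length w ≡ rows + rows
  w-length = trans (pairs-length _ _ (upTo rows)) (cong₂ _+_ (List.length-upTo rows) (List.length-upTo rows))

  w-part : ∀ r → part w r ≡ row r top ∸ row r base
  w-part r with parity r
  ... | even a = trans (go (a <? rows)) (cong₂ _∸_ (sym (row-even a λ' ν)) (sym (row-base-even a)))
    where
    go : Dec (a < rows) → part w (a + a) ≡ part λ' a ∸ part μ a
    go (yes p) = pairs-even (λ i → part λ' i ∸ part μ i) (λ i → part ν i ∸ part ρ i) id rows p
    go (no ¬p) = trans (part-beyond w (≤-trans (≤-reflexive w-length) (+-mono-≤ (≮⇒≥ ¬p) (≮⇒≥ ¬p))))
      (sym (trans (cong (_∸ part μ a) (part-beyond λ' (≤-trans (m≤m+n (length λ') (length ν)) (≮⇒≥ ¬p))))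
        (0∸n≡0 (part μ a))))
  ... | odd a = trans (go (a <? rows)) (cong₂ _∸_ (sym (row-odd a λ' ν)) (sym (row-base-odd a)))
    where
    go : Dec (a < rows) → part w (suc (a + a)) ≡ part ν a ∸ part ρ a
    go (yes p) = pairs-odd (λ i → part λ' i ∸ part μ i) (λ i → part ν i ∸ part ρ i) id rows p
    go (no ¬p) = trans (part-beyond w (≤-trans (≤-reflexive w-length) (m≤n⇒m≤1+n (+-mono-≤ (≮⇒≥ ¬p) (≮⇒≥ ¬p)))))
      (sym (trans (cong (_∸ part ρ a) (part-beyond ν (≤-trans (m≤n+m (length ν) (length λ')) (≮⇒≥ ¬p))))
        (0∸n≡0 (part ρ a))))

  top-desc : Desc₂ top
  top-desc = isPartition⇒desc λ-part , isPartition⇒desc ν-part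

  base-desc : Desc₂ base
  base-desc = applyUpTo-desc (length λ') (λ i _ → μ-part i) , applyUpTo-desc (length ν) (λ i _ → ρ-part i)

  base≤₁ : Pointwise _≤_ (proj₁ base) λ'
  base≤₁ = subst (Pointwise _≤_ (proj₁ base)) (applyUpTo-part λ') (applyUpTo-pointwise (length λ') (λ i _ → μ⊆λ i))

  base≤₂ : Pointwise _≤_ (proj₂ base) ν
  base≤₂ = subst (Pointwise _≤_ (proj₂ base)) (applyUpTo-part ν) (applyUpTo-pointwise (length ν) (λ i _ → ρ⊆ν i))

  module _ (κ : List ℕ) (κ-desc : Desc κ) (J : ℕ) (κ≤K : part κ 0 ≤ suc J) where
    private
      module P = Peel top base w rows κ (suc J) top-desc base-desc base≤₁ base≤₂ (m≤m+n (length λ') (length ν))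
        (m≤n+m (length ν) (length λ'))
        w-length w-part κ-desc κ≤K
      module N = VChains top (λ _ → 0)

    peelableCount-chains : peelableCount λ' μ ν ρ κ ≡
      length (filter (noExcess? (codes (suc (rows + rows)) J) top) (N.chains top (applyUpTo (col κ) (suc J)) base))
    peelableCount-chains = P.peelable-count refl (filterᵇ peel (SSYTs κ [] w))
      (Unique.filter⁺ (T? ∘ peel) (SSYTs-unique κ [] w))
      (λ z∈ → let (s∈ , p) = ∈-filter⁻ (T? ∘ peel) {xs = SSYTs κ [] w} z∈ ; s = SSYTs-sound κ [] w s∈ in
        s , proj₁ (P.Matched.peelable-iff s D aCoeff-row) p)
      (λ s p → ∈-filter⁺ (T? ∘ peel) (SSYTs-complete κ [] w s) (proj₂ (P.Matched.peelable-iff s D aCoeff-row) p))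
      where
      peel : List Filled → Bool
      peel z = all (peelCondition D z) (upTo (length w))

-- Straight shapes

addδ? : ∀ ξ → Dec (∃ λ β → ξ ≡ addδ β)
addδ? [] = yes ([] , refl)
addδ? (x ∷ ξ) with addδ? ξ
... | no ¬p = no λ { (b ∷ β , e) → ¬p (β , List.∷-injectiveʳ e) }
... | yes (β , refl) with length β ≤? x
... | yes p = yes (x ∸ length β ∷ β , cong (_∷ addδ β) (sym (m∸n+n≡m p)))
... | no ¬p = no λ { (b ∷ γ , e) → ¬p (≤-trans (m≤n+m (length β) b)
  (≤-reflexive (trans (cong (b +_) (same-length e)) (sym (List.∷-injectiveˡ e))))) }
  where
  same-length : ∀ {b γ} → x ∷ addδ β ≡ addδ (b ∷ γ) → length β ≡ length γ
  same-length {b} {γ} e = trans (sym (addδ-length β)) (trans (cong length (List.∷-injectiveʳ e)) (addδ-length γ))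

addδ-injective : ∀ β γ → addδ β ≡ addδ γ → β ≡ γ
addδ-injective [] [] _ = refl
addδ-injective (b ∷ β) (c ∷ γ) e with addδ-injective β γ (List.∷-injectiveʳ e)
... | refl = cong (_∷ β) (+-cancelʳ-≡ (length β) b c (List.∷-injectiveˡ e))

-- A convex sequence descending to 0 in steps of 0 or 1 makes all its steps of 1 first.
convex-steps : ∀ K (g : ℕ → ℕ) → (∀ k → k < K → Step (g (suc k)) (g k)) → g K ≡ 0 →
  (∀ k → suc k < K → g (suc k) + g (suc k) ≤ g (suc (suc k)) + g k) → ∀ k → k ≤ K → g k ≡ g 0 ∸ k
convex-steps K g step end convex = go
  where
  flat : ∀ d k → k + suc d ≡ K → g k ≡ g (suc k) → g k ≡ 0
  flat zero k e q = trans q (trans (cong g (trans (sym (+-comm k 1)) e)) end)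
  flat (suc d) k e q = trans q (flat d (suc k) e′ (≤-antisym (+-cancelʳ-≤ (g (suc k)) (g (suc k)) (g (suc (suc k)))
      (subst (λ m → g (suc k) + g (suc k) ≤ g (suc (suc k)) + m) q (convex k sk<K))) (proj₁ (step (suc k) sk<K))))
    where
    e′ : suc k + suc d ≡ K
    e′ = trans (sym (+-suc k (suc d))) e
    sk<K : suc k < K
    sk<K = subst (suc k <_) e′ (m<m+n (suc k) (s≤s z≤n))
  go : ∀ k → k ≤ K → g k ≡ g 0 ∸ k
  go zero _ = refl
  go (suc k) k<K with g k ≟ g (suc k)
  ... | yes e = trans (sym e) (trans gk≡0 (sym
    (m≤n⇒m∸n≡0 (≤-trans (m∸n≡0⇒m≤n (trans (sym (go k (<⇒≤ k<K))) gk≡0)) (n≤1+n k)))))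
    where
    gk≡0 : g k ≡ 0
    gk≡0 = flat (K ∸ suc k) k (trans (+-suc k (K ∸ suc k)) (m+[n∸m]≡n k<K)) e
  ... | no ne = suc-injective (trans (≤-antisym (≤∧≢⇒< (proj₁ (step k k<K)) (ne ∘ sym)) (proj₂ (step k k<K)))
      (trans (go k (<⇒≤ k<K)) (+-∸-assoc 1 k<g0)))
    where
    k<g0 : k < g 0
    k<g0 = ≰⇒> (λ le → let gk≡0 = trans (go k (<⇒≤ k<K)) (m≤n⇒m∸n≡0 le) in
      ne (trans gk≡0 (sym (n≤0⇒n≡0 (≤-trans (proj₁ (step k k<K)) (≤-reflexive gk≡0))))))

∸-convex : ∀ m k → m ∸ suc k + (m ∸ suc k) ≤ m ∸ suc (suc k) + (m ∸ k)
∸-convex zero k = z≤n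
∸-convex (suc zero) zero = z≤n
∸-convex (suc (suc m)) zero = ≤-reflexive (sym (+-suc m (suc m)))
∸-convex (suc m) (suc k) = ∸-convex m k

∸-linear : ∀ m k → suc k < m → m ∸ suc (suc k) + (m ∸ k) ≡ m ∸ suc k + (m ∸ suc k)
∸-linear (suc (suc m)) zero _ = +-suc m (suc m)
∸-linear (suc zero) zero (s≤s ())
∸-linear (suc m) (suc k) (s≤s p) = ∸-linear m k p

∸-suc-⟦⟧ : ∀ m k → m ∸ k ≡ ⟦ k <? m ⟧ + (m ∸ suc k)
∸-suc-⟦⟧ m k with k <? m
... | yes p = +-∸-assoc 1 p
... | no ¬p = trans (m≤n⇒m∸n≡0 (≮⇒≥ ¬p)) (sym (m≤n⇒m∸n≡0 (m≤n⇒m≤1+n (≮⇒≥ ¬p))))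

-- The only lattice filling of a straight shape has row i filled with 1, …, κ_i.
module Straight (κ : List ℕ) (κ-desc : Desc κ) (J : ℕ) (κ≤K : part κ 0 ≤ suc J) where
  private
    K = suc J
    ℓ = length κ
    W = ℓ + ℓ

  top base : Shape
  top = κ , []
  base = fit ℓ [] , []

  top-desc : Desc₂ top
  top-desc = κ-desc , []

  private
    module N = VChains top (λ _ → 0)

  β : List ℕ
  β = applyUpTo (col κ) K

  cut : ℕ → Shape
  cut k = applyUpTo (λ a → part κ a ∸ k) ℓ , []

  row-single : ∀ xs a → row (a + a) (xs , []) ≡ part xs a
  row-single xs a = row-even a xs []

  pre-single : ∀ xs a → pre (a + a) (xs , []) ≡ sm a (part xs)
  pre-single xs zero = refl
  pre-single xs (suc a) = trans (cong (λ t → pre (suc t) (xs , [])) (+-suc a a))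
    (trans (pre-suc (suc (a + a)) (xs , []))
    (trans (cong₂ _+_ (trans (pre-suc (a + a) (xs , [])) (cong₂ _+_ (pre-single xs a) (row-single xs a)))
      (row-odd a xs [])) (+-identityʳ _)))

  part-cut : ∀ k a → part (proj₁ (cut k)) a ≡ part κ a ∸ k
  part-cut k a with a <? ℓ
  ... | yes p = part-applyUpTo ℓ (λ a → part κ a ∸ k) p
  ... | no ¬p = trans (part-beyond (proj₁ (cut k)) (≤-trans (≤-reflexive (List.length-applyUpTo _ ℓ)) (≮⇒≥ ¬p)))
    (sym (trans (cong (_∸ k) (part-beyond κ (≮⇒≥ ¬p))) (0∸n≡0 k)))

  part-≤K : ∀ a → part κ a ≤ K
  part-≤K a = ≤-trans (isPartition⇒≤ κ (desc⇒isPartition κ-desc) z≤n) κ≤K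

  cut-0 : cut 0 ≡ top
  cut-0 = cong (_, []) (applyUpTo-part κ)

  cut-K : cut K ≡ base
  cut-K = cong (_, []) (applyUpTo-cong ℓ (λ a _ → m≤n⇒m∸n≡0 (part-≤K a)))

  β-length : length β ≡ K
  β-length = List.length-applyUpTo (col κ) K

  cut-size : ∀ k → size (cut k) ≡ col κ k + size (cut (suc k))
  cut-size k = trans (+-identityʳ _) (trans (sum-applyUpTo ℓ (λ a → part κ a ∸ k))
    (trans (sm-cong ℓ (λ a _ → ∸-suc-⟦⟧ (part κ a) k))
    (trans (sm-+ ℓ (λ a → ⟦ k <? part κ a ⟧) (λ a → part κ a ∸ suc k)) (cong (col κ k +_)
      (sym (trans (+-identityʳ _) (sum-applyUpTo ℓ (λ a → part κ a ∸ suc k))))))))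

  chain : List Shape
  chain = applyUpTo (cut ∘ suc) (length β)

  cut-chain : N.IsChain top β chain base
  cut-chain = subst₂ (λ u t → N.IsChain u β chain t) cut-0 (trans (cong cut β-length) cut-K)
    (N.steps-chain cut β (λ k k< → N.inside⇒∈U
        ((subst (Pointwise _≤_ (proj₁ (cut (suc k)))) (applyUpTo-part κ)
          (applyUpTo-pointwise ℓ (λ a _ → m∸n≤m (part κ a) (suc k))) , []) ,
         (applyUpTo-desc ℓ (λ a _ → ∸-monoˡ-≤ (suc k) (desc⇒isPartition κ-desc a)) , [])) ,
      λ _ → (applyUpTo-pointwise ℓ (λ a _ → subst (part κ a ∸ suc k ≤_) (sym (∸-suc-⟦⟧ (part κ a) k)) (m≤n+m _ _) ,
          ≤-trans (≤-reflexive (∸-suc-⟦⟧ (part κ a) k)) (+-monoˡ-≤ (part κ a ∸ suc k) (⟦⟧≤1 (k <? part κ a)))) , []) ,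
        trans (+-identityʳ _) (trans (cut-size k)
          (cong (_+ size (cut (suc k))) (sym (part-applyUpTo K (col κ) (subst (k <_) β-length k<)))))))

  nth-chain : ∀ k → k ≤ K → nth top chain k ≡ cut k
  nth-chain k k≤ = trans (cong (λ u → nth u chain k) (sym cut-0))
    (nth-applyUpTo cut (length β) (subst (k ≤_) (sym β-length) k≤))

  row-cut-convex : ∀ k r → row r (cut (suc k)) + row r (cut (suc k)) ≤ row r (cut (suc (suc k))) + row r (cut k)
  row-cut-convex k r with parity r
  ... | even a = subst₂ _≤_ (sym (cong₂ _+_ (eq (suc k)) (eq (suc k)))) (sym (cong₂ _+_ (eq (suc (suc k))) (eq k)))
    (∸-convex (part κ a) k)
    where
    eq : ∀ k → row (a + a) (cut k) ≡ part κ a ∸ k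
    eq k = trans (row-single (proj₁ (cut k)) a) (part-cut k a)
  ... | odd a = ≤-trans (≤-reflexive (cong₂ _+_ (row-odd a (proj₁ (cut (suc k))) [])
    (row-odd a (proj₁ (cut (suc k))) []))) z≤n

  chain-lattice : ∀ T → NoExcess (codes T J) top chain
  chain-lattice T = All.tabulate (λ {c} _ → no-excess (proj₁ c) (proj₂ c))
    where
    no-excess : ∀ t j → ¬ At (Excess t) j top chain
    no-excess t j e = <⇒≱ ex (begin
        pre t B + pre t B                    ≡⟨ cong₂ _+_ (pre-rows t B) (pre-rows t B) ⟩
        sm t (λ r → row r B) + sm t (λ r → row r B) ≡⟨ sym (sm-+ t (λ r → row r B) (λ r → row r B)) ⟩
        sm t (λ r → row r B + row r B)       ≤⟨ sm-mono t (λ r _ → row-cut-convex j r) ⟩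
        sm t (λ r → row r A + row r C)       ≡⟨ sm-+ t (λ r → row r A) (λ r → row r C) ⟩
        sm t (λ r → row r A) + sm t (λ r → row r C) ≡⟨ sym (cong₂ _+_ (pre-rows t A) (pre-rows t C)) ⟩
        pre t A + pre t C                    ∎)
      where
      open ≤-Reasoning
      A = cut (suc (suc j))
      B = cut (suc j)
      C = cut j
      j<K : suc j < K
      j<K = ≤-trans (at-length j e) (≤-reflexive (trans (List.length-applyUpTo (cut ∘ suc) (length β)) β-length))
      ex : Excess t A B C
      ex = subst₂ (λ A BC → Excess t A (proj₁ BC) (proj₂ BC)) (nth-chain (suc (suc j)) j<K)
        (cong₂ _,_ (nth-chain (suc j) (<⇒≤ j<K)) (nth-chain j (<⇒≤ (<⇒≤ j<K)))) (at-nth⁻ j e)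

  module _ {γ : List ℕ} {F : List Shape} (γ-length : length γ ≡ K) (ch : N.IsChain top γ F base)
    (lat : NoExcess (codes (suc W) J) top F) where
    private
      S : ℕ → Shape
      S = nth top F
      g : ℕ → ℕ → ℕ
      g a k = part (proj₁ (S k)) a

    S-inside : ∀ k → k ≤ K → N.Inside (S k)
    S-inside zero _ = (PW.refl ≤-refl , []) , top-desc
    S-inside (suc k) k<K = N.∈U⇒inside (proj₁ (N.chain-step ch k (subst (k <_) (sym γ-length) k<K)))

    S-second : ∀ k → k ≤ K → proj₂ (S k) ≡ []
    S-second k k≤ with proj₂ (S k) | proj₂ (proj₁ (S-inside k k≤))
    ... | [] | [] = refl

    g-step : ∀ a k → k < K → Step (g a (suc k)) (g a k)
    g-step a k k<K = pointwise-part (z≤n , z≤n)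
      (proj₁ (proj₁ (proj₂ (proj₂ (N.chain-step ch k (subst (k <_) (sym γ-length) k<K)))))) a

    g-end : ∀ a → g a K ≡ 0
    g-end a = trans (cong (λ S → part (proj₁ S) a) (trans (cong S (sym γ-length)) (N.chain-end ch))) (part-zeros ℓ a)
      where
      part-zeros : ∀ n a → part (fit n []) a ≡ 0
      part-zeros zero a = refl
      part-zeros (suc n) zero = refl
      part-zeros (suc n) (suc a) = part-zeros n a

    F-length : length F ≡ K
    F-length = trans (trans (cong length (N.chain-nth ch)) (List.length-applyUpTo _ (length γ))) γ-length

    pre-S : ∀ a k → k ≤ K → pre (a + a) (S k) ≡ sm a (λ a → g a k)
    pre-S a k k≤ = trans (cong (λ s → pre (a + a) (proj₁ (S k) , s)) (S-second k k≤)) (pre-single (proj₁ (S k)) a)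

    -- The lattice condition says that the total of the first rows is convex in `k`. The prefix
    -- index is `a + a`, since the rows of the empty second component are read in between.
    prefix-convex : ∀ a k → a ≤ ℓ → suc k < K → sm a (λ a → g a (suc k)) + sm a (λ a → g a (suc k)) ≤ sm a
      (λ a → g a (suc (suc k))) + sm a (λ a → g a k)
    prefix-convex a k a≤ sk<K = subst₂ _≤_ (cong₂ _+_ (pre-S a (suc k) (<⇒≤ sk<K)) (pre-S a (suc k) (<⇒≤ sk<K)))
      (cong₂ _+_ (pre-S a (suc (suc k)) sk<K) (pre-S a k (<⇒≤ (<⇒≤ sk<K))))
      (≮⇒≥ (λ ex → All.lookup lat (codes-∈ (suc W) (s≤s (+-mono-≤ a≤ a≤)) (s≤s⁻¹ sk<K))
        (at-nth⁺ {Excess (a + a)} k (subst (suc (suc k) ≤_) (sym F-length) sk<K) ex)))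

    g-linear : ∀ a → (∀ a′ → a′ < a → ∀ k → k ≤ K → g a′ k ≡ part κ a′ ∸ k) → ∀ k → suc k < K →
      (∀ a′ → a′ < a → suc k < part κ a′) →
      sm a (λ a → g a (suc (suc k))) + sm a (λ a → g a k) ≡ sm a (λ a → g a (suc k)) + sm a (λ a → g a (suc k))
    g-linear a ih k sk<K long = trans (sym (sm-+ a (λ a → g a (suc (suc k))) (λ a → g a k)))
      (trans (sm-cong a (λ a′ a′< →
        trans (cong₂ _+_ (ih a′ a′< (suc (suc k)) sk<K) (ih a′ a′< k (<⇒≤ (<⇒≤ sk<K))))
          (trans (∸-linear (part κ a′) k (long a′ a′<))
          (sym (cong₂ _+_ (ih a′ a′< (suc k) (<⇒≤ sk<K)) (ih a′ a′< (suc k) (<⇒≤ sk<K)))))))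
      (sm-+ a (λ a → g a (suc k)) (λ a → g a (suc k))))

    -- The total of the rows up to `a` is convex in `k`, and the rows above `a`, known by induction,
    -- are linear in `k` until they run out, so their difference is convex. If the row just above
    -- has run out at `k + 1`, then so has row `a`, as the shape is a partition.
    g-convex : ∀ a → a < ℓ → (∀ a′ → a′ < a → ∀ k → k ≤ K → g a′ k ≡ part κ a′ ∸ k) →
      ∀ k → suc k < K → g a (suc k) + g a (suc k) ≤ g a (suc (suc k)) + g a k
    g-convex a a< ih k sk<K with short a ih
      where
      short : ∀ a → (∀ a′ → a′ < a → ∀ k → k ≤ K → g a′ k ≡ part κ a′ ∸ k) → (∀ a′ → a′ < a → suc k < part κ a′) ⊎ g a
        (suc k) ≡ 0
      short zero ih = inj₁ (λ _ ())
      short (suc a) ih with suc k <? part κ a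
      ... | yes p = inj₁ (λ a′ a′< → ≤-trans p (isPartition⇒≤ κ (desc⇒isPartition κ-desc) (s≤s⁻¹ a′<)))
      ... | no ¬p = inj₂ (n≤0⇒n≡0 (≤-trans (desc⇒isPartition (proj₁ (proj₂ (S-inside (suc k) (<⇒≤ sk<K)))) a)
        (≤-reflexive (trans (ih a ≤-refl (suc k) (<⇒≤ sk<K)) (m≤n⇒m∸n≡0 (≮⇒≥ ¬p))))))
    ... | inj₂ e = ≤-trans (≤-reflexive (cong₂ _+_ e e)) z≤n
    ... | inj₁ long = +-cancelˡ-≤ (p + p) _ _ (begin
      p + p + (g a (suc k) + g a (suc k))   ≡⟨ +-interchange p p (g a (suc k)) (g a (suc k)) ⟩
      sm (suc a) (λ a → g a (suc k)) + sm (suc a) (λ a → g a (suc k)) ≤⟨ prefix-convex (suc a) k a< sk<K ⟩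
      sm (suc a) (λ a → g a (suc (suc k))) + sm (suc a) (λ a → g a k) ≡⟨ sym
        (+-interchange (sm a (λ a → g a (suc (suc k)))) (sm a (λ a → g a k)) (g a (suc (suc k))) (g a k)) ⟩
      sm a (λ a → g a (suc (suc k))) + sm a (λ a → g a k) + (g a (suc (suc k)) + g a k) ≡⟨ cong
        (_+ (g a (suc (suc k)) + g a k)) (g-linear a ih k sk<K long) ⟩
      p + p + (g a (suc (suc k)) + g a k)   ∎)
      where
      open ≤-Reasoning
      p = sm a (λ a → g a (suc k))

    g-cut : ∀ n a → a < n → n ≤ ℓ → ∀ k → k ≤ K → g a k ≡ part κ a ∸ k
    g-cut (suc n) a a<n n≤ = convex-steps K (g a) (g-step a) (g-end a)
      (g-convex a (≤-trans a<n n≤) (λ a′ a′< → g-cut n a′ (≤-trans a′< (s≤s⁻¹ a<n)) (<⇒≤ n≤)))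

    S-cut : ∀ k → k ≤ K → S k ≡ cut k
    S-cut k k≤ = cong₂ _,_ (part-ext (proj₁ (S k)) (proj₁ (cut k)) (trans len (sym (List.length-applyUpTo _ ℓ)))
      (λ a a< → let a<ℓ = subst (a <_) len a< in trans (g-cut ℓ a a<ℓ ≤-refl k k≤) (sym (part-cut k a)))) (S-second k k≤)
      where
      len : length (proj₁ (S k)) ≡ ℓ
      len = PW.Pointwise-length (proj₁ (proj₁ (S-inside k k≤)))

    chain-unique : F ≡ chain
    chain-unique = trans (N.chain-nth ch) (trans
      (applyUpTo-cong (length γ) (λ k k< → S-cut (suc k) (subst (k <_) γ-length k<)))
      (cong (applyUpTo (cut ∘ suc)) (trans γ-length (sym β-length))))

    content-unique : γ ≡ β
    content-unique = part-ext γ β (trans γ-length (sym β-length)) (λ k k< → let k<K = subst (k <_) γ-length k< in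
      +-cancelʳ-≡ (size (S (suc k))) _ _ (trans (sym (proj₂ (proj₂ (proj₂ (N.chain-step ch k k<)))))
        (trans (+-identityʳ _) (trans (cong size (S-cut k (<⇒≤ k<K)))
          (trans (cut-size k) (cong₂ _+_ (sym (part-applyUpTo K (col κ) k<K))
            (cong size (sym (S-cut (suc k) k<K)))))))))

  -- A lattice filling of a straight shape has a forced content too, namely the column lengths, so
  -- its number is the indicator of a single vector.
  straight-count : ∀ ξ → length ξ ≡ K → pos (#noExcess top base top-desc (codes (suc W) J) ξ) ≡ ind (addδ β ≟ₗ ξ)
  straight-count ξ ξ-length with addδ? ξ
  ... | no ¬δ = trans (cong pos (#noExcess-zero top base top-desc (codes (suc W) J) ξ ¬δ))
    (sym (ind-no (addδ β ≟ₗ ξ) (λ e → ¬δ (β , sym e))))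
  ... | yes (γ , refl) = trans (cong pos (#noExcess-addδ top base top-desc (codes (suc W) J) γ)) (go (β ≟ₗ γ))
    where
    L = filter (noExcess? (codes (suc W) J) top) (N.chains top γ base)
    unfilter : ∀ {F} → F ∈ L → N.IsChain top γ F base × NoExcess (codes (suc W) J) top F
    unfilter F∈ = let (c , n) = ∈-filter⁻ (noExcess? (codes (suc W) J) top) {xs = N.chains top γ base} F∈ in N.chains-sound top γ base c , n
    γ-length : length γ ≡ K
    γ-length = trans (sym (addδ-length γ)) ξ-length
    go : Dec (β ≡ γ) → pos (length L) ≡ ind (addδ β ≟ₗ addδ γ)
    go (yes refl) = trans (cong pos (length-singleton
      (Unique.filter⁺ (noExcess? (codes (suc W) J) top) (N.chains-unique top γ base)) chain
      (∈-filter⁺ (noExcess? (codes (suc W) J) top) (N.chains-complete cut-chain) (chain-lattice (suc W)))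
      (λ F∈ → chain-unique γ-length (proj₁ (unfilter F∈)) (proj₂ (unfilter F∈)))))
        (sym (ind-yes (addδ β ≟ₗ addδ γ) refl))
    go (no ne) = trans (cong pos (length-empty {xs = L}
      (λ F∈ → ne (sym (content-unique γ-length (proj₁ (unfilter F∈)) (proj₂ (unfilter F∈)))))))
      (sym (ind-no (addδ β ≟ₗ addδ γ) (ne ∘ addδ-injective β γ)))

-- The expansion of the product

decreasingᵇ⇒desc : ∀ κ → T (decreasingᵇ κ) → Desc κ
decreasingᵇ⇒desc [] _ = []
decreasingᵇ⇒desc (x ∷ []) _ = [-]
decreasingᵇ⇒desc (x ∷ y ∷ κ) t = ≤ᵇ⇒≤ y x (proj₁ (Equivalence.to T-∧ t)) ∷ decreasingᵇ⇒desc (y ∷ κ)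
  (proj₂ (Equivalence.to (T-∧ {y ≤ᵇ x}) t))

desc⇒decreasingᵇ : ∀ {κ} → Desc κ → T (decreasingᵇ κ)
desc⇒decreasingᵇ [] = tt
desc⇒decreasingᵇ [-] = tt
desc⇒decreasingᵇ (p ∷ d) = Equivalence.from T-∧ (≤⇒≤ᵇ p , desc⇒decreasingᵇ d)

Positive : List ℕ → Set
Positive = All (1 ≤_)

module Partitions (N : ℕ) where

  private
    test : List ℕ → Bool
    test κ = decreasingᵇ κ ∧ (sum κ ≡ᵇ N)
    lists : ℕ → List (List ℕ)
    lists k = listsOver k (letters N)

  ∈-partitionsOf⁻ : ∀ {κ} → κ ∈ partitionsOf N → Desc κ × sum κ ≡ N × Positive κ
  ∈-partitionsOf⁻ {κ} κ∈ with ∈-filter⁻ (T? ∘ test) {xs = concatMap lists (upTo (suc N))} κ∈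
  ... | p , t with Equivalence.to T-∧ t | ∈-concatMap-elim lists {upTo (suc N)} p
  ... | d , s | k , _ , q = decreasingᵇ⇒desc κ d , ≡ᵇ⇒≡ (sum κ) N s , All.map (proj₁ ∘ ∈-letters⁻)
    (proj₂ (∈-listsOver⁻ k (letters N) q))

  ∈-partitionsOf⁺ : ∀ {κ} → Desc κ → sum κ ≡ N → Positive κ → κ ∈ partitionsOf N
  ∈-partitionsOf⁺ {κ} d s p = ∈-filter⁺ (T? ∘ test)
    (∈-concatMap-intro lists (∈-upTo⁺ (s≤s (subst (length κ ≤_) s (length-≤-sum p))))
      (∈-listsOver⁺ (All.zipWith (λ (l , u) → ∈-letters⁺ l (subst (_ ≤_) s u)) (p , parts-≤-sum κ))))
    (Equivalence.from T-∧ (desc⇒decreasingᵇ d , ≡⇒≡ᵇ (sum κ) N s))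
    where
    length-≤-sum : ∀ {κ} → Positive κ → length κ ≤ sum κ
    length-≤-sum [] = z≤n
    length-≤-sum (p ∷ ps) = +-mono-≤ p (length-≤-sum ps)
    parts-≤-sum : ∀ κ → All (_≤ sum κ) κ
    parts-≤-sum [] = []
    parts-≤-sum (x ∷ κ) = m≤m+n x (sum κ) ∷ All.map (λ q → ≤-trans q (m≤n+m (sum κ) x)) (parts-≤-sum κ)

  partitionsOf-unique : Unique (partitionsOf N)
  partitionsOf-unique = Unique.filter⁺ (T? ∘ test) (concatMap-unique lists (Unique.upTo⁺ (suc N))
    (λ {k} _ → listsOver-unique k (letters-unique N))
    (λ {j} {k} _ _ p q → trans (sym (proj₁ (∈-listsOver⁻ j (letters N) p))) (proj₁ (∈-listsOver⁻ k (letters N) q))))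

-- Conjugation, and the contents of lattice fillings

col-desc : ∀ {κ} → Desc κ → ∀ k → col κ (suc k) ≤ col κ k
col-desc {κ} d k = ≮⇒≥ (λ lt → <-irrefl refl (proj₁ (col-iff d (col κ k) k)
  (<⇒≤ (proj₂ (col-iff d (col κ k) (suc k)) lt))))

sm-ones : ∀ n → sm n (λ _ → 1) ≡ n
sm-ones zero = refl
sm-ones (suc n) = trans (cong (_+ 1) (sm-ones n)) (+-comm n 1)

sum-col : ∀ {κ} → Desc κ → ∀ {K} → part κ 0 ≤ K → sm K (col κ) ≡ sum κ
sum-col {κ} d {K} h = trans (sm-cong K (λ k _ → sym (sm-ones (col κ k)))) (trans (sm-columns d K h (λ _ _ → 1))
  (trans (sm-cong (length κ) (λ i _ → sm-ones (part κ i))) (sym (sum-part κ refl))))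

conj : List ℕ → List ℕ
conj β = applyUpTo (col β) (part β 0)

module _ {β : List ℕ} (d : Desc β) where

  col-conj : ∀ k → col (conj β) k ≡ part β k
  col-conj k = trans (cong (λ n → sm n (λ i → ⟦ k <? part (conj β) i ⟧)) (List.length-applyUpTo (col β) (part β 0)))
    (trans (sm-cong (part β 0) (λ i i< → ⟦⟧-cong (k <? part (conj β) i) (i <? part β k)
      (λ p → proj₂ (col-iff d k i) (subst (k <_) (part-applyUpTo (part β 0) (col β) i<) p))
      (λ p → subst (k <_) (sym (part-applyUpTo (part β 0) (col β) i<)) (proj₁ (col-iff d k i) p))))
    (sm-below (part β 0) (isPartition⇒≤ β (desc⇒isPartition d) z≤n)))

  conj-desc : Desc (conj β)
  conj-desc = applyUpTo-desc (part β 0) (λ i _ → col-desc d i)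

  sum-conj : sum (conj β) ≡ sum β
  sum-conj = trans (sum-applyUpTo (part β 0) (col β)) (sum-col d ≤-refl)

  conj-positive : Positive (conj β)
  conj-positive = All.applyUpTo⁺₁ (col β) (part β 0) (λ {i} p → proj₁ (col-iff d 0 i) p)

positive-part : ∀ {κ} → Positive κ → ∀ {i} → i < length κ → 0 < part κ i
positive-part (p ∷ ps) {zero} _ = p
positive-part (p ∷ ps) {suc i} (s≤s h) = positive-part ps h

-- Column lengths do not see trailing zeros. Positivity excludes them: then `col κ 0` is the number
-- of parts, and the parts are recovered from the columns.
col-injective : ∀ {κ κ′} K → Desc κ → Desc κ′ → Positive κ → Positive κ′ → part κ 0 ≤ K → part κ′ 0 ≤ K → 0 < K →
  (∀ k → k < K → col κ k ≡ col κ′ k) → κ ≡ κ′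
col-injective {κ} {κ′} K d d′ p p′ h h′ 0<K e = part-ext κ κ′
  (trans (sym (col-0 d p)) (trans (e 0 0<K) (col-0 d′ p′)))
  (λ i _ → ≤-antisym (half d d′ h e i) (half d′ d h′ (λ k k< → sym (e k k<)) i))
  where
  col-0 : ∀ {κ} → Desc κ → Positive κ → col κ 0 ≡ length κ
  col-0 {κ} d p = sm-all (length κ) (λ i → 0 <? part κ i) (λ i i< → positive-part p i<)
  half : ∀ {κ κ′} → Desc κ → Desc κ′ → part κ 0 ≤ K → (∀ k → k < K → col κ k ≡ col κ′ k) → ∀ i → part κ i ≤ part κ′ i
  half {κ} {κ′} d d′ h e i = ≮⇒≥ (λ lt → <-irrefl refl (proj₂ (col-iff d′ i (part κ′ i))
    (subst (i <_) (e (part κ′ i) (≤-trans lt (≤-trans (isPartition⇒≤ κ (desc⇒isPartition d) z≤n) h)))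
      (proj₁ (col-iff d i (part κ′ i)) lt))))

-- The lattice condition after all rows compares the total multiplicities of adjacent letters.
lattice-content-desc : ∀ top base n {J γ F} → Desc₂ top → length (proj₁ top) ≤ n → length (proj₂ top) ≤ n
  → length γ ≡ suc J →
  VChains.IsChain top (λ _ → 0) top γ F base → NoExcess (codes (suc (n + n)) J) top F → Desc γ
lattice-content-desc top base n {J} {γ} {F} d ℓ₁ ℓ₂ γ-length ch lat = subst Desc (applyUpTo-part γ)
  (applyUpTo-desc (length γ) decrease)
  where
  module N = VChains top (λ _ → 0)
  S : ℕ → Shape
  S = nth top F
  inside : ∀ k → k ≤ length γ → N.Inside (S k)
  inside zero _ = (PW.refl ≤-refl , PW.refl ≤-refl) , d
  inside (suc k) k< = N.∈U⇒inside (proj₁ (N.chain-step ch k k<))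
  pre-size : ∀ k → k ≤ length γ → pre (n + n) (S k) ≡ size (S k)
  pre-size k k≤ with inside k k≤
  ... | (p , p′) , _ = trans (pre-rows (n + n) (S k)) (sym (size-rows n (S k)
    (subst (_≤ n) (sym (PW.Pointwise-length p)) ℓ₁) (subst (_≤ n) (sym (PW.Pointwise-length p′)) ℓ₂)))
  step : ∀ k → k < length γ → size (S k) ≡ part γ k + size (S (suc k))
  step k k< = trans (sym (+-identityʳ _)) (proj₂ (proj₂ (proj₂ (N.chain-step ch k k<))))
  decrease : ∀ i → suc i < length γ → part γ (suc i) ≤ part γ i
  decrease i si< = +-cancelʳ-≤ (size (S (suc (suc i)))) (part γ (suc i)) (part γ i)
    (+-cancelˡ-≤ (size (S (suc i))) _ _ (begin
    size (S (suc i)) + (part γ (suc i) + size (S (suc (suc i)))) ≡⟨ cong (size (S (suc i)) +_)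
      (sym (step (suc i) si<)) ⟩
    size (S (suc i)) + size (S (suc i)) ≡⟨ cong₂ _+_ (sym (pre-size (suc i) (<⇒≤ si<)))
      (sym (pre-size (suc i) (<⇒≤ si<))) ⟩
    pre (n + n) (S (suc i)) + pre (n + n) (S (suc i)) ≤⟨ ≮⇒≥
      (λ ex → All.lookup lat (codes-∈ (suc (n + n)) ≤-refl (s≤s⁻¹ (subst (suc i <_) γ-length si<)))
        (at-nth⁺ {Excess (n + n)} i (subst (suc (suc i) ≤_)
          (sym (trans (cong length (N.chain-nth ch))
            (List.length-applyUpTo (λ k → S (suc k)) (length γ)))) si<) ex)) ⟩
    pre (n + n) (S (suc (suc i))) + pre (n + n) (S i) ≡⟨ cong₂ _+_ (pre-size (suc (suc i)) si<)
      (pre-size i (<⇒≤ (<⇒≤ si<))) ⟩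
    size (S (suc (suc i))) + size (S i) ≡⟨ cong (size (S (suc (suc i))) +_) (step i (<⇒≤ si<)) ⟩
    size (S (suc (suc i))) + (part γ i + size (S (suc i))) ≡⟨ x∙yz≈z∙yx (size (S (suc (suc i)))) (part γ i)
      (size (S (suc i))) ⟩
    size (S (suc i)) + (part γ i + size (S (suc (suc i)))) ∎))
    where
    open ≤-Reasoning

cells-length : ∀ λ' μ → μ ⊆ₚ λ' → length (cells λ' μ) + sum (fit (length λ') μ) ≡ sum λ'
cells-length λ' μ μ⊆λ = trans (cong₂ _+_ (trans (ones (cells λ' μ))
  (trans (sum-cells (λ _ → 1) λ' μ) (sm-cong (length λ') (λ r _ → sm-ones (part λ' r ∸ part μ r)))))
    (sum-applyUpTo (length λ') (part μ)))
  (trans (sym (sm-+ (length λ') (λ r → part λ' r ∸ part μ r) (part μ)))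
    (trans (sm-cong (length λ') (λ r _ → m∸n+n≡m (μ⊆λ r))) (sym (sum-part λ' refl))))
  where
  ones : ∀ {A : Set} (xs : List A) → length xs ≡ sum (map (λ _ → 1) xs)
  ones [] = refl
  ones (x ∷ xs) = cong suc (ones xs)

-- Vanishing of the difference between the product and its expansion

vcount v̂count : Shape → Shape → List ℕ → ℤ
vcount top z β = pos (VChains.#chains top (λ _ → 0) top β z)
v̂count top z ξ = pos (VChains.#chains top id top ξ z)

mixedCount : Shape → Shape → List ℕ → List ℕ → ℤ
mixedCount top z α β = ∑ (Inside.U top) (λ u → pos (VChains.#chains top (λ _ → 0) u β z) *ℤ pos
  (HChains.#chains top u α top))

module Main (λ' μ ν ρ : List ℕ) (λ-part : IsPartition λ') (μ-part : IsPartition μ) (μ⊆λ : μ ⊆ₚ λ')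
  (ν-part : IsPartition ν) (ρ-part : IsPartition ρ) (ρ⊆ν : ρ ⊆ₚ ν) where

  open Shuffle λ' μ ν ρ λ-part μ-part μ⊆λ ν-part ρ-part ρ⊆ν hiding (w)

  N : ℕ
  N = length (cells λ' μ) + length (cells ν ρ)

  κs : List (List ℕ)
  κs = partitionsOf N

  open Partitions N

  top-size : N + size base ≡ size top
  top-size = trans (+-interchange (length (cells λ' μ)) (length (cells ν ρ)) _ _)
    (cong₂ _+_ (cells-length λ' μ μ⊆λ) (cells-length ν ρ ρ⊆ν))

  c : List ℕ → ℤ
  c κ = pos (peelableCount λ' μ ν ρ κ)

  κtop κbase : List ℕ → Shape
  κtop κ = κ , []
  κbase κ = fit (length κ) [] , []

  κtop-desc : ∀ {κ} → κ ∈ κs → Desc₂ (κtop κ)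
  κtop-desc κ∈ = proj₁ (∈-partitionsOf⁻ κ∈) , []

  part-≤N : ∀ {κ} → κ ∈ κs → part κ 0 ≤ N
  part-≤N {[]} _ = z≤n
  part-≤N {x ∷ κ} κ∈ = subst (x ≤_) (proj₁ (proj₂ (∈-partitionsOf⁻ κ∈))) (m≤m+n x (sum κ))

  -- A count for the given pair of skew shapes minus the same count for the straight shapes,
  -- weighted by the peelable numbers. All relations between counts are linear and therefore pass to
  -- this difference; the theorem is its vanishing for horizontal strips.
  combine : (Shape → Shape → ℤ) → ℤ
  combine m = m top base +ℤ ∑ κs (λ κ → negℤ c κ *ℤ m (κtop κ) (κbase κ))

  combine-cong : ∀ m m′ → m top base ≡ m′ top base → (∀ {κ} → κ ∈ κs → m (κtop κ) (κbase κ) ≡ m′ (κtop κ) (κbase κ))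
    → combine m ≡ combine m′
  combine-cong m m′ e e′ = cong₂ _+ℤ_ e (∑-cong κs (λ {κ} κ∈ → cong (negℤ c κ *ℤ_) (e′ κ∈)))

  combine-zero : ∀ m → m top base ≡ 0ℤ → (∀ {κ} → κ ∈ κs → m (κtop κ) (κbase κ) ≡ 0ℤ) → combine m ≡ 0ℤ
  combine-zero m e e′ = cong₂ _+ℤ_ e (∑-zero κs
    (λ {κ} κ∈ → trans (cong (negℤ c κ *ℤ_) (e′ κ∈)) (ℤ.*-zeroʳ (negℤ c κ))))

  v v̂ : List ℕ → Shape → Shape → ℤ
  v β t b = vcount t b β
  v̂ ξ t b = v̂count t b ξ

  V V̂ : List ℕ → ℤ
  V β = combine (v β)
  V̂ ξ = combine (v̂ ξ)

  V-symmetric : Symmetric V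
  V-symmetric k β = combine-cong (v (swapAt k β)) (v β) (cong pos (#V-symmetric top base top-desc k β))
    (λ {κ} κ∈ → cong pos (#V-symmetric (κtop κ) (κbase κ) (κtop-desc κ∈) k β))

  V̂-addδ : ∀ β → V̂ (addδ β) ≡ V β
  V̂-addδ β = combine-cong (v̂ (addδ β)) (v β) (cong pos (#V̂-addδ top base top-desc β))
    (λ {κ} κ∈ → cong pos (#V̂-addδ (κtop κ) (κbase κ) (κtop-desc κ∈) β))

  V̂-zero : ∀ ξ → (∃ λ β → ξ ≡ addδ β) ⊎ V̂ ξ ≡ 0ℤ
  V̂-zero ξ with addδ? ξ
  ... | yes p = inj₁ p
  ... | no ¬p = inj₂ (combine-zero (v̂ ξ) (cong pos (#V̂-zero top base top-desc ξ ¬p))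
    (λ {κ} κ∈ → cong pos (#V̂-zero (κtop κ) (κbase κ) (κtop-desc κ∈) ξ ¬p)))

  κbase-size : ∀ κ → size (κbase κ) ≡ 0
  κbase-size κ = trans (+-identityʳ _) (trans (sum-applyUpTo (length κ) (part []))
    (sm-zero (length κ) (λ _ _ → refl)))

  V-size-zero : ∀ β → sum β ≢ N → V β ≡ 0ℤ
  V-size-zero β ne = combine-zero (v β)
    (cong pos (#V-size top base top-desc β (λ e → ne (+-cancelʳ-≡ (size base) (sum β) N (trans e (sym top-size))))))
    (λ {κ} κ∈ → cong pos (#V-size (κtop κ) (κbase κ) (κtop-desc κ∈) β (λ e → ne (trans (sym (+-identityʳ (sum β)))
      (trans (cong (sum β +_) (sym (κbase-size κ)))
        (trans e (trans (+-identityʳ _) (proj₁ (proj₂ (∈-partitionsOf⁻ κ∈))))))))))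

  -- With `K = suc J` letters, more than `N`, the column lengths of every partition of `N` fit into
  -- a content of length `K`.
  module _ (J : ℕ) (N≤J : N ≤ J) where
    private
      K = suc J

    κ≤K : ∀ {κ} → κ ∈ κs → part κ 0 ≤ K
    κ≤K κ∈ = m≤n⇒m≤1+n (≤-trans (part-≤N κ∈) N≤J)

    β-of : List ℕ → List ℕ
    β-of κ = applyUpTo (col κ) K

    β-of-desc : ∀ {κ} → κ ∈ κs → Desc (β-of κ)
    β-of-desc κ∈ = applyUpTo-desc K (λ k _ → col-desc (proj₁ (∈-partitionsOf⁻ κ∈)) k)

    β-of-sum : ∀ {κ} → κ ∈ κs → sum (β-of κ) ≡ N
    β-of-sum {κ} κ∈ = trans (sum-applyUpTo K (col κ))
      (trans (sum-col (proj₁ (∈-partitionsOf⁻ κ∈)) (κ≤K κ∈)) (proj₁ (proj₂ (∈-partitionsOf⁻ κ∈))))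

    β-of-injective : ∀ {κ κ′} → κ ∈ κs → κ′ ∈ κs → β-of κ ≡ β-of κ′ → κ ≡ κ′
    β-of-injective {κ} {κ′} κ∈ κ∈′ e = col-injective K (proj₁ p) (proj₁ p′) (proj₂ (proj₂ p)) (proj₂ (proj₂ p′))
      (κ≤K κ∈) (κ≤K κ∈′) (s≤s z≤n)
      (λ k k< → trans (sym (part-applyUpTo K (col κ) k<))
        (trans (cong (λ l → part l k) e) (part-applyUpTo K (col κ′) k<)))
      where
      p = ∈-partitionsOf⁻ κ∈
      p′ = ∈-partitionsOf⁻ κ∈′

    lattices : List ℕ → ℕ
    lattices = #noExcess top base top-desc (codes (suc (rows + rows)) J)

    c-lattices : ∀ {κ} → κ ∈ κs → c κ ≡ pos (lattices (addδ (β-of κ)))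
    c-lattices {κ} κ∈ = cong pos (trans (peelableCount-chains κ (proj₁ (∈-partitionsOf⁻ κ∈)) J (κ≤K κ∈))
      (sym (#noExcess-addδ top base top-desc (codes (suc (rows + rows)) J) (β-of κ))))

    lattices-content : ∀ γ → length γ ≡ K → ¬ (Desc γ × sum γ ≡ N) → lattices (addδ γ) ≡ 0
    lattices-content γ γ-length bad = trans (#noExcess-addδ top base top-desc cs γ)
      (length-empty {xs = filter (noExcess? cs top) (NC.chains top γ base)} (λ F∈ →
      let (F∈′ , n) = ∈-filter⁻ (noExcess? cs top) {xs = NC.chains top γ base} F∈
          ch = NC.chains-sound top γ base F∈′
      in bad (lattice-content-desc top base rows top-desc (m≤m+n (length λ') (length ν))
        (m≤n+m (length ν) (length λ')) γ-length ch n ,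
        +-cancelʳ-≡ (size base) (sum γ) N (trans (sym (V-size top base top-desc ch)) (sym top-size)))))
      where
      module NC = VChains top (λ _ → 0)
      cs = codes (suc (rows + rows)) J

    -- A lattice filling has as content a partition γ of `N`, and the tableaux that correspond to it
    -- have the conjugate shape. So at ξ = γ + δ exactly the term with κ = `conj γ` survives, and
    -- elsewhere both sides are zero.
    expansion : ∀ ξ → length ξ ≡ K → ∑ κs (λ κ → c κ *ℤ ind (addδ (β-of κ) ≟ₗ ξ)) ≡ pos (lattices ξ)
    expansion ξ ξ-length with addδ? ξ
    ... | no ¬δ = trans (∑-zero κs (λ {κ} _ → trans
      (cong (c κ *ℤ_) (ind-no (addδ (β-of κ) ≟ₗ ξ) (λ e → ¬δ (β-of κ , sym e)))) (ℤ.*-zeroʳ (c κ))))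
      (cong pos (sym (#noExcess-zero top base top-desc (codes (suc (rows + rows)) J) ξ ¬δ)))
    ... | yes (γ , refl) with desc? γ ×-dec (sum γ ≟ N)
    ... | no bad = trans (∑-zero κs (λ {κ} κ∈ → trans (cong (c κ *ℤ_) (ind-no (addδ (β-of κ) ≟ₗ addδ γ)
          (λ e → let eq = addδ-injective (β-of κ) γ e in bad (subst Desc eq (β-of-desc κ∈) , trans (cong sum (sym eq)) (β-of-sum κ∈))))) (ℤ.*-zeroʳ (c κ))))
        (cong pos (sym (lattices-content γ (trans (sym (addδ-length γ)) ξ-length) bad)))
    ... | yes (γ-desc , γ-sum) = trans (∑-single partitionsOf-unique κ∈ _
          (λ {κ′} κ∈′ ne → trans (cong (c κ′ *ℤ_)
            (ind-no (addδ (β-of κ′) ≟ₗ addδ γ)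
              (λ e → ne (β-of-injective κ∈′ κ∈ (trans (addδ-injective (β-of κ′) γ e) (sym βκ≡γ))))))
            (ℤ.*-zeroʳ (c κ′))))
        (trans (cong₂ _*ℤ_ (c-lattices κ∈) (ind-yes (addδ (β-of κ) ≟ₗ addδ γ) (cong addδ βκ≡γ)))
          (trans (ℤ.*-identityʳ _) (cong (pos ∘ lattices ∘ addδ) βκ≡γ)))
      where
      κ = conj γ
      κ∈ : κ ∈ κs
      κ∈ = ∈-partitionsOf⁺ (conj-desc γ-desc) (trans (sum-conj γ-desc) γ-sum) (conj-positive γ-desc)
      γ-length : length γ ≡ K
      γ-length = trans (sym (addδ-length γ)) ξ-length
      βκ≡γ : β-of κ ≡ γ
      βκ≡γ = trans (applyUpTo-cong K (λ k _ → col-conj γ-desc k))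
        (trans (cong (applyUpTo (part γ)) (sym γ-length)) (applyUpTo-part γ))

    -- Under the alternant every count may be replaced by that of the lattice fillings. For κ this
    -- is the indicator of one content, and by `expansion` the difference is then zero at every
    -- single vector, even before alternating.
    alt-V̂ : ∀ ξ → length ξ ≡ K → alt V̂ ξ ≡ 0ℤ
    alt-V̂ ξ ξ-length = begin
      alt V̂ ξ
        ≡⟨ expand (v̂count top base) (λ κ → v̂count (κtop κ) (κbase κ)) ⟩
      alt (v̂count top base) ξ +ℤ ∑ κs (λ κ → negℤ c κ *ℤ alt (v̂count (κtop κ) (κbase κ)) ξ)
        ≡⟨ cong₂ _+ℤ_ (alt-noExcess top base top-desc (suc (rows + rows)) ξ ξ-length)
             (∑-cong κs (λ {κ} κ∈ → cong (negℤ c κ *ℤ_)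
               (trans (alt-noExcess (κtop κ) (κbase κ) (κtop-desc κ∈) (suc (length κ + length κ)) ξ ξ-length)
               (alt-cong ξ (λ η e → Straight.straight-count κ (proj₁ (∈-partitionsOf⁻ κ∈)) J (κ≤K κ∈) η
                 (trans e ξ-length)))))) ⟩
      alt (pos ∘ lattices) ξ +ℤ ∑ κs (λ κ → negℤ c κ *ℤ alt (λ η → ind (addδ (β-of κ) ≟ₗ η)) ξ)
        ≡⟨ sym (expand (pos ∘ lattices) (λ κ η → ind (addδ (β-of κ) ≟ₗ η))) ⟩
      alt (λ η → pos (lattices η) +ℤ ∑ κs (λ κ → negℤ c κ *ℤ ind (addδ (β-of κ) ≟ₗ η))) ξ
        ≡⟨ alt-zero ξ (λ η e → trans (cong (pos (lattices η) +ℤ_) (negate η (trans e ξ-length)))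
          (ℤ.+-inverseʳ (pos (lattices η)))) ⟩
      0ℤ ∎
      where
      open ≡-Reasoning
      expand : ∀ (f : List ℕ → ℤ) (g : List ℕ → List ℕ → ℤ) →
        alt (λ η → f η +ℤ ∑ κs (λ κ → negℤ c κ *ℤ g κ η)) ξ ≡ alt f ξ +ℤ ∑ κs (λ κ → negℤ c κ *ℤ alt (g κ) ξ)
      expand f g = trans (alt-+ f (λ η → ∑ κs (λ κ → negℤ c κ *ℤ g κ η)) ξ) (cong (alt f ξ +ℤ_)
        (trans (alt-∑ κs (λ κ η → negℤ c κ *ℤ g κ η) ξ) (∑-cong κs (λ {κ} _ → alt-* (negℤ c κ) (g κ) ξ))))
      negate : ∀ η → length η ≡ K → ∑ κs (λ κ → negℤ c κ *ℤ ind (addδ (β-of κ) ≟ₗ η)) ≡ negℤ pos (lattices η)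
      negate η e = trans (∑-cong κs (λ {κ} _ → l (c κ) (ind (addδ (β-of κ) ≟ₗ η))))
        (trans (∑-*ˡ -1ℤ κs (λ κ → c κ *ℤ ind (addδ (β-of κ) ≟ₗ η)))
        (trans (cong (-1ℤ *ℤ_) (expansion η e)) (ℤ.-1*i≡-i (pos (lattices η)))))
        where
        l : ∀ a b → negℤ a *ℤ b ≡ -1ℤ *ℤ (a *ℤ b)
        l = ℤR.solve-∀

    V-vanishes-long : ∀ β → length β ≡ K → V β ≡ 0ℤ
    V-vanishes-long = vanishing N K V V̂ V-symmetric (λ β _ → V̂-addδ β) (λ ξ _ → V̂-zero ξ) alt-V̂ V-size-zero

  base∈U : base ∈ Inside.U top
  base∈U = Inside.inside⇒∈U top ((base≤₁ , base≤₂) , base-desc)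

  κbase∈U : ∀ {κ} → κ ∈ κs → κbase κ ∈ Inside.U (κtop κ)
  κbase∈U {κ} κ∈ = Inside.inside⇒∈U (κtop κ) ((subst (Pointwise _≤_ (fit (length κ) [])) (applyUpTo-part κ)
    (applyUpTo-pointwise (length κ) (λ _ _ → z≤n)) , []) ,
    (applyUpTo-desc (length κ) (λ _ _ → z≤n) , []))

  module MD = Mixed top base top-desc base∈U
  module Mκ {κ : List ℕ} (κ∈ : κ ∈ κs) = Mixed (κtop κ) (κbase κ) (κtop-desc κ∈) (κbase∈U κ∈)

  V-0 : ∀ β → V (0 ∷ β) ≡ V β
  V-0 β = combine-cong (v (0 ∷ β)) (v β) (MD.v-0 top β MD.top∈U) (λ {κ} κ∈ → Mκ.v-0 κ∈ (κtop κ) β (Mκ.top∈U κ∈))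

  -- Letters of multiplicity 0 change no count, so `β` can be padded until it has more than `N`
  -- letters, as the comparison of alternants requires.
  V-vanishes : ∀ β → V β ≡ 0ℤ
  V-vanishes β = trans (sym (pad (suc N))) (V-vanishes-long (N + length β) (m≤m+n N (length β)) (zeros (suc N))
    (zeros-length (suc N)))
    where
    zeros : ℕ → List ℕ
    zeros zero = β
    zeros (suc p) = 0 ∷ zeros p
    zeros-length : ∀ p → length (zeros p) ≡ p + length β
    zeros-length zero = refl
    zeros-length (suc p) = cong suc (zeros-length p)
    pad : ∀ p → V (zeros p) ≡ V β
    pad zero = refl
    pad (suc p) = trans (V-0 (zeros p)) (pad p)

  mixed : List ℕ → List ℕ → Shape → Shape → ℤ
  mixed α β t b = mixedCount t b α β

  W : List ℕ → List ℕ → ℤ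
  W α β = combine (mixed α β)

  W-alternating : ∀ n α β → ∑ (upTo (suc (suc n))) (λ j → sgn j *ℤ W ((suc n ∸ j) ∷ α) (j ∷ β)) ≡ 0ℤ
  W-alternating n α β = trans (∑-cong J (λ {j} _ → trans (ℤ.*-distribˡ-+ (sgn j) _ _)
    (cong (sgn j *ℤ M top base j +ℤ_)
      (trans (sym (∑-*ˡ (sgn j) κs _)) (∑-cong κs (λ {κ} _ → l (sgn j) (negℤ c κ) (M (κtop κ) (κbase κ) j)))))))
    (trans (∑-+ J (λ j → sgn j *ℤ M top base j) (λ j → ∑ κs (λ κ → negℤ c κ *ℤ (sgn j *ℤ M (κtop κ) (κbase κ) j))))
    (trans (cong (∑ J (λ j → sgn j *ℤ M top base j) +ℤ_)
      (trans (∑-swap J κs (λ j κ → negℤ c κ *ℤ (sgn j *ℤ M (κtop κ) (κbase κ) j)))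
      (∑-cong κs (λ {κ} _ → ∑-*ˡ (negℤ c κ) J (λ j → sgn j *ℤ M (κtop κ) (κbase κ) j)))))
    (combine-zero (λ t b → ∑ J (λ j → sgn j *ℤ M t b j)) (MD.mixed-alternating n α β)
      (λ κ∈ → Mκ.mixed-alternating κ∈ n α β))))
    where
    J = upTo (suc (suc n))
    M : Shape → Shape → ℕ → ℤ
    M t b j = mixedCount t b ((suc n ∸ j) ∷ α) (j ∷ β)
    l : ∀ a b c → a *ℤ (b *ℤ c) ≡ b *ℤ (a *ℤ c)
    l = ℤR.solve-∀

  W-vanishes : ∀ α β → W α β ≡ 0ℤ
  W-vanishes = mixed-vanishing W
    (λ β → trans (combine-cong (mixed [] β) (v β) (MD.mixed-[]ʰ β) (λ κ∈ → Mκ.mixed-[]ʰ κ∈ β)) (V-vanishes β))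
    (λ α β → combine-cong (mixed α (0 ∷ β)) (mixed α β) (MD.mixed-0ᵛ α β) (λ κ∈ → Mκ.mixed-0ᵛ κ∈ α β))
    (λ α β → combine-cong (mixed (0 ∷ α) β) (mixed α β) (MD.mixed-0ʰ α β) (λ κ∈ → Mκ.mixed-0ʰ κ∈ α β))
    W-alternating

  -- Without vertical letters the middle shape is forced to be `base`, and the mixed count is the
  -- number of chains that `convolution` splits.
  product-count : ∀ α → pos ((skewSchur λ' μ ·ₚ skewSchur ν ρ) α) ≡ mixedCount top base α []
  product-count α = trans (pos-sum (belowVec α) (λ β → skewSchur λ' μ β * skewSchur ν ρ (zipWith _∸_ α β)))
    (trans (∑-cong (belowVec α) (λ {β} _ → trans (ℤ.pos-* (skewSchur λ' μ β) (skewSchur ν ρ (zipWith _∸_ α β)))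
      (cong₂ (λ a b → pos a *ℤ pos b)
      (skewSchur-chains λ' μ β λ-part μ-part μ⊆λ) (skewSchur-chains ν ρ (zipWith _∸_ α β) ν-part ρ-part ρ⊆ν))))
    (trans (sym (convolution λ' ν α (fit (length λ') μ) (fit (length ν) ρ))) (sym (MD.mixed-[]ᵛ α))))

  schur-count : ∀ α {κ} → κ ∈ κs → pos (skewSchur κ [] α) ≡ mixedCount (κtop κ) (κbase κ) α []
  schur-count α {κ} κ∈ = trans (cong pos (skewSchur-chains κ [] α (desc⇒isPartition (proj₁ (∈-partitionsOf⁻ κ∈)))
    (λ _ → z≤n) (λ _ → z≤n)))
    (trans (sym (hchains-single κ α (fit (length κ) []))) (sym (Mκ.mixed-[]ᵛ κ∈ α)))

theorem1p2 : (λ' μ ν ρ : List ℕ) → IsPartition λ' → IsPartition μ → μ ⊆ₚ λ' →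
    IsPartition ν → IsPartition ρ → ρ ⊆ₚ ν → (α : List ℕ) →
    (skewSchur λ' μ ·ₚ skewSchur ν ρ) α ≡
    sum (map (λ κ → peelableCount λ' μ ν ρ κ * skewSchur κ [] α)
    (partitionsOf (length (cells λ' μ) + length (cells ν ρ))))
theorem1p2 λ' μ ν ρ λ-part μ-part μ⊆λ ν-part ρ-part ρ⊆ν α = ℤ.+-injective (begin
  pos ((skewSchur λ' μ ·ₚ skewSchur ν ρ) α)
    ≡⟨ product-count α ⟩
  mixedCount top base α []
    -- `W α []`, with horizontal letters only, is the coefficient of the product minus that of the
    -- expansion.
    ≡⟨ difference _ _ (trans (cong (mixedCount top base α [] +ℤ_) (sym negated)) (W-vanishes α [])) ⟩
  ∑ κs (λ κ → c κ *ℤ mixedCount (κtop κ) (κbase κ) α [])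
    ≡⟨ ∑-cong κs (λ {κ} κ∈ → trans (cong (c κ *ℤ_) (sym (schur-count α κ∈)))
      (sym (ℤ.pos-* (peelableCount λ' μ ν ρ κ) (skewSchur κ [] α)))) ⟩
  ∑ κs (λ κ → pos (peelableCount λ' μ ν ρ κ * skewSchur κ [] α))
    ≡⟨ sym (pos-sum κs (λ κ → peelableCount λ' μ ν ρ κ * skewSchur κ [] α)) ⟩
  pos (sum (map (λ κ → peelableCount λ' μ ν ρ κ * skewSchur κ [] α) κs)) ∎)
  where
  open ≡-Reasoning
  open Main λ' μ ν ρ λ-part μ-part μ⊆λ ν-part ρ-part ρ⊆ν
  open Shuffle λ' μ ν ρ λ-part μ-part μ⊆λ ν-part ρ-part ρ⊆ν using (top; base)
  m : List ℕ → ℤ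
  m κ = mixedCount (κtop κ) (κbase κ) α []
  l : ∀ a b → negℤ a *ℤ b ≡ -1ℤ *ℤ (a *ℤ b)
  l = ℤR.solve-∀
  negated : ∑ κs (λ κ → negℤ c κ *ℤ m κ) ≡ negℤ ∑ κs (λ κ → c κ *ℤ m κ)
  negated = trans (∑-cong κs (λ {κ} _ → l (c κ) (m κ))) (trans (∑-*ˡ -1ℤ κs (λ κ → c κ *ℤ m κ)) (ℤ.-1*i≡-i _))
  difference : ∀ a b → a +ℤ negℤ b ≡ 0ℤ → a ≡ b
  difference a b e = ℤ.i-j≡0⇒i≡j a b e
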